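{- Let $q=p^h$, $p$ prime, $n\ge2$, $1\le k\le n-1$. Let $B$ be a minimal $(n-k)$-blocking set in $PG(n,q)$ of size $q^{n-k}+x$ with $x<(q^{n-k}+1)/2$, and suppose there is an $(n-k)$-dimensional subspace $T$ meeting $B$ in exactly $x$ points. Then the difference of the incidence vectors of $B$ and $T$ is a codeword of $C_k(n,q)^\perp$ of weight $2q^{n-k}+\theta_{n-k-1}-x$.
   Context: $\theta_m=(q^{m+1}-1)/(q-1)$. An $(n-k)$-blocking set is a point set meeting every $k$-dimensional subspace; minimal means no proper subset has this property. $C_k(n,q)$ is the $p$-ary linear code spanned over $\mathbb{F}_p$ by the rows of the incidence matrix of $k$-dimensional subspaces versus points of $PG(n,q)$, and $C_k(n,q)^\perp$ its dual with respect to the standard scalar product. -}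

module Defs where

open import Level using (0ℓ)
open import Data.Nat as ℕ using (ℕ; zero; suc; _^_; NonZero)
open import Data.Nat.Primality using (Prime)
open import Data.Integer as ℤ using (ℤ; +_; _%ℕ_)
open import Data.Bool using (Bool; true; false; _∧_; if_then_else_)
open import Data.List as List using (List; []; _∷_; _++_; length; filter; map; concatMap)
open import Data.List.Membership.Propositional using (_∈_)
open import Data.List.Relation.Unary.Unique.Propositional using (Unique)
open import Data.Vec as Vec using (Vec; []; _∷_; zipWith; replicate)
open import Data.Product using (Σ; ∃; ∃-syntax; _×_; _,_)
open import Function.Bundles using (_⇔_)
open import Relation.Binary.PropositionalEquality using (_≡_; _≢_)
open import Relation.Nullary using (¬_; Dec; yes; no)
open import Relation.Nullary.Decidable using (⌊_⌋)
open import Relation.Binary.Definitions using (DecidableEquality)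
import Algebra.Structures as AS

record FiniteField : Set₁ where
  infixl 6 _+_
  infixl 7 _*_
  field
    Carrier   : Set
    _+_ _*_   : Carrier → Carrier → Carrier
    -_        : Carrier → Carrier
    0# 1#     : Carrier
    isCommutativeRing : AS.IsCommutativeRing {A = Carrier} _≡_ _+_ _*_ -_ 0# 1#
    0≢1       : 0# ≢ 1#
    inverse   : ∀ a → a ≢ 0# → ∃[ b ] (a * b ≡ 1#)
    _≟_       : DecidableEquality Carrier
    elements  : List Carrier
    complete  : ∀ a → a ∈ elements
    unique    : Unique elements

  order : ℕ
  order = length elements

module PG (F : FiniteField) where
  open FiniteField F

  allVecs : (m : ℕ) → List (Vec Carrier m)
  allVecs zero = [] ∷ []
  allVecs (suc m) = concatMap (λ a → map (a ∷_) (allVecs m)) elements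

  -- Normalised vectors (first nonzero coordinate equal to 1): these are
  -- canonical representatives of the 1-dimensional subspaces of F^m.
  data NVec : ℕ → Set where
    lead  : ∀ {m} → Vec Carrier m → NVec (suc m)
    zcons : ∀ {m} → NVec m → NVec (suc m)

  toVec : ∀ {m} → NVec m → Vec Carrier m
  toVec (lead v)  = 1# ∷ v
  toVec (zcons p) = 0# ∷ toVec p

  allNVecs : (m : ℕ) → List (NVec m)
  allNVecs zero = []
  allNVecs (suc m) = map lead (allVecs m) ++ map zcons (allNVecs m)

  Point : ℕ → Set
  Point n = NVec (suc n)

  allPoints : (n : ℕ) → List (Point n)
  allPoints n = allNVecs (suc n)

  lincomb : ∀ {m N} → Vec Carrier m → Vec (Vec Carrier N) m → Vec Carrier N
  lincomb [] [] = replicate _ 0#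
  lincomb (c ∷ cs) (v ∷ vs) = zipWith _+_ (Vec.map (c *_) v) (lincomb cs vs)

  LinIndep : ∀ {m N} → Vec (Vec Carrier N) m → Set
  LinIndep {m} vs = ∀ (cs : Vec Carrier m) → lincomb cs vs ≡ replicate _ 0# → cs ≡ replicate _ 0#

  record Subspace (n d : ℕ) : Set where
    field
      basis  : Vec (Vec Carrier (suc n)) (suc d)
      indep  : LinIndep basis
      mem    : Vec Carrier (suc n) → Bool
      memSpec : ∀ v → (mem v ≡ true) ⇔ (∃[ cs ] (v ≡ lincomb cs basis))

  _∈S_ : ∀ {n d} → Point n → Subspace n d → Bool
  P ∈S S = Subspace.mem S (toVec P)

  PointSet : ℕ → Set
  PointSet n = Point n → Bool

  ∣_∣ : ∀ {n} → PointSet n → ℕ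
  ∣_∣ {n} B = length (filter (λ P → B P Data.Bool.≟ true) (allPoints n))

  _∩S_ : ∀ {n d} → PointSet n → Subspace n d → PointSet n
  (B ∩S S) P = B P ∧ (P ∈S S)

  _⊆_ : ∀ {n} → PointSet n → PointSet n → Set
  B ⊆ B' = ∀ P → B P ≡ true → B' P ≡ true

  -- an (n-k)-blocking set: meets every k-dimensional subspace
  Blocking : (n k : ℕ) → PointSet n → Set
  Blocking n k B = ∀ (S : Subspace n k) → ∃[ P ] (B P ≡ true × (P ∈S S) ≡ true)

  MinimalBlocking : (n k : ℕ) → PointSet n → Set
  MinimalBlocking n k B =
    Blocking n k B × (∀ B' → B' ⊆ B → Blocking n k B' → B ⊆ B')

  -- p-ary codes: words are functions Point n → ℤ, read modulo p.

  Word : ℕ → Set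
  Word n = Point n → ℤ

  χ : ∀ {n} → PointSet n → Word n
  χ B P = if B P then + 1 else + 0

  χS : ∀ {n d} → Subspace n d → Word n
  χS S P = if P ∈S S then + 1 else + 0

  sumℤ : List ℤ → ℤ
  sumℤ = List.foldr ℤ._+_ (+ 0)

  ⟨_,_⟩ : ∀ {n} → Word n → Word n → ℤ
  ⟨_,_⟩ {n} c c' = sumℤ (map (λ P → c P ℤ.* c' P) (allPoints n))

  _≡[mod_]_ : ℤ → (p : ℕ) → .{{NonZero p}} → ℤ → Set
  (a ≡[mod p ] b) = (a %ℕ p) ≡ (b %ℕ p)

  InC : (p : ℕ) .{{_ : NonZero p}} (n k : ℕ) → Word n → Set
  InC p n k c = ∃[ gens ] (∀ P → (c P ≡[mod p ]
      sumℤ (map (λ (g : ℤ × Subspace n k) → let (a , S) = g in a ℤ.* χS S P) gens)))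

  InC⊥ : (p : ℕ) .{{_ : NonZero p}} (n k : ℕ) → Word n → Set
  InC⊥ p n k c = ∀ c' → InC p n k c' → (⟨ c , c' ⟩ ≡[mod p ] (+ 0))

  weight : (p : ℕ) .{{_ : NonZero p}} {n : ℕ} → Word n → ℕ
  weight p {n} c = length (filter (λ P → ¬? ((c P %ℕ p) ℕ.≟ 0)) (allPoints n))
    where open import Relation.Nullary.Decidable using (¬?)

-- θ_m = (q^(m+1) - 1)/(q - 1) = 1 + q + ... + q^m
θ : ℕ → ℕ → ℕ
θ q zero = 1
θ q (suc m) = q ^ suc m ℕ.+ θ q m

{-# OPTIONS --safe #-}
module Submission where

-- Write m = n − k and Q = q^m. Points are evaluated at GF(q)-linear functionals V → K = GF(Q): the kernels of these are the
-- subspaces of codimension at most m, so B has a zero of every functional, and it suffices to show that every φ has 1 mod p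
-- zeros on B, because T also has 1 mod p points in every k-space, namely the θ_d points of some subspace.
--
-- Let D = B ∩ T and U = B ∖ T, so |D| = x and |U| = Q, and choose a functional l vanishing on T but nowhere on U. If φ has no
-- zero on D then φ / l maps U onto K, hence bijectively. Choosing ψ without zeros on D, this holds for φ + yψ for all but x
-- values of y, and Rédei's lacunary polynomial argument shows that φ / l is injective on U or takes all values 0 mod p times.
-- By minimality of B the first case is excluded when φ has a zero on D. So the count is right for functionals with at most
-- one zero on D. The others follow by induction on the number of these zeros, comparing two pencils of codimension-m
-- subspaces inside a subspace of codimension m − 1.
--
-- The field K is found as a simple submodule of the module of sequences over GF(q) with period Q − 1, on which X acts as the
-- shift: there X^Q = X, and a simple submodule on which no X^(q^d) − X with 1 ≤ d < m vanishes has dimension exactly m.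

open import Defs
open import Data.Nat as ℕ using (ℕ; zero; suc; z≤n; s≤s; NonZero)
import Data.Nat.Properties as ℕₚ
open import Data.Nat.Combinatorics using (_C_; nCk+nC[k+1]≡[n+1]C[k+1]; nCn≡1; nC1≡n; k>n⇒nCk≡0)
import Data.Nat.Divisibility as Div
open import Data.Nat.Divisibility using (_∣_; divides)
import Data.Nat.DivMod as DivMod
open import Data.Nat.GCD using (GCD; gcd; gcd[m,n]∣m; gcd[m,n]∣n; gcd-GCD; module Bézout)
open import Data.Nat.Primality using (Prime; euclidsLemma; prime⇒nonZero; prime⇒irreducible)
import Data.Nat.Solver
open import Data.Integer as ℤ using (ℤ; -[1+_]; _%ℕ_)
import Data.Integer.DivMod as ℤDivMod
import Data.Integer.Properties as ℤₚ
open import Data.Bool as Bool using (Bool; true; false; _∧_; not; if_then_else_)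
open import Data.Empty using (⊥; ⊥-elim)
open import Data.Fin as Fin using (Fin; toℕ; inject₁; punchIn; punchOut)
import Data.Fin.Properties as Finₚ
open import Data.Maybe using (Maybe; just; nothing)
open import Data.Product using (∃-syntax; _×_; _,_; proj₁; proj₂)
open import Data.Sum using (_⊎_; inj₁; inj₂; [_,_]′)
open import Data.List as List using (List; []; _∷_; _++_; length; filter; concatMap; deduplicate)
import Data.List.Properties as Listₚ
open import Data.List.Membership.Propositional using (_∈_; _∉_; find; lose)
open import Data.List.Membership.Propositional.Properties
  using (∈-∃++; ∈-++⁻; ∈-++⁺ˡ; ∈-++⁺ʳ; ∈-map⁺; ∈-map⁻; ∈-filter⁺; ∈-filter⁻; ∈-deduplicate⁺; ∈-deduplicate⁻; ∈-applyUpTo⁻)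
import Data.List.Membership.DecPropositional as DecMembership
open import Data.List.Relation.Unary.Any as Any using (here; there)
open import Data.List.Relation.Unary.All as All using ([]; _∷_)
import Data.List.Relation.Unary.All.Properties as Allₚ
open import Data.List.Relation.Unary.AllPairs using ([]; _∷_)
open import Data.List.Relation.Unary.Unique.Propositional using (Unique)
open import Data.List.Relation.Unary.Unique.Propositional.Properties
  using (Unique[x∷xs]⇒x∉xs; applyUpTo⁺₁) renaming (map⁺ to Unique-map⁺; ++⁺ to Unique-++⁺; filter⁺ to Unique-filter⁺)
open import Data.List.Relation.Unary.Unique.DecPropositional.Properties using (deduplicate-!)
open import Data.List.Relation.Binary.Permutation.Propositional as Perm using (_↭_; ↭-sym; ↭-trans; ↭-refl; ↭⇒↭ₛ)
open import Data.List.Relation.Binary.Permutation.Propositional.Properties using (shift; ↭-length; ∈-resp-↭)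
import Data.List.Relation.Binary.Permutation.Setoid.Properties as PermSetoid
open import Data.Vec as Vec using (Vec; []; _∷_; _∷ʳ_; zipWith; replicate; lookup; tabulate)
import Data.Vec.Properties as Vecₚ
open import Algebra.Bundles using (CommutativeRing; Semiring)
open import Algebra.Solver.Ring.AlmostCommutativeRing using (fromCommutativeRing; _-Raw-AlmostCommutative⟶_)
open import Function using (_∘_; _⇔_; mk⇔; Equivalence)
open import Relation.Binary.Definitions using (DecidableEquality)
open import Relation.Binary.PropositionalEquality as ≡
  using (_≡_; _≢_; refl; sym; trans; cong; cong₂; subst; module ≡-Reasoning)
open import Relation.Nullary using (¬_; Dec; yes; no)
open import Relation.Nullary.Decidable using (¬?; _×-dec_; _→-dec_; map′; ⌊_⌋; decidable-stable)

-- The role of `K` is to make the problem one-dimensional: `m` functionals over GF(q) become a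
-- single one with values in `K`, and division by `l` turns `U` into a list of exactly Q elements of
-- a field with Q elements. So onto means bijective, and the product of the factors X - a(u) has
-- degree exactly Q. The hypothesis x < (Q+1)/2 is used as 2x ≤ Q: at most x parameters y are bad,
-- so at least x are good, enough to kill a polynomial of degree below x. The polynomial argument
-- controls zeros on `U` only. For a functional with a zero on `D` it gives 0 mod p zeros on `U`, so
-- the total is known only if `D` contributes a single zero; nothing is known beforehand about how
-- `D` lies inside `T`, and this forces the separate induction for several zeros. Counts are sums of
-- `0#` and `1#` in the field, so that a congruence modulo p is an equality there. This equality is
-- decidable, which is why a field `K` known only up to double negation is enough.

private module ℕS = Data.Nat.Solver.+-*-Solver

-- Duplicate-free lists: pigeonhole and permutations.

module _ {a} {A : Set a} where

  -- The pigeonhole principle is kept as a permutation with remainder `zs`, so that sums and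
  -- products over `ys` can be rewritten over `xs`, not merely lengths compared.
  unique-⊆-split : ∀ {xs ys : List A} → Unique xs → (∀ {z} → z ∈ xs → z ∈ ys) → ∃[ zs ] (ys ↭ xs ++ zs)
  unique-⊆-split {[]} {ys} u xs⊆ys = ys , ↭-refl
  unique-⊆-split {x ∷ xs} u@(x≢ ∷ u') xs⊆ys with ∈-∃++ (xs⊆ys (here refl))
  ... | as , bs , refl = let zs , e = unique-⊆-split u' ⊆' in zs , ↭-trans (shift x as bs) (Perm.prep x e)
    where
    ⊆' : ∀ {z} → z ∈ xs → z ∈ as ++ bs
    ⊆' z∈ with ∈-++⁻ as (xs⊆ys (there z∈))
    ... | inj₁ p = ∈-++⁺ˡ p
    ... | inj₂ (here refl) = ⊥-elim (All.lookup x≢ z∈ refl)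
    ... | inj₂ (there p) = ∈-++⁺ʳ as p

  unique-⊆⇒length≤ : ∀ {xs ys : List A} → Unique xs → (∀ {z} → z ∈ xs → z ∈ ys) → length xs ℕ.≤ length ys
  unique-⊆⇒length≤ {xs} u xs⊆ys with unique-⊆-split u xs⊆ys
  ... | zs , e = ℕₚ.≤-trans (ℕₚ.m≤m+n (length xs) (length zs))
                   (ℕₚ.≤-reflexive (sym (trans (↭-length e) (Listₚ.length-++ xs))))

  unique-⊆⇒↭ : ∀ {xs ys : List A} → Unique xs → (∀ {z} → z ∈ xs → z ∈ ys) → length ys ℕ.≤ length xs → ys ↭ xs
  unique-⊆⇒↭ {xs} u xs⊆ys len with unique-⊆-split u xs⊆ys
  ... | [] , e = subst (_ ↭_) (Listₚ.++-identityʳ xs) e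
  ... | z ∷ zs , e = ⊥-elim (ℕₚ.m+1+n≰m (length xs)
          (subst (ℕ._≤ length xs) (trans (↭-length e) (Listₚ.length-++ xs)) len))

  Unique-resp-↭ : ∀ {xs ys : List A} → xs ↭ ys → Unique xs → Unique ys
  Unique-resp-↭ p = PermSetoid.Unique-resp-↭ (≡.setoid A) (↭⇒↭ₛ p)

-- Field arithmetic, finite sums and products, polynomials in one variable.

module FieldProps (F : FiniteField) where
  open FiniteField F public

  commutativeRing : CommutativeRing _ _
  commutativeRing = record { isCommutativeRing = isCommutativeRing }

  open CommutativeRing commutativeRing public
    using (+-assoc; +-comm; +-identityˡ; +-identityʳ; -‿inverseˡ; -‿inverseʳ; *-assoc; *-comm; *-identityˡ;
           *-identityʳ; distribˡ; distribʳ; zeroˡ; zeroʳ; semiring; commutativeSemiring; ring; +-abelianGroup)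
  open import Algebra.Properties.Semiring.Mult semiring public
    using (×-homo-+; ×1-homo-*) renaming (_×_ to _·ℕ_)
  open import Algebra.Properties.Semiring.Exp semiring public
    using (_^_; ^-homo-*; ^-assocʳ)
  open import Algebra.Properties.CommutativeSemiring.Exp commutativeSemiring public
    using (^-distrib-*)
  open import Algebra.Properties.Ring ring public
    using (-‿distribˡ-*; -‿distribʳ-*; -1*x≈-x)
  open import Algebra.Properties.AbelianGroup +-abelianGroup public
    using () renaming (⁻¹-∙-comm to -‿+-comm; ε⁻¹≈ε to -0≡0; ⁻¹-involutive to -‿involutive;
                       ∙-cancelˡ to +-cancelˡ; ∙-cancelʳ to +-cancelʳ)

  ⟦_⟧ : ℕ → Carrier
  ⟦ n ⟧ = n ·ℕ 1#

  -- Serves twice: as the coefficient homomorphism of the ring solver, and as reduction modulo p of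
  -- integer words, since in characteristic p exactly the multiples of p have image `0#`.
  ⟦_⟧ℤ : ℤ → Carrier
  ⟦ ℤ.+ n ⟧ℤ = ⟦ n ⟧
  ⟦ -[1+ n ] ⟧ℤ = - ⟦ suc n ⟧

  private
    interchange : ∀ a b c d → (a + b) + (c + d) ≡ (a + c) + (b + d)
    interchange a b c d = trans (+-assoc a b _) (trans (cong (a +_)
      (trans (sym (+-assoc b c d)) (trans (cong (_+ d) (+-comm b c)) (+-assoc c b d)))) (sym (+-assoc a c _)))

  ⊖-homo : ∀ m n → ⟦ m ℤ.⊖ n ⟧ℤ ≡ ⟦ m ⟧ + - ⟦ n ⟧
  ⊖-homo zero zero = sym (-‿inverseʳ 0#)
  ⊖-homo (suc m) zero = sym (trans (cong (⟦ suc m ⟧ +_) -0≡0) (+-identityʳ _))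
  ⊖-homo zero (suc n) = sym (+-identityˡ _)
  ⊖-homo (suc m) (suc n) = begin
    ⟦ suc m ℤ.⊖ suc n ⟧ℤ ≡⟨ cong ⟦_⟧ℤ (ℤₚ.[1+m]⊖[1+n]≡m⊖n m n) ⟩
    ⟦ m ℤ.⊖ n ⟧ℤ ≡⟨ ⊖-homo m n ⟩
    ⟦ m ⟧ + - ⟦ n ⟧ ≡⟨ +-identityˡ _ ⟨
    0# + (⟦ m ⟧ + - ⟦ n ⟧) ≡⟨ cong (_+ (⟦ m ⟧ + - ⟦ n ⟧)) (-‿inverseʳ 1#) ⟨
    (1# + - 1#) + (⟦ m ⟧ + - ⟦ n ⟧) ≡⟨ interchange _ _ _ _ ⟩
    (1# + ⟦ m ⟧) + (- 1# + - ⟦ n ⟧) ≡⟨ cong (⟦ suc m ⟧ +_) (-‿+-comm 1# ⟦ n ⟧) ⟩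
    ⟦ suc m ⟧ + - ⟦ suc n ⟧ ∎
    where open ≡-Reasoning

  ℤ-+-homo : ∀ i j → ⟦ i ℤ.+ j ⟧ℤ ≡ ⟦ i ⟧ℤ + ⟦ j ⟧ℤ
  ℤ-+-homo (ℤ.+ m) (ℤ.+ n) = ×-homo-+ 1# m n
  ℤ-+-homo (ℤ.+ m) -[1+ n ] = ⊖-homo m (suc n)
  ℤ-+-homo -[1+ m ] (ℤ.+ n) = trans (⊖-homo n (suc m)) (+-comm _ _)
  ℤ-+-homo -[1+ m ] -[1+ n ] = trans (cong -_ (trans (cong (λ k → ⟦ suc k ⟧) (sym (ℕₚ.+-suc m n)))
                                 (×-homo-+ 1# (suc m) (suc n)))) (sym (-‿+-comm _ _))

  ℤ-neg-homo : ∀ i → ⟦ ℤ.- i ⟧ℤ ≡ - ⟦ i ⟧ℤ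
  ℤ-neg-homo (ℤ.+ zero) = sym -0≡0
  ℤ-neg-homo (ℤ.+ suc n) = refl
  ℤ-neg-homo -[1+ n ] = sym (-‿involutive _)

  ℤ-*-homo⁺ : ∀ m j → ⟦ (ℤ.+ m) ℤ.* j ⟧ℤ ≡ ⟦ m ⟧ * ⟦ j ⟧ℤ
  ℤ-*-homo⁺ m (ℤ.+ n) = trans (cong ⟦_⟧ℤ (sym (ℤₚ.pos-* m n))) (×1-homo-* m n)
  ℤ-*-homo⁺ m -[1+ n ] = begin
    ⟦ (ℤ.+ m) ℤ.* ℤ.- (ℤ.+ suc n) ⟧ℤ ≡⟨ cong ⟦_⟧ℤ (sym (ℤₚ.neg-distribʳ-* (ℤ.+ m) (ℤ.+ suc n))) ⟩
    ⟦ ℤ.- ((ℤ.+ m) ℤ.* (ℤ.+ suc n)) ⟧ℤ ≡⟨ ℤ-neg-homo ((ℤ.+ m) ℤ.* (ℤ.+ suc n)) ⟩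
    - ⟦ (ℤ.+ m) ℤ.* (ℤ.+ suc n) ⟧ℤ ≡⟨ cong -_ (ℤ-*-homo⁺ m (ℤ.+ suc n)) ⟩
    - (⟦ m ⟧ * ⟦ suc n ⟧) ≡⟨ -‿distribʳ-* _ _ ⟩
    ⟦ m ⟧ * - ⟦ suc n ⟧ ∎
    where open ≡-Reasoning

  ℤ-*-homo : ∀ i j → ⟦ i ℤ.* j ⟧ℤ ≡ ⟦ i ⟧ℤ * ⟦ j ⟧ℤ
  ℤ-*-homo (ℤ.+ m) j = ℤ-*-homo⁺ m j
  ℤ-*-homo -[1+ m ] j = begin
    ⟦ ℤ.- (ℤ.+ suc m) ℤ.* j ⟧ℤ ≡⟨ cong ⟦_⟧ℤ (sym (ℤₚ.neg-distribˡ-* (ℤ.+ suc m) j)) ⟩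
    ⟦ ℤ.- ((ℤ.+ suc m) ℤ.* j) ⟧ℤ ≡⟨ ℤ-neg-homo ((ℤ.+ suc m) ℤ.* j) ⟩
    - ⟦ (ℤ.+ suc m) ℤ.* j ⟧ℤ ≡⟨ cong -_ (ℤ-*-homo⁺ (suc m) j) ⟩
    - (⟦ suc m ⟧ * ⟦ j ⟧ℤ) ≡⟨ -‿distribˡ-* _ _ ⟩
    - ⟦ suc m ⟧ * ⟦ j ⟧ℤ ∎
    where open ≡-Reasoning

  private
    ℤ⟶F : CommutativeRing.rawRing ℤₚ.+-*-commutativeRing -Raw-AlmostCommutative⟶ fromCommutativeRing commutativeRing
    ℤ⟶F = record
      { ⟦_⟧ = ⟦_⟧ℤ ; +-homo = ℤ-+-homo ; *-homo = ℤ-*-homo ; -‿homo = ℤ-neg-homo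
      ; 0-homo = refl ; 1-homo = +-identityʳ 1# }

    ℤ≟ : ∀ i j → Maybe (⟦ i ⟧ℤ ≡ ⟦ j ⟧ℤ)
    ℤ≟ i j with i ℤ.≟ j
    ... | yes e = just (cong ⟦_⟧ℤ e)
    ... | no _ = nothing

  module Solver where
    open import Algebra.Solver.Ring (CommutativeRing.rawRing ℤₚ.+-*-commutativeRing)
      (fromCommutativeRing commutativeRing) ℤ⟶F ℤ≟ public
      using (solve; _:=_; _:+_; _:*_; _:-_; :-_; con)

  open Solver

  x-y≡0⇒x≡y : ∀ {x y} → x + - y ≡ 0# → x ≡ y
  x-y≡0⇒x≡y {x} {y} e = begin
    x ≡⟨ solve 2 (λ x y → x := (x :+ :- y) :+ y) refl x y ⟩
    (x + - y) + y ≡⟨ cong (_+ y) e ⟩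
    0# + y ≡⟨ +-identityˡ y ⟩
    y ∎
    where open ≡-Reasoning

  x≡y⇒x-y≡0 : ∀ {x y} → x ≡ y → x + - y ≡ 0#
  x≡y⇒x-y≡0 refl = -‿inverseʳ _

  -- Total, with value `0#` at `0#`, so that quotients such as `ratio` are functions of all points;
  -- nonvanishing is asked for only where the inverse law is applied.
  _⁻¹ : Carrier → Carrier
  a ⁻¹ with a ≟ 0#
  ... | yes _ = 0#
  ... | no a≢0 = proj₁ (inverse a a≢0)

  ⁻¹-inverseʳ : ∀ {a} → a ≢ 0# → a * a ⁻¹ ≡ 1#
  ⁻¹-inverseʳ {a} a≢0 with a ≟ 0#
  ... | yes e = ⊥-elim (a≢0 e)
  ... | no a≢0' = proj₂ (inverse a a≢0')

  ⁻¹-inverseˡ : ∀ {a} → a ≢ 0# → a ⁻¹ * a ≡ 1#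
  ⁻¹-inverseˡ a≢0 = trans (*-comm _ _) (⁻¹-inverseʳ a≢0)

  *-cancelˡ : ∀ {a x y} → a ≢ 0# → a * x ≡ a * y → x ≡ y
  *-cancelˡ {a} {x} {y} a≢0 e = begin
    x ≡⟨ *-identityˡ x ⟨
    1# * x ≡⟨ cong (_* x) (⁻¹-inverseˡ a≢0) ⟨
    a ⁻¹ * a * x ≡⟨ *-assoc _ _ _ ⟩
    a ⁻¹ * (a * x) ≡⟨ cong (a ⁻¹ *_) e ⟩
    a ⁻¹ * (a * y) ≡⟨ *-assoc _ _ _ ⟨
    a ⁻¹ * a * y ≡⟨ cong (_* y) (⁻¹-inverseˡ a≢0) ⟩
    1# * y ≡⟨ *-identityˡ y ⟩
    y ∎
    where open ≡-Reasoning

  x*y≡0⇒y≡0 : ∀ {x y} → x ≢ 0# → x * y ≡ 0# → y ≡ 0#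
  x*y≡0⇒y≡0 x≢0 e = *-cancelˡ x≢0 (trans e (sym (zeroʳ _)))

  *-nonzero : ∀ {x y} → x ≢ 0# → y ≢ 0# → x * y ≢ 0#
  *-nonzero x≢0 y≢0 e = y≢0 (x*y≡0⇒y≡0 x≢0 e)

  *-zero-split : ∀ {x y} → x * y ≡ 0# → x ≡ 0# ⊎ y ≡ 0#
  *-zero-split {x} {y} e with x ≟ 0#
  ... | yes x≡0 = inj₁ x≡0
  ... | no x≢0 = inj₂ (x*y≡0⇒y≡0 x≢0 e)

  ⁻¹-nonzero : ∀ {a} → a ≢ 0# → a ⁻¹ ≢ 0#
  ⁻¹-nonzero {a} a≢0 e = 0≢1 (trans (sym (trans (cong (a *_) e) (zeroʳ a))) (⁻¹-inverseʳ a≢0))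

  x≡0⇒a+t*x≡a : ∀ {a t x} → x ≡ 0# → a + t * x ≡ a
  x≡0⇒a+t*x≡a {a} {t} refl = trans (cong (a +_) (zeroʳ t)) (+-identityʳ a)

  -- The pivot step used throughout: if two functionals take the values `a` and `b` at a vector,
  -- this multiple of the second corrects the first to vanish there.
  eliminate : ∀ a {b} → b ≢ 0# → a + - (a * b ⁻¹) * b ≡ 0#
  eliminate a {b} b≢0 = begin
    a + - (a * b ⁻¹) * b ≡⟨ solve 3 (λ a i b → a :+ :- (a :* i) :* b := a :- a :* (i :* b)) refl a (b ⁻¹) b ⟩
    a + - (a * (b ⁻¹ * b)) ≡⟨ cong (λ z → a + - (a * z)) (⁻¹-inverseˡ b≢0) ⟩
    a + - (a * 1#) ≡⟨ x≡y⇒x-y≡0 (sym (*-identityʳ a)) ⟩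
    0# ∎
    where open ≡-Reasoning

  -- Names the only root `t` as an explicit function of `a` and `b`, so that the parameters to be
  -- avoided form a list with one entry per point.
  linear-root : ∀ {a b t} → a ≢ 0# → b + t * a ≡ 0# → - b * a ⁻¹ ≡ t
  linear-root {a} {b} {t} a≢0 e = begin
    - b * a ⁻¹ ≡⟨ solve 4 (λ b t a i → :- b :* i := t :* (a :* i) :+ :- (b :+ t :* a) :* i) refl b t a (a ⁻¹) ⟩
    t * (a * a ⁻¹) + - (b + t * a) * a ⁻¹ ≡⟨ cong₂ (λ y z → t * y + - z * a ⁻¹) (⁻¹-inverseʳ a≢0) e ⟩
    t * 1# + - 0# * a ⁻¹ ≡⟨ cong₂ _+_ (*-identityʳ t) (trans (cong (_* a ⁻¹) -0≡0) (zeroˡ _)) ⟩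
    t + 0# ≡⟨ +-identityʳ t ⟩
    t ∎
    where open ≡-Reasoning

  ^-nonzero : ∀ {a} n → a ≢ 0# → a ^ n ≢ 0#
  ^-nonzero zero a≢0 e = 0≢1 (sym e)
  ^-nonzero (suc n) a≢0 = *-nonzero a≢0 (^-nonzero n a≢0)

  -- Valued in the field and not in `ℕ`: a sum of indicators is a count modulo the characteristic.
  ind : ∀ {a} {A : Set a} → Dec A → Carrier
  ind (yes _) = 1#
  ind (no _) = 0#

  ind-yes : ∀ {a} {A : Set a} (d : Dec A) → A → ind d ≡ 1#
  ind-yes (yes _) _ = refl
  ind-yes (no ¬a) a = ⊥-elim (¬a a)

  ind-no : ∀ {a} {A : Set a} (d : Dec A) → ¬ A → ind d ≡ 0#
  ind-no (yes a) ¬a = ⊥-elim (¬a a)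
  ind-no (no _) _ = refl

  ind-⇔ : ∀ {a b} {A : Set a} {B : Set b} (d : Dec A) (e : Dec B) → (A → B) → (B → A) → ind d ≡ ind e
  ind-⇔ (yes a) e f g = sym (ind-yes e (f a))
  ind-⇔ (no ¬a) e f g = sym (ind-no e (¬a ∘ g))

  module _ {ℓ} {A : Set ℓ} where

    ∑ : List A → (A → Carrier) → Carrier
    ∑ [] f = 0#
    ∑ (x ∷ xs) f = f x + ∑ xs f

    ∏ : List A → (A → Carrier) → Carrier
    ∏ [] f = 1#
    ∏ (x ∷ xs) f = f x * ∏ xs f

    ∑-cong∈ : ∀ xs {f g : A → Carrier} → (∀ {x} → x ∈ xs → f x ≡ g x) → ∑ xs f ≡ ∑ xs g
    ∑-cong∈ [] e = refl
    ∑-cong∈ (x ∷ xs) e = cong₂ _+_ (e (here refl)) (∑-cong∈ xs (e ∘ there))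

    ∑-cong : ∀ xs {f g : A → Carrier} → (∀ x → f x ≡ g x) → ∑ xs f ≡ ∑ xs g
    ∑-cong xs e = ∑-cong∈ xs (λ {x} _ → e x)

    ∑-+ : ∀ xs (f g : A → Carrier) → ∑ xs (λ x → f x + g x) ≡ ∑ xs f + ∑ xs g
    ∑-+ [] f g = sym (+-identityˡ 0#)
    ∑-+ (x ∷ xs) f g = trans (cong (_ +_) (∑-+ xs f g)) (interchange _ _ _ _)

    ∑-* : ∀ xs c (f : A → Carrier) → ∑ xs (λ x → c * f x) ≡ c * ∑ xs f
    ∑-* [] c f = sym (zeroʳ c)
    ∑-* (x ∷ xs) c f = trans (cong (_ +_) (∑-* xs c f)) (sym (distribˡ c _ _))

    ∑-zero : ∀ xs → ∑ xs (λ _ → 0#) ≡ 0#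
    ∑-zero [] = refl
    ∑-zero (x ∷ xs) = trans (+-identityˡ _) (∑-zero xs)

    ∑-const : ∀ xs c → ∑ xs (λ _ → c) ≡ ⟦ length xs ⟧ * c
    ∑-const [] c = sym (zeroˡ c)
    ∑-const (x ∷ xs) c = trans (cong (c +_) (∑-const xs c))
      (trans (cong (_+ (⟦ length xs ⟧ * c)) (sym (*-identityˡ c))) (sym (distribʳ c 1# _)))

    ∑-↭ : ∀ {xs ys} (f : A → Carrier) → xs ↭ ys → ∑ xs f ≡ ∑ ys f
    ∑-↭ f Perm.refl = refl
    ∑-↭ f (Perm.prep x p) = cong (f x +_) (∑-↭ f p)
    ∑-↭ f (Perm.swap {xs} {ys} x y p) = trans
      (solve 3 (λ a b c → a :+ (b :+ c) := b :+ (a :+ c)) refl (f x) (f y) (∑ xs f)) (cong (λ s → f y + (f x + s)) (∑-↭ f p))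
    ∑-↭ f (Perm.trans p q) = trans (∑-↭ f p) (∑-↭ f q)

    ∏-↭ : ∀ {xs ys} (f : A → Carrier) → xs ↭ ys → ∏ xs f ≡ ∏ ys f
    ∏-↭ f Perm.refl = refl
    ∏-↭ f (Perm.prep x p) = cong (f x *_) (∏-↭ f p)
    ∏-↭ f (Perm.swap {xs} {ys} x y p) = trans
      (solve 3 (λ a b c → a :* (b :* c) := b :* (a :* c)) refl (f x) (f y) (∏ xs f)) (cong (λ s → f y * (f x * s)) (∏-↭ f p))
    ∏-↭ f (Perm.trans p q) = trans (∏-↭ f p) (∏-↭ f q)

    ∏-nonzero : ∀ xs {f : A → Carrier} → (∀ {x} → x ∈ xs → f x ≢ 0#) → ∏ xs f ≢ 0#
    ∏-nonzero [] nz e = 0≢1 (sym e)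
    ∏-nonzero (x ∷ xs) nz = *-nonzero (nz (here refl)) (∏-nonzero xs (nz ∘ there))

    ∏-zero : ∀ {xs x} {f : A → Carrier} → x ∈ xs → f x ≡ 0# → ∏ xs f ≡ 0#
    ∏-zero {x ∷ xs} {f = f} (here refl) e = trans (cong (_* ∏ xs f) e) (zeroˡ _)
    ∏-zero {x ∷ xs} {f = f} (there p) e = trans (cong (f x *_) (∏-zero p e)) (zeroʳ _)

    ∏-zero⁻ : ∀ xs {f : A → Carrier} → ∏ xs f ≡ 0# → ∃[ x ] (x ∈ xs × f x ≡ 0#)
    ∏-zero⁻ [] e = ⊥-elim (0≢1 (sym e))
    ∏-zero⁻ (x ∷ xs) e with *-zero-split e
    ... | inj₁ z = x , here refl , z
    ... | inj₂ z = let y , y∈ , z' = ∏-zero⁻ xs z in y , there y∈ , z'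

    ∏-scale : ∀ xs c (f : A → Carrier) → ∏ xs (λ x → c * f x) ≡ c ^ length xs * ∏ xs f
    ∏-scale [] c f = sym (*-identityʳ 1#)
    ∏-scale (x ∷ xs) c f = trans (cong (_ *_) (∏-scale xs c f))
      (solve 4 (λ c a d b → c :* a :* (d :* b) := c :* d :* (a :* b)) refl c (f x) (c ^ length xs) (∏ xs f))

    ∑-++ : ∀ xs ys (f : A → Carrier) → ∑ (xs ++ ys) f ≡ ∑ xs f + ∑ ys f
    ∑-++ [] ys f = sym (+-identityˡ _)
    ∑-++ (x ∷ xs) ys f = trans (cong (f x +_) (∑-++ xs ys f)) (sym (+-assoc _ _ _))

    ∑-filter : ∀ {P : A → Set} (P? : ∀ x → Dec (P x)) xs (f : A → Carrier) → ∑ (List.filter P? xs) f ≡ ∑ xs (λ x → ind (P? x) * f x)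
    ∑-filter P? [] f = refl
    ∑-filter P? (x ∷ xs) f with P? x
    ... | yes _ = cong₂ _+_ (sym (*-identityˡ _)) (∑-filter P? xs f)
    ... | no _ = trans (∑-filter P? xs f) (sym (trans (cong (_+ ∑ xs (λ x → ind (P? x) * f x)) (zeroˡ _)) (+-identityˡ _)))

    ∑-ind : ∀ {P : A → Set} (P? : ∀ x → Dec (P x)) xs → ∑ xs (λ x → ind (P? x)) ≡ ⟦ length (List.filter P? xs) ⟧
    ∑-ind P? xs = trans (∑-cong xs (λ x → sym (*-identityʳ _))) (trans (sym (∑-filter P? xs (λ _ → 1#)))
      (trans (∑-const (List.filter P? xs) 1#) (*-identityʳ _)))

  module _ {ℓ ℓ'} {A : Set ℓ} {B : Set ℓ'} where

    ∑-swap : ∀ (xs : List A) (ys : List B) (f : A → B → Carrier) →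
             ∑ xs (λ x → ∑ ys (f x)) ≡ ∑ ys (λ y → ∑ xs (λ x → f x y))
    ∑-swap [] ys f = sym (∑-zero ys)
    ∑-swap (x ∷ xs) ys f = trans (cong (_ +_) (∑-swap xs ys f)) (sym (∑-+ ys (f x) _))

    ∑-map : ∀ (g : B → A) xs (f : A → Carrier) → ∑ (List.map g xs) f ≡ ∑ xs (f ∘ g)
    ∑-map g [] f = refl
    ∑-map g (x ∷ xs) f = cong (_ +_) (∑-map g xs f)

    ∏-map : ∀ (g : B → A) xs (f : A → Carrier) → ∏ (List.map g xs) f ≡ ∏ xs (f ∘ g)
    ∏-map g [] f = refl
    ∏-map g (x ∷ xs) f = cong (_ *_) (∏-map g xs f)

  -- Horner evaluation of the coefficients below the bound; a polynomial is a bound together with an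
  -- infinite sequence whose later terms are ignored.
  eval : ℕ → (ℕ → Carrier) → Carrier → Carrier
  eval zero e y = 0#
  eval (suc d) e y = e 0 + y * eval d (e ∘ suc) y

  -- Synthetic division: the coefficients of (e(X) - e(r)) / (X - r), the j-th being the part of `e`
  -- after index j evaluated at `r`.
  quot : ℕ → (ℕ → Carrier) → Carrier → ℕ → Carrier
  quot d e r zero = eval d (e ∘ suc) r
  quot zero e r (suc j) = 0#
  quot (suc d) e r (suc j) = quot d (e ∘ suc) r j

  eval-quot : ∀ d e r y → eval (suc d) e y + - eval (suc d) e r ≡ (y + - r) * eval d (quot d e r) y
  eval-quot zero e r y = solve 3 (λ c y r → (c :+ y :* con (ℤ.+ 0)) :- (c :+ r :* con (ℤ.+ 0)) := (y :- r) :* con (ℤ.+ 0)) refl (e 0) y r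
  eval-quot (suc d) e r y = begin
    (e 0 + y * Ey) + - (e 0 + r * Er)
      ≡⟨ solve 5 (λ c y r Ey Er → (c :+ y :* Ey) :- (c :+ r :* Er) := (y :- r) :* Er :+ y :* (Ey :- Er)) refl (e 0) y r Ey Er ⟩
    (y + - r) * Er + y * (Ey + - Er)
      ≡⟨ cong (λ z → (y + - r) * Er + y * z) (eval-quot d (e ∘ suc) r y) ⟩
    (y + - r) * Er + y * ((y + - r) * eval d (quot d (e ∘ suc) r) y)
      ≡⟨ solve 4 (λ y r Er t → (y :- r) :* Er :+ y :* ((y :- r) :* t) := (y :- r) :* (Er :+ y :* t)) refl y r Er _ ⟩
    (y + - r) * (Er + y * eval d (quot d (e ∘ suc) r) y) ∎
    where
    open ≡-Reasoning
    Ey = eval (suc d) (e ∘ suc) y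
    Er = eval (suc d) (e ∘ suc) r

  quot≡0⇒coeff≡0 : ∀ d e r → eval (suc d) e r ≡ 0# → (∀ j → j ℕ.< d → quot d e r j ≡ 0#) → ∀ j → j ℕ.< suc d → e j ≡ 0#
  quot≡0⇒coeff≡0 d e r ev q zero _ = begin
    e 0 ≡⟨ +-identityʳ _ ⟨
    e 0 + 0# ≡⟨ cong (e 0 +_) (trans (cong (r *_) (tail d q)) (zeroʳ r)) ⟨
    eval (suc d) e r ≡⟨ ev ⟩
    0# ∎
    where
    open ≡-Reasoning
    tail : ∀ d → (∀ j → j ℕ.< d → quot d e r j ≡ 0#) → eval d (e ∘ suc) r ≡ 0#
    tail zero q = refl
    tail (suc d) q = q 0 (s≤s z≤n)
  quot≡0⇒coeff≡0 zero e r ev q (suc j) (s≤s ())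
  quot≡0⇒coeff≡0 (suc d) e r ev q (suc j) (s≤s j<d) =
    quot≡0⇒coeff≡0 d (e ∘ suc) r (q 0 (s≤s z≤n)) (λ j j<d → q (suc j) (s≤s j<d)) j j<d

  -- Divide by one root; the remaining roots are roots of the quotient. The conclusion is about
  -- coefficients because over a finite field a polynomial can vanish at every point without being
  -- zero.
  roots⇒coeff≡0 : ∀ d e (rs : List Carrier) → Unique rs → d ℕ.≤ length rs → (∀ {r} → r ∈ rs → eval d e r ≡ 0#) →
                  ∀ j → j ℕ.< d → e j ≡ 0#
  roots⇒coeff≡0 zero e rs u len z j ()
  roots⇒coeff≡0 (suc d) e (r ∷ rs) (r≢ ∷ u) (s≤s len) z =
    quot≡0⇒coeff≡0 d e r (z (here refl)) (roots⇒coeff≡0 d (quot d e r) rs u len quot-root)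
    where
    quot-root : ∀ {s} → s ∈ rs → eval d (quot d e r) s ≡ 0#
    quot-root {s} s∈ = x*y≡0⇒y≡0 (λ e → All.lookup r≢ s∈ (sym (x-y≡0⇒x≡y e))) (trans (sym (eval-quot d e r s))
      (trans (cong₂ (λ a b → a + - b) (z (there s∈)) (z (here refl))) (-‿inverseʳ 0#)))

  eval-zero : ∀ d {e} → (∀ j → j ℕ.< d → e j ≡ 0#) → ∀ y → eval d e y ≡ 0#
  eval-zero zero z y = refl
  eval-zero (suc d) z y = trans (cong₂ (λ a b → a + y * b) (z 0 (s≤s z≤n)) (eval-zero d (λ j j<d → z (suc j) (s≤s j<d)) y))
    (trans (+-identityˡ _) (zeroʳ y))

  eval-+ : ∀ d e e' y → eval d (λ j → e j + e' j) y ≡ eval d e y + eval d e' y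
  eval-+ zero e e' y = sym (+-identityˡ 0#)
  eval-+ (suc d) e e' y = trans (cong (λ z → _ + y * z) (eval-+ d (e ∘ suc) (e' ∘ suc) y))
    (solve 5 (λ a b y s t → (a :+ b) :+ y :* (s :+ t) := (a :+ y :* s) :+ (b :+ y :* t)) refl _ _ y _ _)

  eval-* : ∀ d c e y → eval d (λ j → c * e j) y ≡ c * eval d e y
  eval-* zero c e y = sym (zeroʳ c)
  eval-* (suc d) c e y = trans (cong (λ z → _ + y * z) (eval-* d c (e ∘ suc) y))
    (solve 4 (λ c a y s → c :* a :+ y :* (c :* s) := c :* (a :+ y :* s)) refl c _ y _)

  eval-snoc : ∀ d e y → eval (suc d) e y ≡ eval d e y + e d * y ^ d
  eval-snoc zero e y = trans (solve 2 (λ a y → a :+ y :* con (ℤ.+ 0) := con (ℤ.+ 0) :+ a) refl (e 0) y) (cong (0# +_) (sym (*-identityʳ _)))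
  eval-snoc (suc d) e y = trans (cong (λ z → e 0 + y * z) (eval-snoc d (e ∘ suc) y))
    (solve 5 (λ a y s b t → a :+ y :* (s :+ b :* t) := (a :+ y :* s) :+ b :* (y :* t)) refl (e 0) y _ _ _)

  eval-trunc : ∀ {d d'} → d ℕ.≤ d' → ∀ {e} → (∀ j → d ℕ.≤ j → j ℕ.< d' → e j ≡ 0#) → ∀ y → eval d' e y ≡ eval d e y
  eval-trunc {d' = d'} z≤n z y = eval-zero d' (λ j → z j z≤n) y
  eval-trunc (s≤s le) z y = cong (λ t → _ + y * t) (eval-trunc le (λ j p q → z (suc j) (s≤s p) (s≤s q)) y)

  -- Degree strictly less than d.
  record IsPoly (d : ℕ) (f : Carrier → Carrier) : Set where
    constructor _,_
    field
      coeff : ℕ → Carrier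
      agrees : ∀ y → f y ≡ eval d coeff y

  poly-weaken : ∀ {d d' f} → d ℕ.≤ d' → IsPoly d f → IsPoly d' f
  poly-weaken {d} {d'} {f} le (e , h) = trunc , λ y → trans (h y) (trans (eval-agree d trunc-< y)
      (sym (eval-trunc le {trunc} (λ j p _ → trunc-≥ j p) y)))
    where
    trunc : ℕ → Carrier
    trunc j with j ℕ.<? d
    ... | yes _ = e j
    ... | no _ = 0#
    trunc-≥ : ∀ j → d ℕ.≤ j → trunc j ≡ 0#
    trunc-≥ j p with j ℕ.<? d
    ... | yes q = ⊥-elim (ℕₚ.<⇒≱ q p)
    ... | no _ = refl
    trunc-< : ∀ j → j ℕ.< d → e j ≡ trunc j
    trunc-< j p with j ℕ.<? d
    ... | yes _ = refl
    ... | no q = ⊥-elim (q p)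
    eval-agree : ∀ k {e e'} → (∀ j → j ℕ.< k → e j ≡ e' j) → ∀ y → eval k e y ≡ eval k e' y
    eval-agree zero h y = refl
    eval-agree (suc k) h y = cong₂ (λ a b → a + y * b) (h 0 (s≤s z≤n)) (eval-agree k (λ j p → h (suc j) (s≤s p)) y)

  poly-zero : ∀ d → IsPoly d (λ _ → 0#)
  poly-zero d = (λ _ → 0#) , λ y → sym (eval-zero d (λ _ _ → refl) y)

  poly-const : ∀ c → IsPoly 1 (λ _ → c)
  poly-const c = (λ _ → c) , λ y → sym (trans (cong (c +_) (zeroʳ y)) (+-identityʳ c))

  poly-+ : ∀ {d f g} → IsPoly d f → IsPoly d g → IsPoly d (λ y → f y + g y)
  poly-+ {d} (e , h) (e' , h') = (λ j → e j + e' j) , λ y → trans (cong₂ _+_ (h y) (h' y)) (sym (eval-+ d e e' y))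

  poly-scale : ∀ {d f} c → IsPoly d f → IsPoly d (λ y → c * f y)
  poly-scale {d} c (e , h) = (λ j → c * e j) , λ y → trans (cong (c *_) (h y)) (sym (eval-* d c e y))

  poly-X : ∀ {d f} → IsPoly d f → IsPoly (suc d) (λ y → y * f y)
  poly-X {d} (e , h) = (λ { zero → 0# ; (suc j) → e j }) , λ y → trans (cong (y *_) (h y)) (sym (+-identityˡ _))

  poly-linear : ∀ {d f} a b → IsPoly d f → IsPoly (suc d) (λ y → (a + y * b) * f y)
  poly-linear {d} {f} a b p with poly-+ (poly-weaken (ℕₚ.n≤1+n d) (poly-scale a p)) (poly-X (poly-scale b p))
  ... | e , h = e , λ y → trans (solve 4 (λ a y b t → (a :+ y :* b) :* t := a :* t :+ y :* (b :* t)) refl a y b (f y)) (h y)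

  poly-∏ : ∀ {A : Set} (xs : List A) (a b : A → Carrier) → IsPoly (suc (length xs)) (λ y → ∏ xs (λ x → a x + y * b x))
  poly-∏ [] a b = poly-const 1#
  poly-∏ (x ∷ xs) a b = poly-linear (a x) (b x) (poly-∏ xs a b)

  poly-∑ : ∀ {d} {A : Set} (xs : List A) (f : A → Carrier → Carrier) → (∀ x → IsPoly d (f x)) → IsPoly d (λ y → ∑ xs (λ x → f x y))
  poly-∑ {d} [] f h = poly-zero d
  poly-∑ (x ∷ xs) f h = poly-+ (h x) (poly-∑ xs f h)

  poly-roots : ∀ {d f} → IsPoly d f → (rs : List Carrier) → Unique rs → d ℕ.≤ length rs →
               (∀ {r} → r ∈ rs → f r ≡ 0#) → ∀ y → f y ≡ 0#
  poly-roots {d} (e , h) rs u len z y = trans (h y)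
    (eval-zero d (roots⇒coeff≡0 d e rs u len (λ {r} r∈ → trans (sym (h r)) (z r∈))) y)

-- Binomial coefficients modulo a prime and the Frobenius map.

C-absorption : ∀ n k → suc k ℕ.* (suc n C suc k) ≡ suc n ℕ.* (n C k)
C-absorption zero zero = refl
C-absorption zero (suc k) = trans (cong (suc (suc k) ℕ.*_) (k>n⇒nCk≡0 {1} {suc (suc k)} (s≤s (s≤s z≤n))))
  (trans (ℕₚ.*-zeroʳ (suc (suc k))) (sym (cong (1 ℕ.*_) (k>n⇒nCk≡0 {0} {suc k} (s≤s z≤n)))))
C-absorption (suc n) zero = trans (ℕₚ.*-identityˡ _) (trans (nC1≡n (suc (suc n))) (sym (ℕₚ.*-identityʳ _)))
C-absorption (suc n) (suc k) = begin
  suc (suc k) ℕ.* (suc (suc n) C suc (suc k))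
    ≡⟨ cong (suc (suc k) ℕ.*_) (sym (nCk+nC[k+1]≡[n+1]C[k+1] (suc n) (suc k))) ⟩
  suc (suc k) ℕ.* (c ℕ.+ (suc n C suc (suc k)))
    ≡⟨ ℕₚ.*-distribˡ-+ (suc (suc k)) c _ ⟩
  (c ℕ.+ suc k ℕ.* c) ℕ.+ suc (suc k) ℕ.* (suc n C suc (suc k))
    ≡⟨ cong₂ (λ a b → (c ℕ.+ a) ℕ.+ b) (C-absorption n k) (C-absorption n (suc k)) ⟩
  (c ℕ.+ suc n ℕ.* (n C k)) ℕ.+ suc n ℕ.* (n C suc k)
    ≡⟨ ℕₚ.+-assoc c _ _ ⟩
  c ℕ.+ (suc n ℕ.* (n C k) ℕ.+ suc n ℕ.* (n C suc k))
    ≡⟨ cong (c ℕ.+_) (sym (ℕₚ.*-distribˡ-+ (suc n) (n C k) (n C suc k))) ⟩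
  c ℕ.+ suc n ℕ.* ((n C k) ℕ.+ (n C suc k))
    ≡⟨ cong (λ z → c ℕ.+ suc n ℕ.* z) (nCk+nC[k+1]≡[n+1]C[k+1] n k) ⟩
  suc (suc n) ℕ.* c ∎
  where
  open ≡-Reasoning
  c = suc n C suc k

-- By absorption p divides the product of `k` and `p C k`; it does not divide the smaller positive
-- factor `k`, so Euclid's lemma leaves the binomial coefficient.
prime∣C : ∀ {p k} → Prime p → k ℕ.< p → 0 ℕ.< k → p ∣ p C k
prime∣C {suc n} {suc k} pr k<p _ with euclidsLemma (suc k) (suc n C suc k) pr
                                       (divides (n C k) (trans (C-absorption n k) (ℕₚ.*-comm (suc n) _)))
... | inj₁ d = ⊥-elim (ℕₚ.<⇒≱ k<p (Div.∣⇒≤ d))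
... | inj₂ d = d
prime∣C {zero} pr () _

module Frobenius {a ℓ} (S : Semiring a ℓ) where
  open Semiring S hiding (zero) renaming (refl to ≈-refl; sym to ≈-sym; trans to ≈-trans)
  open import Algebra.Properties.Semiring.Mult S using (×-congʳ; ×-assoc-*; ×-assocˡ; ×-homo-1) renaming (_×_ to _·ℕ_)
  open import Algebra.Properties.Semiring.Exp S using (_^_; ^-congˡ; ^-assocʳ)
  open import Algebra.Properties.Semiring.Sum S using (sum; sum-init-last; sum-cong-≋; sum-replicate-zero)
  import Algebra.Properties.Semiring.Binomial S as Bin
  open import Relation.Binary.Reasoning.Setoid setoid

  module _ {p : ℕ} (pr : Prime p) (p·1≈0 : p ·ℕ 1# ≈ 0#) where

    p∣n⇒n·z≈0 : ∀ {n} z → p ∣ n → n ·ℕ z ≈ 0#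
    p∣n⇒n·z≈0 {n} z (divides t refl) = begin
      (t ℕ.* p) ·ℕ z ≈⟨ ×-assocˡ z t p ⟨
      t ·ℕ (p ·ℕ z) ≈⟨ ×-congʳ t (×-congʳ p (*-identityˡ z)) ⟨
      t ·ℕ (p ·ℕ (1# * z)) ≈⟨ ×-congʳ t (×-assoc-* p 1# z) ⟨
      t ·ℕ ((p ·ℕ 1#) * z) ≈⟨ ×-congʳ t (≈-trans (*-congʳ p·1≈0) (zeroˡ z)) ⟩
      t ·ℕ 0# ≈⟨ t·0 t ⟩
      0# ∎
      where
      t·0 : ∀ t → t ·ℕ 0# ≈ 0#
      t·0 zero = ≈-refl
      t·0 (suc t) = ≈-trans (+-identityˡ _) (t·0 t)

    -- Stated for two commuting elements of an arbitrary semiring of characteristic p, because it is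
    -- applied both to fields and to the noncommutative semiring of operators on sequences.
    frobenius : ∀ x y → x * y ≈ y * x → (x + y) ^ p ≈ x ^ p + y ^ p
    frobenius x y xy≈yx = go p refl p·1≈0
      where
      go : ∀ n → n ≡ p → n ·ℕ 1# ≈ 0# → (x + y) ^ n ≈ x ^ n + y ^ n
      go zero refl _ with prime⇒nonZero pr
      ... | ()
      go (suc n) refl _ = begin
        (x + y) ^ suc n ≈⟨ Bin.theorem x y xy≈yx (suc n) ⟩
        t Fin.zero + sum (λ i → t (Fin.suc i)) ≈⟨ +-congˡ (sum-init-last (λ i → t (Fin.suc i))) ⟩
        t Fin.zero + (sum (λ i → t (Fin.suc (inject₁ i))) + t (Fin.suc (Fin.fromℕ n)))
          ≈⟨ +-congˡ (+-congʳ (≈-trans (sum-cong-≋ mid) (sum-replicate-zero n))) ⟩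
        t Fin.zero + (0# + t (Fin.suc (Fin.fromℕ n))) ≈⟨ +-cong first (≈-trans (+-identityˡ _) (last (Fin.suc (Fin.fromℕ n)) (cong suc (Finₚ.toℕ-fromℕ n)))) ⟩
        y ^ suc n + x ^ suc n ≈⟨ +-comm _ _ ⟩
        x ^ suc n + y ^ suc n ∎
        where
        t = Bin.binomialTerm x y (suc n)
        mid : ∀ i → t (Fin.suc (inject₁ i)) ≈ 0#
        mid i = p∣n⇒n·z≈0 _ (prime∣C pr (s≤s (subst (ℕ._< n) (sym (Finₚ.toℕ-inject₁ i)) (Finₚ.toℕ<n i))) (s≤s z≤n))
        first : t Fin.zero ≈ y ^ suc n
        first = ≈-trans (×-homo-1 _) (*-identityˡ _)
        last : ∀ k → toℕ k ≡ suc n → t k ≈ x ^ suc n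
        last k e rewrite e | nCn≡1 (suc n) | ℕₚ.n∸n≡0 n = ≈-trans (×-homo-1 _) (*-identityʳ _)

    ^-commute : ∀ {x y} n → x * y ≈ y * x → x ^ n * y ≈ y * x ^ n
    ^-commute zero c = ≈-trans (*-identityˡ _) (≈-sym (*-identityʳ _))
    ^-commute {x} {y} (suc n) c = begin
      x * x ^ n * y ≈⟨ *-assoc _ _ _ ⟩
      x * (x ^ n * y) ≈⟨ *-congˡ (^-commute n c) ⟩
      x * (y * x ^ n) ≈⟨ *-assoc _ _ _ ⟨
      x * y * x ^ n ≈⟨ *-congʳ c ⟩
      y * x * x ^ n ≈⟨ *-assoc _ _ _ ⟩
      y * (x * x ^ n) ∎

    frobenius^ : ∀ e x y → x * y ≈ y * x → (x + y) ^ (p ℕ.^ e) ≈ x ^ (p ℕ.^ e) + y ^ (p ℕ.^ e)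
    frobenius^ zero x y c = ≈-trans (*-identityʳ _) (+-cong (≈-sym (*-identityʳ _)) (≈-sym (*-identityʳ _)))
    frobenius^ (suc e) x y c = begin
      (x + y) ^ (p ℕ.* p ℕ.^ e) ≈⟨ ^-assocʳ (x + y) p (p ℕ.^ e) ⟨
      ((x + y) ^ p) ^ (p ℕ.^ e) ≈⟨ ^-congˡ (p ℕ.^ e) (frobenius x y c) ⟩
      (x ^ p + y ^ p) ^ (p ℕ.^ e) ≈⟨ frobenius^ e (x ^ p) (y ^ p)
                                                     (^-commute p (≈-sym (^-commute p (≈-sym c)))) ⟩
      (x ^ p) ^ (p ℕ.^ e) + (y ^ p) ^ (p ℕ.^ e) ≈⟨ +-cong (^-assocʳ x p _) (^-assocʳ y p _) ⟩
      x ^ (p ℕ.* p ℕ.^ e) + y ^ (p ℕ.* p ℕ.^ e) ∎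

-- Finite fields: Fermat's theorem, power sums, characteristic.

module FiniteFieldProps (F : FiniteField) where
  open FieldProps F public
  open Solver

  elements-map-↭ : ∀ {f : Carrier → Carrier} → (∀ {a b} → f a ≡ f b → a ≡ b) → elements ↭ List.map f elements
  elements-map-↭ {f} inj = unique-⊆⇒↭ (Unique-map⁺ inj unique) (λ _ → complete _) (ℕₚ.≤-reflexive (sym (Listₚ.length-map f elements)))

  private
    split : ∃[ zs ] (elements ↭ 0# ∷ zs)
    split = unique-⊆-split {xs = 0# ∷ []} ([] ∷ []) (λ _ → complete _)

  units : List Carrier
  units = proj₁ split

  elements↭0∷units : elements ↭ 0# ∷ units
  elements↭0∷units = proj₂ split

  private
    unique′ : Unique (0# ∷ units)
    unique′ = Unique-resp-↭ elements↭0∷units unique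

  units-unique : Unique units
  units-unique with unique′
  ... | _ ∷ u = u

  units-nonzero : ∀ {a} → a ∈ units → a ≢ 0#
  units-nonzero a∈ refl = Unique[x∷xs]⇒x∉xs unique′ a∈

  units-complete : ∀ {a} → a ≢ 0# → a ∈ units
  units-complete {a} a≢0 with ∈-resp-↭ elements↭0∷units (complete a)
  ... | here e = ⊥-elim (a≢0 e)
  ... | there a∈ = a∈

  order≡1+units : order ≡ suc (length units)
  order≡1+units = ↭-length elements↭0∷units

  2≤order : 2 ℕ.≤ order
  2≤order = unique-⊆⇒length≤ {xs = 0# ∷ 1# ∷ []} ((0≢1 ∷ []) ∷ [] ∷ []) (λ _ → complete _)

  -- Translation by `1#` permutes the field, so the sum of all elements is unchanged, yet it grows
  -- by `1#` for each element.
  order≡0 : ⟦ order ⟧ ≡ 0#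
  order≡0 = +-cancelˡ (∑ elements (λ c → c)) ⟦ order ⟧ 0# (sym (begin
      ∑ elements (λ c → c) + 0# ≡⟨ +-identityʳ _ ⟩
      ∑ elements (λ c → c) ≡⟨ ∑-↭ _ (elements-map-↭ {_+ 1#} (+-cancelʳ 1# _ _)) ⟩
      ∑ (List.map (_+ 1#) elements) (λ c → c) ≡⟨ ∑-map (_+ 1#) elements _ ⟩
      ∑ elements (λ c → c + 1#) ≡⟨ ∑-+ elements _ _ ⟩
      ∑ elements (λ c → c) + ∑ elements (λ _ → 1#) ≡⟨ cong (∑ elements (λ c → c) +_) (trans (∑-const elements 1#) (*-identityʳ _)) ⟩
      ∑ elements (λ c → c) + ⟦ order ⟧ ∎))
    where open ≡-Reasoning

  -- Multiplication by `a` permutes the units, so their nonzero product equals itself times this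
  -- power of `a`.
  a^units≡1 : ∀ {a} → a ≢ 0# → a ^ length units ≡ 1#
  a^units≡1 {a} a≢0 = *-cancelˡ {∏ units (λ c → c)} (∏-nonzero units units-nonzero) (begin
    ∏ units (λ c → c) * a ^ length units ≡⟨ *-comm _ _ ⟩
    a ^ length units * ∏ units (λ c → c) ≡⟨ ∏-scale units a _ ⟨
    ∏ units (a *_) ≡⟨ ∏-map (a *_) units _ ⟨
    ∏ (List.map (a *_) units) (λ c → c) ≡⟨ ∏-↭ _ (↭-sym perm) ⟩
    ∏ units (λ c → c) ≡⟨ *-identityʳ _ ⟨
    ∏ units (λ c → c) * 1# ∎)
    where
    open ≡-Reasoning
    perm : units ↭ List.map (a *_) units
    perm = unique-⊆⇒↭ (Unique-map⁺ (*-cancelˡ a≢0) units-unique)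
      (λ z∈ → let _ , c∈ , e = ∈-map⁻ (a *_) z∈ in units-complete (λ z≡0 → *-nonzero a≢0 (units-nonzero c∈) (trans (sym e) z≡0)))
      (ℕₚ.≤-reflexive (sym (Listₚ.length-map _ units)))

  fermat : ∀ a → a ^ order ≡ a
  fermat a rewrite order≡1+units with a ≟ 0#
  ... | yes refl = zeroˡ _
  ... | no a≢0 = trans (cong (a *_) (a^units≡1 a≢0)) (*-identityʳ a)

  poly-power : ∀ j → IsPoly (suc j) (_^ j)
  poly-power zero = poly-const 1#
  poly-power (suc j) = poly-X (poly-power j)

  -- If every unit were a root of y^(j+1) - 1, there would be more roots than the degree and the
  -- polynomial would vanish at `0#` too, where its value is -1.
  nonRootOfUnity : ∀ j → suc j ℕ.< length units → ∃[ a ] (a ≢ 0# × a ^ suc j ≢ 1#)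
  nonRootOfUnity j j<n with All.all? (λ a → (a ^ suc j) ≟ 1#) units
  ... | no ¬all with find (Allₚ.¬All⇒Any¬ (λ a → (a ^ suc j) ≟ 1#) units ¬all)
  ... | a , a∈ , ne = a , units-nonzero a∈ , ne
  nonRootOfUnity j j<n | yes all = ⊥-elim (0≢1 (sym (trans (sym z) (zeroˡ _))))
    where
    z : 0# ^ suc j ≡ 1#
    z = x-y≡0⇒x≡y (poly-roots {suc (suc j)} {λ y → y ^ suc j + - 1#}
          (poly-+ (poly-power (suc j)) (poly-weaken (s≤s z≤n) (poly-const (- 1#))))
          units units-unique j<n (λ r∈ → x≡y⇒x-y≡0 (All.lookup all r∈)) 0#)

  -- The substitution c ↦ a c leaves the sum unchanged and multiplies it by a^j, and `a` is chosen
  -- with a^j ≢ 1. For j = 0 the sum is the order of the field.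
  ∑-power : ∀ j → j ℕ.< length units → ∑ elements (_^ j) ≡ 0#
  ∑-power zero _ = trans (∑-const elements 1#) (trans (*-identityʳ _) order≡0)
  ∑-power (suc j) j<n with nonRootOfUnity j j<n
  ... | a , a≢0 , a^j≢1 with *-zero-split {a ^ suc j + - 1#} {∑ elements (_^ suc j)} (begin
      (a ^ suc j + - 1#) * S ≡⟨ solve 3 (λ p o s → (p :- o) :* s := p :* s :- o :* s) refl (a ^ suc j) 1# S ⟩
      a ^ suc j * S + - (1# * S) ≡⟨ cong₂ (λ x y → x + - y) (sym eq) (*-identityˡ S) ⟩
      S + - S ≡⟨ -‿inverseʳ S ⟩
      0# ∎)
    where
    open ≡-Reasoning
    S = ∑ elements (_^ suc j)
    eq : S ≡ a ^ suc j * S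
    eq = begin
      ∑ elements (_^ suc j) ≡⟨ ∑-↭ _ (elements-map-↭ {a *_} (*-cancelˡ a≢0)) ⟩
      ∑ (List.map (a *_) elements) (_^ suc j) ≡⟨ ∑-map (a *_) elements _ ⟩
      ∑ elements (λ c → (a * c) ^ suc j) ≡⟨ ∑-cong elements (λ c → ^-distrib-* a c (suc j)) ⟩
      ∑ elements (λ c → a ^ suc j * c ^ suc j) ≡⟨ ∑-* elements _ _ ⟩
      a ^ suc j * S ∎
  ... | inj₁ z = ⊥-elim (a^j≢1 (x-y≡0⇒x≡y z))
  ... | inj₂ z = z

  private
    ∑-power-eval : ∀ d i e → i ℕ.+ d ℕ.≤ length units → ∑ elements (λ c → c ^ i * eval d e c) ≡ 0#
    ∑-power-eval zero i e _ = trans (∑-cong elements (λ c → zeroʳ _)) (∑-zero elements)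
    ∑-power-eval (suc d) i e le = begin
      ∑ elements (λ c → c ^ i * (e 0 + c * eval d (e ∘ suc) c))
        ≡⟨ ∑-cong elements (λ c → solve 4 (λ p a c t → p :* (a :+ c :* t) := a :* p :+ (c :* p) :* t) refl (c ^ i) (e 0) c _) ⟩
      ∑ elements (λ c → e 0 * c ^ i + c ^ suc i * eval d (e ∘ suc) c)
        ≡⟨ ∑-+ elements _ _ ⟩
      ∑ elements (λ c → e 0 * c ^ i) + ∑ elements (λ c → c ^ suc i * eval d (e ∘ suc) c)
        ≡⟨ cong₂ _+_ (trans (∑-* elements _ _) (cong (e 0 *_) (∑-power i (ℕₚ.≤-trans (ℕₚ.≤-trans (s≤s (ℕₚ.m≤m+n i d)) (ℕₚ.≤-reflexive (sym (ℕₚ.+-suc i d)))) le))))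
                     (∑-power-eval d (suc i) (e ∘ suc) (ℕₚ.≤-trans (ℕₚ.≤-reflexive (sym (ℕₚ.+-suc i d))) le)) ⟩
      e 0 * 0# + 0#
        ≡⟨ trans (+-identityʳ _) (zeroʳ _) ⟩
      0# ∎
      where open ≡-Reasoning

  -- `IsPoly d` means degree below `d`, so the degree is at most q - 2. This is sharp: X^(q-1) sums
  -- to -1.
  ∑-poly : ∀ {d f} → d ℕ.< order → IsPoly d f → ∑ elements f ≡ 0#
  ∑-poly {d} d<q (e , h) rewrite order≡1+units =
    trans (∑-cong elements (λ c → trans (h c) (sym (*-identityˡ _)))) (∑-power-eval d 0 e (ℕₚ.≤-pred d<q))

  ⟦^⟧ : ∀ n e → ⟦ n ℕ.^ e ⟧ ≡ ⟦ n ⟧ ^ e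
  ⟦^⟧ n zero = +-identityʳ 1#
  ⟦^⟧ n (suc e) = trans (×1-homo-* n _) (cong (⟦ n ⟧ *_) (⟦^⟧ n e))

  module Characteristic {p h : ℕ} (pr : Prime p) (q≡p^h : order ≡ p ℕ.^ h) where

    p≡0 : ⟦ p ⟧ ≡ 0#
    p≡0 with ⟦ p ⟧ ≟ 0#
    ... | yes e = e
    ... | no ne = ⊥-elim (^-nonzero h ne (trans (sym (⟦^⟧ p h)) (trans (cong ⟦_⟧ (sym q≡p^h)) order≡0)))

    -- If p and `n` were coprime, Bézout would write 1 as a difference of multiples of them, both of
    -- which vanish in the field.
    ⟦n⟧≡0⇒p∣n : ∀ {n} → ⟦ n ⟧ ≡ 0# → p ∣ n
    ⟦n⟧≡0⇒p∣n {n} e = subst (_∣ n) d≡p (gcd[m,n]∣n p n)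
      where
      open Bézout using (identity; module Identity)
      1≡0⇒⊥ : ∀ {x y} → 1 ℕ.+ x ≡ y → ⟦ x ⟧ ≡ 0# → ⟦ y ⟧ ≡ 0# → ⊥
      1≡0⇒⊥ {x} refl ex ey = 0≢1 (trans (sym ey) (trans (cong (1# +_) ex) (+-identityʳ 1#)))
      mult : ∀ x m → ⟦ m ⟧ ≡ 0# → ⟦ x ℕ.* m ⟧ ≡ 0#
      mult x m em = trans (×1-homo-* x m) (trans (cong (⟦ x ⟧ *_) em) (zeroʳ _))
      d≢1 : gcd p n ≢ 1
      d≢1 d≡1 with identity (subst (GCD p n) d≡1 (gcd-GCD p n))
      ... | Identity.+- x y eq = 1≡0⇒⊥ eq (mult y n e) (mult x p p≡0)
      ... | Identity.-+ x y eq = 1≡0⇒⊥ eq (mult x p p≡0) (mult y n e)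
      d≡p : gcd p n ≡ p
      d≡p with prime⇒irreducible pr (gcd[m,n]∣m p n)
      ... | inj₁ d≡1 = ⊥-elim (d≢1 d≡1)
      ... | inj₂ d≡p = d≡p

    open Frobenius semiring public using () renaming (frobenius^ to frobenius^′)

¬Unique-map⇒collision : ∀ {A B : Set} (_≟_ : DecidableEquality B) (f : A → B) (xs : List A) → Unique xs → ¬ Unique (List.map f xs) →
                        ∃[ x ] ∃[ y ] (x ∈ xs × y ∈ xs × x ≢ y × f x ≡ f y)
¬Unique-map⇒collision _≟_ f [] u ¬u = ⊥-elim (¬u [])
¬Unique-map⇒collision _≟_ f (x ∷ xs) (x≢ ∷ u) ¬u with Any.any? (λ y → f x ≟ f y) xs
... | yes p = let y , y∈ , e = find p in x , y , here refl , there y∈ , All.lookup x≢ y∈ , e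
... | no ¬p with ¬Unique-map⇒collision _≟_ f xs u (λ u' → ¬u (All.tabulate (λ z∈ e →
                   let y , y∈ , e' = ∈-map⁻ f z∈ in ¬p (lose y∈ (trans e e'))) ∷ u'))
... | a , b , a∈ , b∈ , r = a , b , there a∈ , there b∈ , r

Unique-map-injective : ∀ {A B : Set} (f : A → B) {xs : List A} {x y} → Unique (List.map f xs) → x ∈ xs → y ∈ xs → f x ≡ f y → x ≡ y
Unique-map-injective f u (here refl) (here refl) e = refl
Unique-map-injective f {z ∷ xs} u (here refl) (there q) e = ⊥-elim (Unique[x∷xs]⇒x∉xs u (subst (_∈ List.map f xs) (sym e) (∈-map⁺ f q)))
Unique-map-injective f {z ∷ xs} u (there p) (here refl) e = ⊥-elim (Unique[x∷xs]⇒x∉xs u (subst (_∈ List.map f xs) e (∈-map⁺ f p)))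
Unique-map-injective f (_ ∷ u) (there p) (there q) e = Unique-map-injective f u p q e

-- Rédei's lacunary polynomial argument.

module Redei (K : FiniteField) where
  open FiniteFieldProps K public
  open Solver
  open DecMembership _≟_ using (_∈?_)

  δ : Carrier → Carrier → Carrier
  δ s t = ind (s ≟ t)

  δ-≡ : ∀ {s t} → s ≡ t → δ s t ≡ 1#
  δ-≡ = ind-yes (_ ≟ _)

  δ-≢ : ∀ {s t} → s ≢ t → δ s t ≡ 0#
  δ-≢ = ind-no (_ ≟ _)

  δ-⇔ : ∀ {s t s' t'} → (s ≡ t → s' ≡ t') → (s' ≡ t' → s ≡ t) → δ s t ≡ δ s' t'
  δ-⇔ = ind-⇔ (_ ≟ _) (_ ≟ _)

  ∑-δ-elements : ∀ c → ∑ elements (λ s → δ s c) ≡ 1#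
  ∑-δ-elements c = begin
    ∑ elements (λ s → δ s c) ≡⟨ ∑-↭ _ (elements-map-↭ {_+ c} (+-cancelʳ c _ _)) ⟩
    ∑ (List.map (_+ c) elements) (λ s → δ s c) ≡⟨ ∑-map (_+ c) elements _ ⟩
    ∑ elements (λ s → δ (s + c) c) ≡⟨ ∑-cong elements (λ s → δ-⇔ (λ e → +-cancelʳ c s 0# (trans e (sym (+-identityˡ c)))) (λ e → trans (cong (_+ c) e) (+-identityˡ c))) ⟩
    ∑ elements (λ s → δ s 0#) ≡⟨ ∑-↭ _ elements↭0∷units ⟩
    δ 0# 0# + ∑ units (λ s → δ s 0#) ≡⟨ cong₂ _+_ (δ-≡ refl) (trans (∑-cong∈ units (λ s∈ → δ-≢ (units-nonzero s∈))) (∑-zero units)) ⟩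
    1# + 0# ≡⟨ +-identityʳ 1# ⟩
    1# ∎
    where open ≡-Reasoning

  ∃∉ : ∀ (bad : List Carrier) → length bad ℕ.< order → ∃[ t ] t ∉ bad
  ∃∉ bad len with Any.any? (λ t → ¬? (t ∈? bad)) elements
  ... | yes p = let t , _ , t∉ = find p in t , t∉
  ... | no ¬p = ⊥-elim (ℕₚ.<⇒≱ len (unique-⊆⇒length≤ unique ⊆bad))
    where
    ⊆bad : ∀ {z} → z ∈ elements → z ∈ bad
    ⊆bad {z} z∈ with z ∈? bad
    ... | yes p = p
    ... | no z∉ = ⊥-elim (¬p (lose z∈ z∉))

  ∋all⇒↭elements : ∀ {vs} → length vs ≡ order → (∀ c → c ∈ vs) → vs ↭ elements
  ∋all⇒↭elements len h = unique-⊆⇒↭ unique (λ _ → h _) (ℕₚ.≤-reflexive len)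

  module _ {A : Set} (l : A → Carrier → Carrier) where

    -- The coefficient of X^j in the product of the factors X - l(u, y), as a function of the
    -- parameter `y`, so that it can itself be treated as a polynomial in `y`.
    coef : List A → ℕ → Carrier → Carrier
    coef [] zero y = 1#
    coef [] (suc j) y = 0#
    coef (u ∷ us) zero y = - l u y * coef us zero y
    coef (u ∷ us) (suc j) y = coef us j y + - l u y * coef us (suc j) y

    coef-above : ∀ us j y → length us ℕ.< j → coef us j y ≡ 0#
    coef-above [] (suc j) y _ = refl
    coef-above (u ∷ us) (suc j) y (s≤s p) = trans (cong₂ (λ s t → s + - l u y * t) (coef-above us j y p) (coef-above us (suc j) y (ℕₚ.m≤n⇒m≤1+n p)))
      (trans (+-identityˡ _) (zeroʳ _))

    coef-top : ∀ us y → coef us (length us) y ≡ 1#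
    coef-top [] y = refl
    coef-top (u ∷ us) y = trans (cong₂ (λ s t → s + - l u y * t) (coef-top us y) (coef-above us _ y ℕₚ.≤-refl))
      (trans (cong (1# +_) (zeroʳ _)) (+-identityʳ 1#))

    eval-coef : ∀ us y c → eval (suc (length us)) (λ j → coef us j y) c ≡ ∏ us (λ u → c + - l u y)
    eval-coef [] y c = trans (cong (1# +_) (zeroʳ c)) (+-identityʳ 1#)
    eval-coef (u ∷ us) y c = begin
      m * e 0 + c * eval (suc L) (λ j → e j + m * e (suc j)) c
        ≡⟨ cong (λ z → m * e 0 + c * z) (trans (eval-+ (suc L) e (λ j → m * e (suc j)) c) (cong (eval (suc L) e c +_) (eval-* (suc L) m (e ∘ suc) c))) ⟩
      m * e 0 + c * (eval (suc L) e c + m * eval (suc L) (e ∘ suc) c)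
        ≡⟨ solve 5 (λ m a c E t → m :* a :+ c :* (E :+ m :* t) := c :* E :+ m :* (a :+ c :* t)) refl m (e 0) c (eval (suc L) e c) _ ⟩
      c * eval (suc L) e c + m * eval (suc (suc L)) e c
        ≡⟨ cong (λ z → c * eval (suc L) e c + m * z) (eval-trunc (ℕₚ.n≤1+n (suc L)) (λ j p _ → coef-above us j y p) c) ⟩
      c * eval (suc L) e c + m * eval (suc L) e c
        ≡⟨ distribʳ _ c m ⟨
      (c + m) * eval (suc L) e c
        ≡⟨ cong ((c + m) *_) (eval-coef us y c) ⟩
      (c + m) * ∏ us (λ u → c + - l u y) ∎
      where
      open ≡-Reasoning
      L = length us
      m = - l u y
      e : ℕ → Carrier
      e j = coef us j y

  poly-ext : ∀ {d f g} → (∀ y → f y ≡ g y) → IsPoly d f → IsPoly d g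
  poly-ext h (e , k) = e , λ y → trans (sym (h y)) (k y)

  module _ {A : Set} (a b : A → Carrier) where
    private
      l : A → Carrier → Carrier
      l u y = a u + y * b u

      l-scale : ∀ u {d f} → IsPoly d f → IsPoly (suc d) (λ y → - l u y * f y)
      l-scale u {d} {f} p = poly-ext
        (λ y → solve 4 (λ a y b t → (:- a :+ y :* :- b) :* t := :- (a :+ y :* b) :* t) refl (a u) y (b u) (f y))
        (poly-linear (- a u) (- b u) p)

    -- Up to sign this is the elementary symmetric function of degree |us| - j in the values of `l`,
    -- each linear in `y`.
    coef-poly : ∀ us j → j ℕ.≤ length us → IsPoly (suc (length us ℕ.∸ j)) (coef l us j)
    coef-poly [] zero _ = poly-const 1#
    coef-poly (u ∷ us) zero _ = l-scale u (coef-poly us zero z≤n)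
    coef-poly (u ∷ us) (suc j) (s≤s j≤L) = poly-+ (coef-poly us j j≤L) (second (ℕₚ.m≤n⇒m<n∨m≡n j≤L))
      where
      second : j ℕ.< length us ⊎ j ≡ length us → IsPoly (suc (length us ℕ.∸ j)) (λ y → - l u y * coef l us (suc j) y)
      second (inj₁ j<L) = subst (λ d → IsPoly d (λ y → - l u y * coef l us (suc j) y)) (cong suc (sym (ℕₚ.+-∸-assoc 1 j<L)))
        (l-scale u (coef-poly us (suc j) j<L))
      second (inj₂ refl) = poly-ext (λ y → sym (trans (cong (- l u y *_) (coef-above l us (suc j) y ℕₚ.≤-refl)) (zeroʳ _)))
        (poly-zero _)

  -- For y ∉ bad the values a u + y * b u exhaust the field, so ∏ (X − a u − y b u) reduces to 0 modulo X^Q − X. Its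
  -- coefficients are polynomials in y, and those of X^j with j > x have too many roots y, hence vanish identically.
  -- Thus ∏ (c − a u) is a polynomial of degree ≤ x in c: either it vanishes everywhere, or a takes at most x values, and
  -- interpolation at these values shows that their multiplicities are zero.
  module _ {A : Set} (us : List A) (a b : A → Carrier) (len : length us ≡ order)
           (x : ℕ) (1≤x : 1 ℕ.≤ x) (2x≤q : x ℕ.+ x ℕ.≤ order)
           (bad : List Carrier) (bad-len : length bad ℕ.≤ x)
           (good : ∀ y → y ∉ bad → ∀ c → ∃[ u ] (u ∈ us × a u + y * b u ≡ c)) where
    private
      l : A → Carrier → Carrier
      l u y = a u + y * b u

      l0 : ∀ u → l u 0# ≡ a u
      l0 u = trans (cong (a u +_) (zeroˡ _)) (+-identityʳ _)

      goods : List Carrier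
      goods = filter (λ y → ¬? (y ∈? bad)) elements

      goods-unique : Unique goods
      goods-unique = Unique-filter⁺ (λ y → ¬? (y ∈? bad)) unique

      goods-good : ∀ {y} → y ∈ goods → y ∉ bad
      goods-good y∈ = proj₂ (∈-filter⁻ (λ y → ¬? (y ∈? bad)) {xs = elements} y∈)

      goods-len : order ℕ.≤ length goods ℕ.+ x
      goods-len = ℕₚ.≤-trans (unique-⊆⇒length≤ unique cover)
        (ℕₚ.≤-trans (ℕₚ.≤-reflexive (Listₚ.length-++ goods)) (ℕₚ.+-monoʳ-≤ (length goods) bad-len))
        where
        cover : ∀ {z} → z ∈ elements → z ∈ goods ++ bad
        cover {z} z∈ with z ∈? bad
        ... | yes p = ∈-++⁺ʳ goods p
        ... | no p = ∈-++⁺ˡ (∈-filter⁺ (λ y → ¬? (y ∈? bad)) z∈ p)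

      -- The factor 2 of the hypothesis enters here: at least q - x ≥ x parameters are good, as many
      -- as the interpolation sum `W` below requires.
      x≤goods : x ℕ.≤ length goods
      x≤goods = ℕₚ.+-cancelʳ-≤ x x (length goods) (ℕₚ.≤-trans 2x≤q goods-len)

      1+x≤q : suc x ℕ.≤ order
      1+x≤q = ℕₚ.≤-trans (ℕₚ.+-monoˡ-≤ x 1≤x) 2x≤q

      -- red replaces the leading term X^Q by X.
      X : ℕ → Carrier
      X 1 = 1#
      X _ = 0#

      eval-X : ∀ d → 2 ℕ.≤ d → ∀ c → eval d X c ≡ c
      eval-X (suc (suc d)) _ c = trans (+-identityˡ _) (trans (cong (c *_) (trans (cong (1# +_)
        (trans (cong (c *_) (eval-zero d (λ _ _ → refl) c)) (zeroʳ c))) (+-identityʳ 1#))) (*-identityʳ c))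
      eval-X (suc zero) (s≤s ()) c

      red : Carrier → ℕ → Carrier
      red y j = coef l us j y + X j

      eval-red : ∀ y c → eval order (red y) c ≡ ∏ us (λ u → c + - l u y)
      eval-red y c = begin
        eval order (red y) c ≡⟨ eval-+ order _ X c ⟩
        eval order (λ j → coef l us j y) c + eval order X c
          ≡⟨ cong (eval order (λ j → coef l us j y) c +_) (trans (eval-X order 2≤order c) (sym (trans (*-identityˡ _) (fermat c)))) ⟩
        eval order (λ j → coef l us j y) c + 1# * c ^ order
          ≡⟨ cong (λ z → eval order (λ j → coef l us j y) c + z * c ^ order) (sym (subst (λ L → coef l us L y ≡ 1#) len (coef-top l us y))) ⟩
        eval order (λ j → coef l us j y) c + coef l us order y * c ^ order
          ≡⟨ eval-snoc order (λ j → coef l us j y) c ⟨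
        eval (suc order) (λ j → coef l us j y) c
          ≡⟨ subst (λ L → eval (suc L) (λ j → coef l us j y) c ≡ ∏ us (λ u → c + - l u y)) len (eval-coef l us y c) ⟩
        ∏ us (λ u → c + - l u y) ∎
        where open ≡-Reasoning

      -- For a good `y` every field element is a root, and the reduced polynomial has degree below
      -- the order, so all its coefficients vanish.
      red-good : ∀ {y} → y ∉ bad → ∀ j → j ℕ.< order → red y j ≡ 0#
      red-good {y} y∉ = roots⇒coeff≡0 order (red y) elements unique ℕₚ.≤-refl
        (λ {c} _ → trans (eval-red y c) (let u , u∈ , e = good y y∉ c in ∏-zero u∈ (x≡y⇒x-y≡0 (sym e))))

      -- The degree in `y` is at most q - j, which for j > x is less than q - x, a lower bound for
      -- the number of good parameters.
      red-high : ∀ y j → suc x ℕ.≤ j → j ℕ.< order → red y j ≡ 0#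
      red-high y j x<j j<q = poly-roots
        (poly-+ (subst (λ L → IsPoly (suc (L ℕ.∸ j)) (coef l us j)) len (coef-poly a b us j (subst (j ℕ.≤_) (sym len) (ℕₚ.<⇒≤ j<q))))
                (poly-weaken (s≤s z≤n) (poly-const (X j))))
        goods goods-unique
        (ℕₚ.≤-trans (ℕₚ.≤-reflexive (sym (ℕₚ.+-∸-assoc 1 (ℕₚ.<⇒≤ j<q))))
          (ℕₚ.m≤n+o⇒m∸n≤o (suc order) j (ℕₚ.≤-trans (s≤s goods-len)
            (ℕₚ.≤-trans (ℕₚ.≤-reflexive (trans (sym (ℕₚ.+-suc (length goods) x)) (ℕₚ.+-comm (length goods) (suc x)))) (ℕₚ.+-monoˡ-≤ (length goods) x<j)))))
        (λ r∈ → red-good (goods-good r∈) j j<q) y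

      f : Carrier → Carrier
      f c = ∏ us (λ u → c + - a u)

      ∏-cong : ∀ (xs : List A) {g h : A → Carrier} → (∀ z → g z ≡ h z) → ∏ xs g ≡ ∏ xs h
      ∏-cong [] e = refl
      ∏-cong (z ∷ xs) e = cong₂ _*_ (e z) (∏-cong xs e)

      -- The parameter `0#` may itself be bad. It becomes accessible because the high coefficients
      -- vanish at every `y`, not only at the good ones.
      f-poly : IsPoly (suc x) f
      f-poly = red 0# , λ c → trans (∏-cong us (λ u → cong (λ z → c + - z) (sym (l0 u))))
        (trans (sym (eval-red 0# c)) (eval-trunc 1+x≤q (red-high 0#) c))

      vals : List Carrier
      vals = deduplicate _≟_ (List.map a us)

      -- More than x roots make `f`, of degree at most x, vanish on the whole field; hence `a` hits
      -- every element, and since |us| is the order it does so once each.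
      many : suc x ℕ.≤ length vals → Unique (List.map a us)
      many le = Unique-resp-↭ (↭-sym (∋all⇒↭elements (trans (Listₚ.length-map a us) len) ∋all)) unique
        where
        f≡0 : ∀ c → f c ≡ 0#
        f≡0 = poly-roots f-poly vals (deduplicate-! _≟_ _) le
          (λ r∈ → let u , u∈ , e = ∈-map⁻ a (∈-deduplicate⁻ _≟_ (List.map a us) r∈) in ∏-zero u∈ (x≡y⇒x-y≡0 e))
        ∋all : ∀ c → c ∈ List.map a us
        ∋all c = let u , u∈ , e = ∏-zero⁻ us (f≡0 c) in subst (_∈ List.map a us) (sym (x-y≡0⇒x≡y e)) (∈-map⁺ a u∈)

      -- Summing `w (l u y)` over `us` gives a polynomial in `y` of degree below x. At a good `y`
      -- the values `l u y` run once through the field, so the sum vanishes by `∑-poly`; with at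
      -- least x good parameters it vanishes identically. At `y = 0#` it is `w c` times the
      -- multiplicity of `c`.
      few : length vals ℕ.≤ x → ∀ c → ∑ us (λ u → δ (a u) c) ≡ 0#
      few le c with c ∈? vals
      ... | no c∉ = trans (∑-cong∈ us (λ u∈ → δ-≢ (λ e → c∉ (subst (_∈ vals) e (∈-deduplicate⁺ _≟_ (∈-map⁺ a u∈)))))) (∑-zero us)
      ... | yes c∈ = x*y≡0⇒y≡0 wc≢0 (trans (sym (∑-* us (w c) _)) (trans (∑-cong∈ us pick) (trans (∑-cong us (λ u → cong w (sym (l0 u)))) (W≡0 0#))))
        where
        others : List Carrier
        others = filter (λ z → ¬? (z ≟ c)) vals
        others< : suc (length others) ℕ.≤ x
        others< = ℕₚ.≤-trans (Listₚ.filter-notAll (λ z → ¬? (z ≟ c)) vals (lose c∈ (λ ne → ne refl))) le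
        -- The unnormalised Lagrange polynomial for `c`: zero at the other values of `a`, and of
        -- degree below x since there are at most x - 1 of them.
        w : Carrier → Carrier
        w z = ∏ others (λ o → z + - o)
        w-poly : IsPoly x w
        w-poly = poly-weaken others< (poly-ext (λ z → ∏-cong' others z) (poly-∏ others (-_) (λ _ → 1#)))
          where
          ∏-cong' : ∀ os z → ∏ os (λ o → - o + z * 1#) ≡ ∏ os (λ o → z + - o)
          ∏-cong' [] z = refl
          ∏-cong' (o ∷ os) z = cong₂ _*_ (trans (+-comm _ _) (cong (_+ - o) (*-identityʳ z))) (∏-cong' os z)
        wc≢0 : w c ≢ 0#
        wc≢0 = ∏-nonzero others (λ o∈ e → proj₂ (∈-filter⁻ (λ z → ¬? (z ≟ c)) {xs = vals} o∈) (sym (x-y≡0⇒x≡y e)))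
        W : Carrier → Carrier
        W y = ∑ us (λ u → w (l u y))
        W-poly : IsPoly x W
        W-poly = poly-∑ us (λ u y → w (l u y)) (λ u → poly-weaken others< (poly-ext (shape u others) (poly-∏ others (λ o → a u + - o) (λ _ → b u))))
          where
          shape : ∀ u os y → ∏ os (λ o → (a u + - o) + y * b u) ≡ ∏ os (λ o → l u y + - o)
          shape u [] y = refl
          shape u (o ∷ os) y = cong₂ _*_ (solve 3 (λ a o t → (a :+ :- o) :+ t := (a :+ t) :+ :- o) refl (a u) o (y * b u)) (shape u os y)
        W≡0 : ∀ y → W y ≡ 0#
        W≡0 = poly-roots W-poly goods goods-unique x≤goods (λ {y} y∈ →
          trans (sym (∑-map (λ u → l u y) us w))
            (trans (∑-↭ w (∋all⇒↭elements (trans (Listₚ.length-map _ us) len)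
              (λ c → let u , u∈ , e = good y (goods-good y∈) c in subst (_∈ List.map (λ u → l u y) us) e (∈-map⁺ _ u∈))))
            (∑-poly 1+x≤q w-poly)))
        pick : ∀ {u} → u ∈ us → w c * δ (a u) c ≡ w (a u)
        pick {u} u∈ with a u ≟ c
        ... | yes refl = *-identityʳ _
        ... | no ne = trans (zeroʳ _) (sym (∏-zero (∈-filter⁺ (λ z → ¬? (z ≟ c)) (∈-deduplicate⁺ _≟_ (∈-map⁺ a u∈)) ne) (-‿inverseʳ (a u))))

    redei : Unique (List.map a us) ⊎ (∀ c → ∑ us (λ u → δ (a u) c) ≡ 0#)
    redei with suc x ℕ.≤? length vals
    ... | yes le = inj₁ (many le)
    ... | no nle = inj₂ (few (ℕₚ.≤-pred (ℕₚ.≰⇒> nle)))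

  module _ {Pt : Set} (𝒜 : (Pt → Carrier) → Set) (comb : ∀ {α β} t → 𝒜 α → 𝒜 β → 𝒜 (λ P → α P + t * β P)) where

    -- Of the functionals β + tα, with α from the induction hypothesis and β nonzero at the new point,
    -- each old point excludes one t.
    avoid : ∀ {α₀} → 𝒜 α₀ → (xs : List Pt) → length xs ℕ.≤ order → (∀ {P} → P ∈ xs → ∃[ α ] (𝒜 α × α P ≢ 0#)) →
            ∃[ α ] (𝒜 α × (∀ {P} → P ∈ xs → α P ≢ 0#))
    avoid a₀ [] _ _ = _ , a₀ , λ ()
    avoid a₀ (P ∷ xs) len sep with avoid a₀ xs (ℕₚ.<⇒≤ len) (sep ∘ there) | sep (here refl)
    ... | α , aα , nz | β , aβ , βP≢0 with α P ≟ 0#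
    ... | no αP≢0 = α , aα , λ { (here refl) → αP≢0 ; (there p) → nz p }
    ... | yes αP≡0 with ∃∉ (List.map (λ R → - β R * α R ⁻¹) xs) (ℕₚ.≤-trans (s≤s (ℕₚ.≤-reflexive (Listₚ.length-map _ xs))) len)
    ... | t , t∉ = (λ R → β R + t * α R) , comb t aβ aα , λ
      { (here refl) e → βP≢0 (trans (sym (x≡0⇒a+t*x≡a αP≡0)) e)
      ; {R} (there p) e → t∉ (subst (_∈ List.map (λ R → - β R * α R ⁻¹) xs) (linear-root (nz p) e) (∈-map⁺ _ p)) }

  -- Zeros of one functional on the two parts of the blocking set.

  module Intersections {Pt : Set} (_≟P_ : DecidableEquality Pt)
    (Φ : (Pt → Carrier) → Set) (comb : ∀ {α β} t → Φ α → Φ β → Φ (λ P → α P + t * β P))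
    (separating : ∀ P → ∃[ α ] (Φ α × α P ≢ 0#))
    (D U : List Pt) (U-unique : Unique U) (U-len : length U ≡ order) (2|D|≤q : length D ℕ.+ length D ℕ.≤ order)
    (blocking : ∀ {φ} → Φ φ → ∃[ P ] (P ∈ D ++ U × φ P ≡ 0#))
    (essential : ∀ {P} → P ∈ D → ¬ (∀ {φ} → Φ φ → ∃[ R ] (R ∈ D ++ U × R ≢ P × φ R ≡ 0#)))
    {λ′ : Pt → Carrier} (Φλ : Φ λ′) (λ-D : ∀ {P} → P ∈ D → λ′ P ≡ 0#) (λ-U : ∀ {P} → P ∈ U → λ′ P ≢ 0#)
    where

    ratio : (Pt → Carrier) → Pt → Carrier
    ratio φ P = φ P * λ′ P ⁻¹

    private
      |D|≤q : length D ℕ.≤ order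
      |D|≤q = ℕₚ.≤-trans (ℕₚ.m≤m+n (length D) (length D)) 2|D|≤q

      ratio-≡ : ∀ {φ P c} → P ∈ U → φ P + - c * λ′ P ≡ 0# → ratio φ P ≡ c
      ratio-≡ {φ} {P} {c} P∈ e = begin
        φ P * λ′ P ⁻¹ ≡⟨ cong (_* λ′ P ⁻¹) (x-y≡0⇒x≡y (trans (cong (φ P +_) (-‿distribˡ-* c (λ′ P))) e)) ⟩
        c * λ′ P * λ′ P ⁻¹ ≡⟨ *-assoc _ _ _ ⟩
        c * (λ′ P * λ′ P ⁻¹) ≡⟨ cong (c *_) (⁻¹-inverseʳ (λ-U P∈)) ⟩
        c * 1# ≡⟨ *-identityʳ c ⟩
        c ∎
        where open ≡-Reasoning

      ratio-* : ∀ φ {P} → P ∈ U → ratio φ P * λ′ P ≡ φ P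
      ratio-* φ {P} P∈ = trans (*-assoc _ _ _) (trans (cong (φ P *_) (⁻¹-inverseˡ (λ-U P∈))) (*-identityʳ _))

      ψ-exists : ∃[ ψ ] (Φ ψ × (∀ {P} → P ∈ D → ψ P ≢ 0#))
      ψ-exists = avoid Φ comb Φλ D |D|≤q (λ {P} _ → separating P)

      -- φ - cλ′ agrees with φ on `D`, where `λ′` vanishes, so the zero supplied by blocking lies on
      -- `U`, and there the ratio is `c`.
      onto : ∀ {φ} → Φ φ → (∀ {P} → P ∈ D → φ P ≢ 0#) → ∀ c → ∃[ P ] (P ∈ U × ratio φ P ≡ c)
      onto {φ} Φφ nz c with blocking (comb (- c) Φφ Φλ)
      ... | P , P∈ , e with ∈-++⁻ D P∈
      ... | inj₁ P∈D = ⊥-elim (nz P∈D (trans (sym (x≡0⇒a+t*x≡a (λ-D P∈D))) e))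
      ... | inj₂ P∈U = P , P∈U , ratio-≡ {φ} P∈U e

      onto-↭ : ∀ {φ} → Φ φ → (∀ {P} → P ∈ D → φ P ≢ 0#) → List.map (ratio φ) U ↭ elements
      onto-↭ {φ} Φφ nz = ∋all⇒↭elements (trans (Listₚ.length-map _ U) U-len)
        (λ c → let P , P∈ , e = onto Φφ nz c in subst (_∈ List.map (ratio φ) U) e (∈-map⁺ _ P∈))

      dichotomy : ∀ {φ} → Φ φ → 1 ℕ.≤ length D → Unique (List.map (ratio φ) U) ⊎ (∀ c → ∑ U (λ u → δ (ratio φ u) c) ≡ 0#)
      dichotomy {φ} Φφ 1≤D with ψ-exists
      ... | ψ , Φψ , ψ≢0 = redei U (ratio φ) (ratio ψ) U-len (length D) 1≤D 2|D|≤q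
              (List.map (λ P → - φ P * ψ P ⁻¹) D) (ℕₚ.≤-reflexive (Listₚ.length-map _ D)) good
        where
        good : ∀ y → y ∉ List.map (λ P → - φ P * ψ P ⁻¹) D → ∀ c → ∃[ u ] (u ∈ U × ratio φ u + y * ratio ψ u ≡ c)
        good y y∉ c with onto (comb y Φφ Φψ) nz c
          where
          nz : ∀ {P} → P ∈ D → φ P + y * ψ P ≢ 0#
          nz {P} P∈ e = y∉ (subst (_∈ List.map (λ P → - φ P * ψ P ⁻¹) D) (linear-root (ψ≢0 P∈) e) (∈-map⁺ _ P∈))
        ... | u , u∈ , e = u , u∈ , trans (solve 4 (λ a y b i → a :* i :+ y :* (b :* i) := (a :+ y :* b) :* i) refl (φ u) y (ψ u) (λ′ u ⁻¹)) e

      δ-ratio : ∀ φ {u} → u ∈ U → δ (φ u) 0# ≡ δ (ratio φ u) 0#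
      δ-ratio φ {u} u∈ = δ-⇔ (λ e → trans (cong (_* λ′ u ⁻¹) e) (zeroˡ _))
        (λ e → trans (sym (ratio-* φ u∈)) (trans (cong (_* λ′ u) e) (zeroˡ _)))

      module _ (u₁ u₂ : Pt) where
        ε : (Pt → Carrier) → Carrier
        ε α = ratio α u₁ + - ratio α u₂

        ε-comb : ∀ α β t → ε (λ P → α P + t * β P) ≡ ε α + t * ε β
        ε-comb α β t = trans (cong₂ (λ y z → y + - z) (ratio-comb u₁) (ratio-comb u₂))
          (solve 5 (λ a b a' b' t → (a :+ t :* b) :- (a' :+ t :* b') := (a :- a') :+ t :* (b :- b')) refl
            (ratio α u₁) (ratio β u₁) (ratio α u₂) (ratio β u₂) t)
          where
          ratio-comb : ∀ P → ratio (λ P → α P + t * β P) P ≡ ratio α P + t * ratio β P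
          ratio-comb P = solve 4 (λ a t b i → (a :+ t :* b) :* i := a :* i :+ t :* (b :* i)) refl (α P) t (β P) (λ′ P ⁻¹)

        Identifying : (Pt → Carrier) → Set
        Identifying α = Φ α × ε α ≡ 0#

        identifying-comb : ∀ {α β} t → Identifying α → Identifying β → Identifying (λ P → α P + t * β P)
        identifying-comb {α} {β} t (Φα , e) (Φβ , e') = comb t Φα Φβ ,
          trans (ε-comb α β t) (trans (cong₂ (λ y z → y + t * z) e e') (trans (+-identityˡ _) (zeroʳ t)))

        -- If φ′, with P as its only zero on D, identifies u₁ and u₂, then so does every φ vanishing at P: otherwise some
        -- identifying functional would have no zero on D, against onto-↭.
        identify : ∀ {φ φ′ P} → Φ φ → Φ φ′ → φ P ≡ 0# → (∀ {R} → R ∈ D → R ≢ P → φ′ R ≢ 0#) →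
                   u₁ ∈ U → u₂ ∈ U → u₁ ≢ u₂ → ε φ′ ≡ 0# → ε φ ≡ 0#
        identify {φ} {φ′} {P} Φφ Φφ′ φP≡0 nz u₁∈ u₂∈ u₁≢u₂ e₁₂ with ε φ ≟ 0#
        ... | yes e = e
        ... | no εφ≢0 with avoid Identifying identifying-comb (Φφ′ , e₁₂) D |D|≤q sep
          where
          killed : ∃[ α ] (Identifying α × α P ≢ 0#)
          killed with separating P
          -- As `φ` vanishes at `P`, adding a multiple of it leaves the value at `P` alone while
          -- correcting `ε` to zero.
          ... | ψ , Φψ , ψP≢0 = (λ R → ψ R + t * φ R) , (comb t Φψ Φφ , eq) , λ e →
                ψP≢0 (trans (sym (x≡0⇒a+t*x≡a φP≡0)) e)
            where
            t = - (ε ψ * ε φ ⁻¹)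
            eq : ε (λ R → ψ R + t * φ R) ≡ 0#
            eq = trans (ε-comb ψ φ t) (eliminate (ε ψ) εφ≢0)
          sep : ∀ {R} → R ∈ D → ∃[ α ] (Identifying α × α R ≢ 0#)
          sep {R} R∈ with R ≟P P
          ... | no ne = φ′ , (Φφ′ , e₁₂) , nz R∈ ne
          ... | yes e = subst (λ Q → ∃[ α ] (Identifying α × α Q ≢ 0#)) (sym e) killed
        ... | χ , (Φχ , εχ) , χ≢0 = ⊥-elim (u₁≢u₂ (Unique-map-injective (ratio χ)
                (Unique-resp-↭ (↭-sym (onto-↭ Φχ χ≢0)) unique) u₁∈ u₂∈ (x-y≡0⇒x≡y εχ)))

      not-injective : ∀ {φ P} → Φ φ → P ∈ D → φ P ≡ 0# → ¬ Unique (List.map (ratio φ) U)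
      not-injective {φ} {P} Φφ P∈ φP≡0 φ-inj = essential P∈ meets
        where
        meets : ∀ {φ′} → Φ φ′ → ∃[ R ] (R ∈ D ++ U × R ≢ P × φ′ R ≡ 0#)
        meets {φ′} Φφ′ with Any.any? (λ R → ¬? (R ≟P P) ×-dec (φ′ R ≟ 0#)) (D ++ U)
        ... | yes p = let R , R∈ , ne , e = find p in R , R∈ , ne , e
        ... | no ¬p with ¬Unique-map⇒collision _≟_ (ratio φ′) U U-unique ¬inj
          where
          zero∉ : ∀ {R} → R ∈ D ++ U → R ≢ P → φ′ R ≢ 0#
          zero∉ R∈ ne e = ¬p (lose R∈ (ne , e))
          ¬inj : ¬ Unique (List.map (ratio φ′) U)
          ¬inj un with ∈-map⁻ (ratio φ′) (∈-resp-↭ (unique-⊆⇒↭ un (λ _ → complete _)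
                         (ℕₚ.≤-reflexive (sym (trans (Listₚ.length-map _ U) U-len)))) (complete 0#))
          ... | u , u∈ , e = zero∉ (∈-++⁺ʳ D u∈) (λ u≡P → λ-U u∈ (trans (cong λ′ u≡P) (λ-D P∈)))
                (trans (sym (ratio-* φ′ u∈)) (trans (cong (_* λ′ u) (sym e)) (zeroˡ _)))
        ... | u₁ , u₂ , u₁∈ , u₂∈ , u₁≢u₂ , e₁₂ = ⊥-elim (u₁≢u₂ (Unique-map-injective (ratio φ) φ-inj u₁∈ u₂∈
                (x-y≡0⇒x≡y (identify u₁ u₂ Φφ Φφ′ φP≡0 (λ R∈ ne e → ¬p (lose (∈-++⁺ˡ R∈) (ne , e))) u₁∈ u₂∈ u₁≢u₂ (x≡y⇒x-y≡0 e₁₂)))))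

      ∑-ratio : ∀ φ → ∑ U (λ u → δ (φ u) 0#) ≡ ∑ U (λ u → δ (ratio φ u) 0#)
      ∑-ratio φ = ∑-cong∈ U {λ u → δ (φ u) 0#} {λ u → δ (ratio φ u) 0#} (λ {u} u∈ → δ-ratio φ u∈)

    off-D⇒one : ∀ {φ} → Φ φ → (∀ {P} → P ∈ D → φ P ≢ 0#) → ∑ U (λ u → δ (φ u) 0#) ≡ 1#
    off-D⇒one {φ} Φφ nz = begin
      ∑ U (λ u → δ (φ u) 0#) ≡⟨ ∑-ratio φ ⟩
      ∑ U (λ u → δ (ratio φ u) 0#) ≡⟨ ∑-map (ratio φ) U (λ z → δ z 0#) ⟨
      ∑ (List.map (ratio φ) U) (λ z → δ z 0#) ≡⟨ ∑-↭ (λ z → δ z 0#) (onto-↭ Φφ nz) ⟩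
      ∑ elements (λ z → δ z 0#) ≡⟨ ∑-δ-elements 0# ⟩
      1# ∎
      where open ≡-Reasoning

    on-D⇒zero : ∀ {φ P} → Φ φ → P ∈ D → φ P ≡ 0# → ∑ U (λ u → δ (φ u) 0#) ≡ 0#
    on-D⇒zero {φ} {P} Φφ P∈ e = [ (λ inj → ⊥-elim (not-injective Φφ P∈ e inj)) , (λ z → trans (∑-ratio φ) (z 0#)) ]′
      (dichotomy Φφ (∈⇒1≤ P∈))
      where
      ∈⇒1≤ : ∀ {xs : List Pt} → P ∈ xs → 1 ℕ.≤ length xs
      ∈⇒1≤ {_ ∷ _} _ = s≤s z≤n

-- Linear algebra over a finite field: kernels, annihilators, point counts of spans.

module LinearAlgebra (F : FiniteField) where
  open FiniteFieldProps F public
  open Solver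
  open PG F public using (allVecs; NVec; lead; zcons; toVec; allNVecs; lincomb; LinIndep)

  infixl 6 _⊕_
  infixr 7 _⊙_

  _⊕_ : ∀ {N} → Vec Carrier N → Vec Carrier N → Vec Carrier N
  _⊕_ = zipWith _+_

  _⊙_ : ∀ {N} → Carrier → Vec Carrier N → Vec Carrier N
  c ⊙ v = Vec.map (c *_) v

  𝟎 : ∀ {N} → Vec Carrier N
  𝟎 = replicate _ 0#

  ⊕-identityˡ : ∀ {N} (v : Vec Carrier N) → 𝟎 ⊕ v ≡ v
  ⊕-identityˡ = Vecₚ.zipWith-identityˡ +-identityˡ

  ⊕-identityʳ : ∀ {N} (v : Vec Carrier N) → v ⊕ 𝟎 ≡ v
  ⊕-identityʳ = Vecₚ.zipWith-identityʳ +-identityʳ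

  ⊙-zeroˡ : ∀ {N} (v : Vec Carrier N) → 0# ⊙ v ≡ 𝟎
  ⊙-zeroˡ [] = refl
  ⊙-zeroˡ (x ∷ v) = cong₂ _∷_ (zeroˡ x) (⊙-zeroˡ v)

  ⊙-zeroʳ : ∀ {N} c → c ⊙ 𝟎 {N} ≡ 𝟎
  ⊙-zeroʳ {N} c = trans (Vecₚ.map-replicate _ 0# N) (cong (replicate N) (zeroʳ c))

  ⊙-identity : ∀ {N} (v : Vec Carrier N) → 1# ⊙ v ≡ v
  ⊙-identity v = trans (Vecₚ.map-cong *-identityˡ v) (Vecₚ.map-id v)

  ⊙-assoc : ∀ {N} a b (v : Vec Carrier N) → a ⊙ (b ⊙ v) ≡ (a * b) ⊙ v
  ⊙-assoc a b v = trans (sym (Vecₚ.map-∘ _ _ v)) (Vecₚ.map-cong (λ x → sym (*-assoc a b x)) v)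

  ⊙-distribʳ : ∀ {N} a b (v : Vec Carrier N) → (a + b) ⊙ v ≡ a ⊙ v ⊕ b ⊙ v
  ⊙-distribʳ a b [] = refl
  ⊙-distribʳ a b (x ∷ v) = cong₂ _∷_ (distribʳ x a b) (⊙-distribʳ a b v)

  ⊙-cancel : ∀ {N c} {v : Vec Carrier N} → v ≢ 𝟎 → c ⊙ v ≡ 𝟎 → c ≡ 0#
  ⊙-cancel {c = c} {v} ne e with c ≟ 0#
  ... | yes z = z
  ... | no c≢0 = ⊥-elim (ne (trans (sym (trans (⊙-assoc (c ⁻¹) c v) (trans (cong (_⊙ v) (⁻¹-inverseˡ c≢0)) (⊙-identity v))))
                   (trans (cong (c ⁻¹ ⊙_) e) (⊙-zeroʳ _))))

  self-difference : ∀ {N} (v : Vec Carrier N) → - 1# ⊙ v ⊕ v ≡ 𝟎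
  self-difference [] = refl
  self-difference (x ∷ v) = cong₂ _∷_ (trans (cong (_+ x) (-1*x≈-x x)) (-‿inverseˡ x)) (self-difference v)

  difference≡𝟎⇒≡ : ∀ {N} (u v : Vec Carrier N) → - 1# ⊙ v ⊕ u ≡ 𝟎 → u ≡ v
  difference≡𝟎⇒≡ [] [] _ = refl
  difference≡𝟎⇒≡ (x ∷ u) (y ∷ v) e = cong₂ _∷_
    (x-y≡0⇒x≡y (trans (+-comm _ _) (trans (cong (_+ x) (sym (-1*x≈-x y))) (Vecₚ.∷-injectiveˡ e))))
    (difference≡𝟎⇒≡ u v (Vecₚ.∷-injectiveʳ e))

  lookup≡0⇒≡𝟎 : ∀ {N} (v : Vec Carrier N) → (∀ i → lookup v i ≡ 0#) → v ≡ 𝟎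
  lookup≡0⇒≡𝟎 [] z = refl
  lookup≡0⇒≡𝟎 (x ∷ v) z = cong₂ _∷_ (z Fin.zero) (lookup≡0⇒≡𝟎 v (z ∘ Fin.suc))

  lincomb-⊕ : ∀ {r N} (cs ds : Vec Carrier r) (vs : Vec (Vec Carrier N) r) → lincomb (cs ⊕ ds) vs ≡ lincomb cs vs ⊕ lincomb ds vs
  lincomb-⊕ [] [] [] = sym (⊕-identityˡ _)
  lincomb-⊕ (c ∷ cs) (d ∷ ds) (v ∷ vs) = trans (cong ((c + d) ⊙ v ⊕_) (lincomb-⊕ cs ds vs)) (lemma v _ _)
    where
    lemma : ∀ {N} (v s t : Vec Carrier N) → (c + d) ⊙ v ⊕ (s ⊕ t) ≡ (c ⊙ v ⊕ s) ⊕ (d ⊙ v ⊕ t)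
    lemma [] [] [] = refl
    lemma (x ∷ v) (y ∷ s) (z ∷ t) = cong₂ _∷_
      (solve 5 (λ c d x y z → (c :+ d) :* x :+ (y :+ z) := (c :* x :+ y) :+ (d :* x :+ z)) refl c d x y z) (lemma v s t)

  lincomb-⊙ : ∀ {r N} c (cs : Vec Carrier r) (vs : Vec (Vec Carrier N) r) → lincomb (c ⊙ cs) vs ≡ c ⊙ lincomb cs vs
  lincomb-⊙ c [] [] = sym (⊙-zeroʳ c)
  lincomb-⊙ c (d ∷ cs) (v ∷ vs) = trans (cong ((c * d) ⊙ v ⊕_) (lincomb-⊙ c cs vs)) (lemma v _)
    where
    lemma : ∀ {N} (v s : Vec Carrier N) → (c * d) ⊙ v ⊕ c ⊙ s ≡ c ⊙ (d ⊙ v ⊕ s)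
    lemma [] [] = refl
    lemma (x ∷ v) (y ∷ s) = cong₂ _∷_ (solve 4 (λ c d x y → (c :* d) :* x :+ c :* y := c :* (d :* x :+ y)) refl c d x y) (lemma v s)

  lincomb-𝟎 : ∀ {r N} (vs : Vec (Vec Carrier N) r) → lincomb 𝟎 vs ≡ 𝟎
  lincomb-𝟎 [] = refl
  lincomb-𝟎 (v ∷ vs) = trans (cong₂ _⊕_ (⊙-zeroˡ v) (lincomb-𝟎 vs)) (⊕-identityˡ 𝟎)

  lincomb-lincomb : ∀ {r s N} (cs : Vec Carrier r) (ds : Vec (Vec Carrier s) r) (vs : Vec (Vec Carrier N) s) →
                    lincomb cs (Vec.map (λ d → lincomb d vs) ds) ≡ lincomb (lincomb cs ds) vs
  lincomb-lincomb [] [] vs = sym (lincomb-𝟎 vs)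
  lincomb-lincomb (c ∷ cs) (d ∷ ds) vs = trans (cong₂ _⊕_ (sym (lincomb-⊙ c d vs)) (lincomb-lincomb cs ds vs)) (sym (lincomb-⊕ (c ⊙ d) _ vs))

  record Linear {N} (φ : Vec Carrier N → Carrier) : Set where
    field
      additive : ∀ u v → φ (u ⊕ v) ≡ φ u + φ v
      homogeneous : ∀ c v → φ (c ⊙ v) ≡ c * φ v

    at-𝟎 : φ 𝟎 ≡ 0#
    at-𝟎 = trans (cong φ (sym (⊙-zeroˡ 𝟎))) (trans (homogeneous 0# 𝟎) (zeroˡ _))

    at-combination : ∀ c u v → φ (c ⊙ u ⊕ v) ≡ c * φ u + φ v
    at-combination c u v = trans (additive _ v) (cong (_+ φ v) (homogeneous c u))

    vanish : ∀ {r} (cs : Vec Carrier r) (vs : Vec (Vec Carrier N) r) → (∀ i → φ (lookup vs i) ≡ 0#) → φ (lincomb cs vs) ≡ 0#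
    vanish [] [] z = at-𝟎
    vanish (c ∷ cs) (v ∷ vs) z = trans (at-combination c v _)
      (trans (cong₂ (λ s t → c * s + t) (z Fin.zero) (vanish cs vs (z ∘ Fin.suc))) (trans (+-identityʳ _) (zeroʳ c)))

  open Linear public

  Linear-lookup : ∀ {N} (i : Fin N) → Linear (λ v → lookup v i)
  Linear-lookup i = record { additive = λ u v → Vecₚ.lookup-zipWith _+_ i u v ; homogeneous = λ c v → Vecₚ.lookup-map i (c *_) v }

  Linear-comb : ∀ {N} {φ ψ : Vec Carrier N → Carrier} t → Linear φ → Linear ψ → Linear (λ v → φ v + t * ψ v)
  Linear-comb {φ = φ} {ψ} t l m = record
    { additive = λ u v → trans (cong₂ (λ x y → x + t * y) (additive l u v) (additive m u v))
        (solve 5 (λ a b c d t → (a :+ b) :+ t :* (c :+ d) := (a :+ t :* c) :+ (b :+ t :* d)) refl (φ u) (φ v) (ψ u) (ψ v) t)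
    ; homogeneous = λ c v → trans (cong₂ (λ x y → x + t * y) (homogeneous l c v) (homogeneous m c v))
        (solve 4 (λ c a t b → c :* a :+ t :* (c :* b) := c :* (a :+ t :* b)) refl c (φ v) t (ψ v)) }

  Linear-lincomb : ∀ {r N} (ds : Vec (Vec Carrier N) r) i → Linear (λ cs → lookup (lincomb cs ds) i)
  Linear-lincomb ds i = record
    { additive = λ u v → trans (cong (λ w → lookup w i) (lincomb-⊕ u v ds)) (Vecₚ.lookup-zipWith _+_ i (lincomb u ds) (lincomb v ds))
    ; homogeneous = λ c v → trans (cong (λ w → lookup w i) (lincomb-⊙ c v ds)) (Vecₚ.lookup-map i (c *_) (lincomb v ds)) }

  InSpan : ∀ {r N} → Vec (Vec Carrier N) r → Vec Carrier N → Set
  InSpan vs w = ∃[ cs ] (w ≡ lincomb cs vs)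

  LinIndep-tail : ∀ {r N v} {vs : Vec (Vec Carrier N) r} → LinIndep (v ∷ vs) → LinIndep vs
  LinIndep-tail {v = v} ind cs e = Vecₚ.∷-injectiveʳ (ind (0# ∷ cs) (trans (cong₂ _⊕_ (⊙-zeroˡ v) e) (⊕-identityˡ 𝟎)))

  private
    -- Projection onto the kernel of `ρ` along `v`. `lift` collects the multiples of `v` introduced
    -- by projecting, so that independence and span can be compared with those of `v ∷ ws`.
    module Pivot {N : ℕ} {ρ : Vec Carrier N → Carrier} (lin : Linear ρ) (v : Vec Carrier N) (ρv≢0 : ρ v ≢ 0#) where
      coefficient : Vec Carrier N → Carrier
      coefficient w = - (ρ w * ρ v ⁻¹)

      project : Vec Carrier N → Vec Carrier N
      project w = coefficient w ⊙ v ⊕ w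

      ρ-project : ∀ w → ρ (project w) ≡ 0#
      ρ-project w = trans (at-combination lin _ v w) (trans (+-comm _ _) (eliminate (ρ w) ρv≢0))

      lift : ∀ {r} → Vec Carrier r → Vec (Vec Carrier N) r → Carrier
      lift [] [] = 0#
      lift (c ∷ cs) (w ∷ ws) = c * coefficient w + lift cs ws

      lincomb-project : ∀ {r} (cs : Vec Carrier r) ws → lincomb cs (Vec.map project ws) ≡ lincomb (lift cs ws ∷ cs) (v ∷ ws)
      lincomb-project [] [] = sym (trans (cong (_⊕ 𝟎) (⊙-zeroˡ v)) (⊕-identityˡ 𝟎))
      lincomb-project (c ∷ cs) (w ∷ ws) = trans (cong (c ⊙ project w ⊕_) (lincomb-project cs ws)) (lemma c (coefficient w) (lift cs ws) v w _)
        where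
        lemma : ∀ {N} c t s (v w l : Vec Carrier N) → c ⊙ (t ⊙ v ⊕ w) ⊕ (s ⊙ v ⊕ l) ≡ (c * t + s) ⊙ v ⊕ (c ⊙ w ⊕ l)
        lemma c t s [] [] [] = refl
        lemma c t s (x ∷ v) (y ∷ w) (z ∷ l) = cong₂ _∷_
          (solve 6 (λ c t s x y z → c :* (t :* x :+ y) :+ (s :* x :+ z) := (c :* t :+ s) :* x :+ (c :* y :+ z)) refl c t s x y z) (lemma c t s v w l)

      ρ-lincomb-project : ∀ {r} (cs : Vec Carrier r) ws → ρ (lincomb cs (Vec.map project ws)) ≡ 0#
      ρ-lincomb-project cs ws = vanish lin cs (Vec.map project ws) (λ i → trans (cong ρ (Vecₚ.lookup-map i project ws)) (ρ-project _))

      span-project : ∀ {r} c (cs : Vec Carrier r) ws → ρ (lincomb (c ∷ cs) (v ∷ ws)) ≡ 0# →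
                     lincomb (c ∷ cs) (v ∷ ws) ≡ lincomb cs (Vec.map project ws)
      span-project c cs ws e = trans (cong (λ d → lincomb (d ∷ cs) (v ∷ ws)) c≡lift) (sym (lincomb-project cs ws))
        where
        c≡lift : c ≡ lift cs ws
        c≡lift = *-cancelˡ ρv≢0 (trans (*-comm _ _) (trans (+-cancelʳ (ρ (lincomb cs ws)) _ _
          (trans (sym (at-combination lin c v _)) (trans e (trans (sym (trans (cong ρ (sym (lincomb-project cs ws))) (ρ-lincomb-project cs ws)))
            (at-combination lin _ v _))))) (*-comm _ _)))

  -- `s` counts the functionals imposed. The rank is only bounded below because dependent
  -- functionals cut out less; `complete-span` still makes the basis span the exact solution space.
  record Kernel {r N} (vs : Vec (Vec Carrier N) r) (Killed : Vec Carrier N → Set) (s : ℕ) : Set where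
    field
      rank : ℕ
      rank-≥ : r ℕ.≤ s ℕ.+ rank
      basis : Vec (Vec Carrier N) rank
      independent : LinIndep basis
      in-span : ∀ {w} → InSpan basis w → InSpan vs w
      killed : ∀ {w} → InSpan basis w → Killed w
      complete-span : ∀ {w} → InSpan vs w → Killed w → InSpan basis w

  -- Gaussian elimination for one equation: a first vector with nonzero value is the pivot and is
  -- lost, otherwise it is kept and the search continues in the tail.
  kernel₁ : ∀ {r N} (vs : Vec (Vec Carrier N) r) → LinIndep vs → ∀ {ρ} → Linear ρ → Kernel vs (λ w → ρ w ≡ 0#) 1
  kernel₁ [] ind {ρ} lin = record
    { rank = 0 ; rank-≥ = z≤n ; basis = [] ; independent = λ { [] _ → refl } ; in-span = λ h → h
    ; killed = λ { ([] , refl) → at-𝟎 lin } ; complete-span = λ h _ → h }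
  kernel₁ (v ∷ ws) ind {ρ} lin = [ zero-case , pivot-case ]′ (decide (ρ v ≟ 0#))
    where
    decide : ∀ {P : Set} → Dec P → P ⊎ ¬ P
    decide (yes p) = inj₁ p
    decide (no p) = inj₂ p
    pivot-case : ρ v ≢ 0# → Kernel (v ∷ ws) (λ w → ρ w ≡ 0#) 1
    pivot-case ρv≢0 = record
      { rank = _ ; rank-≥ = ℕₚ.≤-refl ; basis = Vec.map project ws
      ; independent = λ cs e → Vecₚ.∷-injectiveʳ (ind _ (trans (sym (lincomb-project cs ws)) e))
      ; in-span = λ { (cs , refl) → lift cs ws ∷ cs , lincomb-project cs ws }
      ; killed = λ { (cs , refl) → ρ-lincomb-project cs ws }
      ; complete-span = λ { (c ∷ cs , refl) e → cs , span-project c cs ws e } }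
      where open Pivot lin v ρv≢0
    zero-case : ρ v ≡ 0# → Kernel (v ∷ ws) (λ w → ρ w ≡ 0#) 1
    zero-case ρv≡0 = record
      { rank = suc K.rank ; rank-≥ = s≤s K.rank-≥ ; basis = v ∷ K.basis
      ; independent = ind'
      ; in-span = λ { (c ∷ cs , refl) → let ds , e = K.in-span (cs , refl) in c ∷ ds , cong (c ⊙ v ⊕_) e }
      ; killed = λ { (c ∷ cs , refl) → trans (ρ-head c _) (K.killed (cs , refl)) }
      ; complete-span = λ { (c ∷ cs , refl) e → let ds , e' = K.complete-span (cs , refl) (trans (sym (ρ-head c _)) e) in c ∷ ds , cong (c ⊙ v ⊕_) e' } }
      where
      module K = Kernel (kernel₁ ws (LinIndep-tail ind) lin)
      ρ-head : ∀ c w → ρ (c ⊙ v ⊕ w) ≡ ρ w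
      ρ-head c w = trans (at-combination lin c v w) (trans (cong (λ z → c * z + ρ w) ρv≡0) (trans (cong (_+ ρ w) (zeroʳ c)) (+-identityˡ _)))
      ind' : LinIndep (v ∷ K.basis)
      ind' (c ∷ cs) e with K.in-span (cs , refl)
      ... | ds , e' with ind (c ∷ ds) (trans (cong (c ⊙ v ⊕_) (sym e')) e)
      ... | refl = cong (0# ∷_) (K.independent cs (trans (sym (trans (cong (_⊕ lincomb cs K.basis) (⊙-zeroˡ v)) (⊕-identityˡ _))) e))

  kernel : ∀ {r N} (vs : Vec (Vec Carrier N) r) → LinIndep vs → ∀ m {ρ : Fin m → Vec Carrier N → Carrier} →
           (∀ i → Linear (ρ i)) → Kernel vs (λ w → ∀ i → ρ i w ≡ 0#) m
  kernel vs ind zero lin = record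
    { rank = _ ; rank-≥ = ℕₚ.≤-refl ; basis = vs ; independent = ind ; in-span = λ h → h ; killed = λ _ () ; complete-span = λ h _ → h }
  kernel vs ind (suc m) {ρ} lin = record
    { rank = L.rank
    ; rank-≥ = ℕₚ.≤-trans K.rank-≥ (s≤s L.rank-≥)
    ; basis = L.basis ; independent = L.independent
    ; in-span = K.in-span ∘ L.in-span
    ; killed = λ { h Fin.zero → K.killed (L.in-span h) ; h (Fin.suc i) → L.killed h i }
    ; complete-span = λ h z → L.complete-span (K.complete-span h (z Fin.zero)) (z ∘ Fin.suc) }
    where
    module K = Kernel (kernel₁ vs ind (lin Fin.zero))
    module L = Kernel (kernel K.basis K.independent m (lin ∘ Fin.suc))

  standard : ∀ N → Vec (Vec Carrier N) N
  standard zero = []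
  standard (suc N) = (1# ∷ 𝟎) ∷ Vec.map (0# ∷_) (standard N)

  lincomb-0∷ : ∀ {r N} (cs : Vec Carrier r) (vs : Vec (Vec Carrier N) r) → lincomb cs (Vec.map (0# ∷_) vs) ≡ 0# ∷ lincomb cs vs
  lincomb-0∷ [] [] = refl
  lincomb-0∷ (c ∷ cs) (v ∷ vs) = trans (cong ((c ⊙ (0# ∷ v)) ⊕_) (lincomb-0∷ cs vs))
    (cong (_∷ (c ⊙ v ⊕ lincomb cs vs)) (trans (+-identityʳ _) (zeroʳ c)))

  lincomb-standard : ∀ {N} (cs : Vec Carrier N) → lincomb cs (standard N) ≡ cs
  lincomb-standard [] = refl
  lincomb-standard {suc N} (c ∷ cs) = trans (cong ((c ⊙ (1# ∷ 𝟎)) ⊕_) (lincomb-0∷ cs (standard N)))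
    (cong₂ _∷_ (trans (+-identityʳ _) (*-identityʳ c)) (trans (cong₂ _⊕_ (⊙-zeroʳ c) (lincomb-standard cs)) (⊕-identityˡ cs)))

  standard-independent : ∀ N → LinIndep (standard N)
  standard-independent N cs e = trans (sym (lincomb-standard cs)) e

  LinIndep⇒head≢𝟎 : ∀ {r N v} {vs : Vec (Vec Carrier N) r} → LinIndep (v ∷ vs) → v ≢ 𝟎
  LinIndep⇒head≢𝟎 {v = v} {vs} ind refl = 0≢1 (sym (Vecₚ.∷-injectiveˡ (ind (1# ∷ 𝟎)
    (trans (cong₂ _⊕_ (⊙-zeroʳ 1#) (lincomb-𝟎 vs)) (⊕-identityˡ 𝟎)))))

  underdetermined : ∀ m {ρ : Fin m → Vec Carrier (suc m) → Carrier} → (∀ i → Linear (ρ i)) → ∃[ w ] (w ≢ 𝟎 × ∀ i → ρ i w ≡ 0#)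
  underdetermined m {ρ} lin = go (kernel (standard (suc m)) (standard-independent _) m lin)
    where
    go : Kernel (standard (suc m)) (λ w → ∀ i → ρ i w ≡ 0#) m → ∃[ w ] (w ≢ 𝟎 × ∀ i → ρ i w ≡ 0#)
    go record { rank = zero ; rank-≥ = le } = ⊥-elim (ℕₚ.1+n≰n (subst (suc m ℕ.≤_) (ℕₚ.+-identityʳ m) le))
    go record { rank = suc _ ; basis = w ∷ ws ; independent = ind ; killed = z } =
      w , LinIndep⇒head≢𝟎 ind , z (1# ∷ 𝟎 , sym (trans (cong₂ _⊕_ (⊙-identity w) (lincomb-𝟎 ws)) (⊕-identityʳ w)))

  prefix-independent : ∀ {N} k {r} (vs : Vec (Vec Carrier N) r) → k ℕ.≤ r → LinIndep vs →
                       ∃[ us ] (LinIndep {k} us × (∀ {w} → InSpan us w → InSpan vs w))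
  prefix-independent {N} k {r} vs k≤r ind with ℕₚ.m≤n⇒∃[o]m+o≡n k≤r
  ... | o , refl = go k o vs ind
    where
    go : ∀ k o (vs : Vec (Vec Carrier N) (k ℕ.+ o)) → LinIndep vs → ∃[ us ] (LinIndep {k} us × (∀ {w} → InSpan us w → InSpan vs w))
    go zero o vs ind = [] , (λ { [] _ → refl }) , λ { ([] , e) → 𝟎 , trans e (sym (lincomb-𝟎 vs)) }
    go (suc k) o (v ∷ vs) ind with go k o vs (LinIndep-tail ind)
    ... | us , ind' , sp = v ∷ us , ind″ , λ { (c ∷ cs , refl) → let ds , e = sp (cs , refl) in c ∷ ds , cong (c ⊙ v ⊕_) e }
      where
      ind″ : LinIndep (v ∷ us)
      ind″ (c ∷ cs) e with sp (cs , refl)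
      ... | ds , e' with ind (c ∷ ds) (trans (cong (c ⊙ v ⊕_) (sym e')) e)
      ... | refl = cong (0# ∷_) (ind' cs (trans (sym (trans (cong (_⊕ lincomb cs us) (⊙-zeroˡ v)) (⊕-identityˡ _))) e))

  record Annihilator {r N} (vs : Vec (Vec Carrier N) r) (k : ℕ) : Set where
    field
      functional : Fin k → Vec Carrier N → Carrier
      linear : ∀ i → Linear (functional i)
      kills : ∀ {w} → InSpan vs w → ∀ i → functional i w ≡ 0#
      separates : ∀ {w} → (∀ i → functional i w ≡ 0#) → InSpan vs w

  -- Starts from all coordinate functionals. Each new vector uses up one functional as pivot, and
  -- the others are corrected to vanish on it; a pivot exists since otherwise the vector would lie
  -- in the span of the earlier ones.
  annihilator : ∀ {r N} (vs : Vec (Vec Carrier N) r) → LinIndep vs → ∃[ k ] (k ℕ.+ r ≡ N × Annihilator vs k)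
  annihilator {N = N} [] ind = N , ℕₚ.+-identityʳ N , record
    { functional = λ i v → lookup v i ; linear = Linear-lookup
    ; kills = λ { ([] , refl) i → Vecₚ.lookup-replicate i 0# }
    ; separates = λ z → [] , lookup≡0⇒≡𝟎 _ z }
  annihilator {suc r} {N} (v ∷ ws) ind = go (annihilator ws (LinIndep-tail ind))
    where
    v∉ : ¬ InSpan ws v
    v∉ (cs , e) = 0≢1 (trans (sym -0≡0) (trans (cong -_ (sym (Vecₚ.∷-injectiveˡ (ind (- 1# ∷ cs)
      (trans (cong (- 1# ⊙ v ⊕_) (sym e)) (self-difference v)))))) (-‿involutive 1#)))
    go : ∃[ k ] (k ℕ.+ r ≡ N × Annihilator ws k) → ∃[ k ] (k ℕ.+ suc r ≡ N × Annihilator (v ∷ ws) k)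
    go (zero , _ , A) = ⊥-elim (v∉ (Annihilator.separates A (λ ())))
    go (suc k , eq , A) = k , trans (ℕₚ.+-suc k r) eq , pick (Finₚ.any? (λ i → ¬? (functional i v ≟ 0#)))
      where
      open Annihilator A
      pick : Dec (∃[ i ] (functional i v ≢ 0#)) → Annihilator (v ∷ ws) k
      pick (no none) = ⊥-elim (v∉ (separates (λ i → decidable-stable (functional i v ≟ 0#) (λ ne → none (i , ne)))))
      pick (yes (i , ρv≢0)) = record
        { functional = ρ′ ; linear = λ j → Linear-comb _ (linear (punchIn i j)) (linear i)
        ; kills = λ { (c ∷ cs , refl) j → kills′ c cs j }
        ; separates = λ {w} z → let cs , e = separates (residue w z) in
            c w ∷ cs , trans (restore (c w) v w) (cong (c w ⊙ v ⊕_) e) }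
        where
        ρ : Vec Carrier N → Carrier
        ρ = functional i
        t : Fin k → Carrier
        t j = - (functional (punchIn i j) v * ρ v ⁻¹)
        ρ′ : Fin k → Vec Carrier N → Carrier
        ρ′ j w = functional (punchIn i j) w + t j * ρ w
        ρ′v≡0 : ∀ j → ρ′ j v ≡ 0#
        ρ′v≡0 j = eliminate _ ρv≢0
        kills′ : ∀ d cs j → ρ′ j (d ⊙ v ⊕ lincomb cs ws) ≡ 0#
        kills′ d cs j = trans (at-combination (Linear-comb (t j) (linear (punchIn i j)) (linear i)) d v _)
          (trans (cong₂ (λ x y → d * x + y) (ρ′v≡0 j)
            (trans (cong₂ (λ x y → x + t j * y) (kills (cs , refl) _) (kills (cs , refl) i)) (trans (+-identityˡ _) (zeroʳ _))))
            (trans (+-identityʳ _) (zeroʳ d)))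
        c : Vec Carrier N → Carrier
        c w = ρ w * ρ v ⁻¹
        residue : ∀ w → (∀ j → ρ′ j w ≡ 0#) → ∀ l → functional l (- c w ⊙ v ⊕ w) ≡ 0#
        residue w z l with i Fin.≟ l
        ... | yes refl = trans (at-combination (linear i) _ v w) (trans (+-comm _ _) (eliminate (ρ w) ρv≢0))
        ... | no i≢l = trans (at-combination (linear l) _ v w) (trans
                (solve 4 (λ a b i f → :- (a :* i) :* b :+ f := f :+ :- (b :* i) :* a) refl (ρ w) (functional l v) (ρ v ⁻¹) (functional l w))
                (subst (λ l → functional l w + - (functional l v * ρ v ⁻¹) * ρ w ≡ 0#) (Finₚ.punchIn-punchOut i≢l) (z (punchOut i≢l))))
        restore : ∀ {N} c (v w : Vec Carrier N) → w ≡ c ⊙ v ⊕ (- c ⊙ v ⊕ w)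
        restore c [] [] = refl
        restore c (x ∷ v) (y ∷ w) = cong₂ _∷_ (solve 3 (λ c x y → y := c :* x :+ (:- c :* x :+ y)) refl c x y) (restore c v w)

  allVecs-complete : ∀ {m} (v : Vec Carrier m) → v ∈ allVecs m
  allVecs-complete [] = here refl
  allVecs-complete {suc m} (x ∷ v) = go elements (complete x)
    where
    go : ∀ es → x ∈ es → (x ∷ v) ∈ concatMap (λ a → List.map (a ∷_) (allVecs m)) es
    go (e ∷ es) (here refl) = ∈-++⁺ˡ (∈-map⁺ (x ∷_) (allVecs-complete v))
    go (e ∷ es) (there p) = ∈-++⁺ʳ _ (go es p)

  anyVec? : ∀ {N} {P : Vec Carrier N → Set} → (∀ v → Dec (P v)) → Dec (∃[ v ] P v)
  anyVec? {N} P? = map′ (λ p → let v , _ , Pv = find p in v , Pv) (λ { (v , Pv) → lose (allVecs-complete v) Pv }) (Any.any? P? (allVecs N))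

  allVecs-unique : ∀ m → Unique (allVecs m)
  allVecs-unique zero = [] ∷ []
  allVecs-unique (suc m) = go elements unique
    where
    block : Carrier → List (Vec Carrier (suc m))
    block a = List.map (a ∷_) (allVecs m)
    head∈ : ∀ {v} es → v ∈ concatMap block es → Vec.head v ∈ es
    head∈ (e ∷ es) p with ∈-++⁻ (block e) p
    ... | inj₁ q with ∈-map⁻ (e ∷_) q
    ... | _ , _ , refl = here refl
    head∈ (e ∷ es) p | inj₂ q = there (head∈ es q)
    go : ∀ es → Unique es → Unique (concatMap block es)
    go [] _ = []
    go (e ∷ es) u@(_ ∷ u') = Unique-++⁺ (Unique-map⁺ Vecₚ.∷-injectiveʳ (allVecs-unique m)) (go es u')
      λ { (p , q) → let _ , _ , e' = ∈-map⁻ (e ∷_) p in Unique[x∷xs]⇒x∉xs u (subst (_∈ es) (cong Vec.head e') (head∈ es q)) }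

  length-allVecs : ∀ m → length (allVecs m) ≡ order ℕ.^ m
  length-allVecs zero = refl
  length-allVecs (suc m) = go elements
    where
    go : ∀ es → length (concatMap (λ a → List.map (a ∷_) (allVecs m)) es) ≡ length es ℕ.* order ℕ.^ m
    go [] = refl
    go (e ∷ es) = trans (Listₚ.length-++ (List.map (e ∷_) (allVecs m)))
      (cong₂ ℕ._+_ (trans (Listₚ.length-map _ (allVecs m)) (length-allVecs m)) (go es))

  allNVecs-complete : ∀ {m} (P : NVec m) → P ∈ allNVecs m
  allNVecs-complete (lead v) = ∈-++⁺ˡ (∈-map⁺ lead (allVecs-complete v))
  allNVecs-complete {suc m} (zcons P) = ∈-++⁺ʳ (List.map lead (allVecs m)) (∈-map⁺ zcons (allNVecs-complete P))

  allNVecs-unique : ∀ m → Unique (allNVecs m)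
  allNVecs-unique zero = []
  allNVecs-unique (suc m) = Unique-++⁺ (Unique-map⁺ (λ { refl → refl }) (allVecs-unique m)) (Unique-map⁺ (λ { refl → refl }) (allNVecs-unique m))
    λ { (p , q) → disjoint (∈-map⁻ lead p) (∈-map⁻ zcons q) }
    where
    disjoint : ∀ {P} → ∃[ v ] (v ∈ allVecs m × P ≡ lead v) → ∃[ Q ] (Q ∈ allNVecs m × P ≡ zcons Q) → ⊥
    disjoint (_ , _ , refl) (_ , _ , ())

  length-allNVecs : ∀ d → length (allNVecs (suc d)) ≡ θ order d
  length-allNVecs d = trans (Listₚ.length-++ (List.map lead (allVecs d)))
    (trans (cong₂ ℕ._+_ (trans (Listₚ.length-map lead (allVecs d)) (length-allVecs d)) (Listₚ.length-map zcons (allNVecs d))) (rest d))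
    where
    rest : ∀ d → order ℕ.^ d ℕ.+ length (allNVecs d) ≡ θ order d
    rest zero = refl
    rest (suc d) = cong (order ℕ.^ suc d ℕ.+_) (length-allNVecs d)

  -- Every power q^i with i ≥ 1 is zero in the field, so a projective space of any dimension has 1
  -- mod p points.
  ⟦θ⟧ : ∀ d → ⟦ θ order d ⟧ ≡ 1#
  ⟦θ⟧ zero = +-identityʳ 1#
  ⟦θ⟧ (suc d) = trans (×-homo-+ 1# (order ℕ.^ suc d) (θ order d)) (trans (cong₂ _+_
    (trans (×1-homo-* order (order ℕ.^ d)) (trans (cong (_* ⟦ order ℕ.^ d ⟧) order≡0) (zeroˡ _))) (⟦θ⟧ d)) (+-identityˡ 1#))

  toVec≢𝟎 : ∀ {m} (P : NVec m) → toVec P ≢ 𝟎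
  toVec≢𝟎 (lead v) e = 0≢1 (sym (Vecₚ.∷-injectiveˡ e))
  toVec≢𝟎 (zcons P) e = toVec≢𝟎 P (Vecₚ.∷-injectiveʳ e)

  normalise : ∀ {m} (v : Vec Carrier m) → v ≢ 𝟎 → ∃[ P ] ∃[ c ] (c ≢ 0# × v ≡ c ⊙ toVec P)
  normalise [] ne = ⊥-elim (ne refl)
  normalise (x ∷ v) ne with x ≟ 0#
  ... | yes refl = let P , c , c≢0 , e = normalise v (ne ∘ cong (0# ∷_)) in
                   zcons P , c , c≢0 , cong₂ _∷_ (sym (zeroʳ c)) e
  ... | no x≢0 = lead (x ⁻¹ ⊙ v) , x , x≢0 , cong₂ _∷_ (sym (*-identityʳ x))
                   (sym (trans (⊙-assoc x (x ⁻¹) v) (trans (cong (_⊙ v) (⁻¹-inverseʳ x≢0)) (⊙-identity v))))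

  toVec-proportional : ∀ {m} {P R : NVec m} {c} → toVec P ≡ c ⊙ toVec R → P ≡ R
  toVec-proportional {P = lead u} {lead v} {c} e with trans (Vecₚ.∷-injectiveˡ e) (*-identityʳ c)
  ... | refl = cong lead (trans (Vecₚ.∷-injectiveʳ e) (⊙-identity v))
  toVec-proportional {P = lead u} {zcons R} {c} e = ⊥-elim (0≢1 (sym (trans (Vecₚ.∷-injectiveˡ e) (zeroʳ c))))
  toVec-proportional {P = zcons P} {lead v} {c} e with trans (Vecₚ.∷-injectiveˡ e) (*-identityʳ c)
  ... | refl = ⊥-elim (toVec≢𝟎 P (trans (Vecₚ.∷-injectiveʳ e) (⊙-zeroˡ v)))
  toVec-proportional {P = zcons P} {zcons R} e = cong zcons (toVec-proportional (Vecₚ.∷-injectiveʳ e))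

  module _ {r N : ℕ} (vs : Vec (Vec Carrier N) r) (ind : LinIndep vs) where

    private
      image : ∀ (P : NVec r) → ∃[ R ] ∃[ c ] (c ≢ 0# × lincomb (toVec P) vs ≡ c ⊙ toVec R)
      image P = normalise _ (λ e → toVec≢𝟎 P (ind _ e))

      g : NVec r → NVec N
      g P = proj₁ (image P)

      g-spec : ∀ P → ∃[ c ] (c ≢ 0# × toVec (g P) ≡ lincomb (c ⊙ toVec P) vs)
      g-spec P = let R , c , c≢0 , e = image P in
        c ⁻¹ , ⁻¹-nonzero c≢0 , sym (trans (lincomb-⊙ (c ⁻¹) (toVec P) vs) (trans (cong (c ⁻¹ ⊙_) e)
          (trans (⊙-assoc (c ⁻¹) c (toVec R)) (trans (cong (_⊙ toVec R) (⁻¹-inverseˡ c≢0)) (⊙-identity _)))))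

    lincomb-injective : ∀ cs ds → lincomb cs vs ≡ lincomb ds vs → cs ≡ ds
    lincomb-injective cs ds e = difference≡𝟎⇒≡ cs ds (ind (- 1# ⊙ ds ⊕ cs) (trans (lincomb-⊕ (- 1# ⊙ ds) cs vs)
      (trans (cong (_⊕ lincomb cs vs) (lincomb-⊙ (- 1#) ds vs))
        (trans (cong (- 1# ⊙ lincomb ds vs ⊕_) e) (self-difference (lincomb ds vs))))))

    private
      g-injective : ∀ {P R} → g P ≡ g R → P ≡ R
      g-injective {P} {R} e = let c , c≢0 , eP = g-spec P ; d , d≢0 , eR = g-spec R in
        toVec-proportional {c = c ⁻¹ * d} (trans (sym (trans (⊙-assoc (c ⁻¹) c _) (trans (cong (_⊙ toVec P) (⁻¹-inverseˡ c≢0)) (⊙-identity _))))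
          (trans (cong (c ⁻¹ ⊙_) (lincomb-injective (c ⊙ toVec P) (d ⊙ toVec R) (trans (sym eP) (trans (cong toVec e) eR)))) (⊙-assoc (c ⁻¹) d _)))

      g-surjective : ∀ R → InSpan vs (toVec R) → ∃[ P ] (R ≡ g P)
      g-surjective R (cs , e) = let P , c , c≢0 , e' = normalise cs (λ { refl → toVec≢𝟎 R (trans e (lincomb-𝟎 vs)) })
                                    _ , d , d≢0 , e″ = image P in
        P , toVec-proportional {c = c * d} (trans e (trans (cong (λ z → lincomb z vs) e') (trans (lincomb-⊙ c (toVec P) vs)
              (trans (cong (c ⊙_) e″) (⊙-assoc c d _)))))

    -- The map `g`, a coordinate point sent to the normalised combination, is a bijection from the
    -- points of PG(r-1, q) onto the points of the span.
    count-span : ∀ (b : NVec N → Bool) → (∀ P → (b P ≡ true) ⇔ InSpan vs (toVec P)) →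
                 length (filter (λ P → b P Bool.≟ true) (allNVecs N)) ≡ length (allNVecs r)
    count-span b spec = ℕₚ.≤-antisym
      (ℕₚ.≤-trans (unique-⊆⇒length≤ (Unique-filter⁺ (λ P → b P Bool.≟ true) (allNVecs-unique N)) ⊆image)
        (ℕₚ.≤-reflexive (Listₚ.length-map g (allNVecs r))))
      (ℕₚ.≤-trans (ℕₚ.≤-reflexive (sym (Listₚ.length-map g (allNVecs r))))
        (unique-⊆⇒length≤ (Unique-map⁺ g-injective (allNVecs-unique r)) image⊆))
      where
      ⊆image : ∀ {P} → P ∈ filter (λ P → b P Bool.≟ true) (allNVecs N) → P ∈ List.map g (allNVecs r)
      ⊆image {P} P∈ = let _ , bP = ∈-filter⁻ (λ P → b P Bool.≟ true) {xs = allNVecs N} P∈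
                          R , e = g-surjective P (Equivalence.to (spec P) bP) in
        subst (_∈ List.map g (allNVecs r)) (sym e) (∈-map⁺ g (allNVecs-complete R))
      image⊆ : ∀ {P} → P ∈ List.map g (allNVecs r) → P ∈ filter (λ P → b P Bool.≟ true) (allNVecs N)
      image⊆ {P} P∈ = let R , _ , e = ∈-map⁻ g P∈ ; c , _ , e' = g-spec R in
        ∈-filter⁺ (λ P → b P Bool.≟ true) (allNVecs-complete P) (Equivalence.from (spec P) (c ⊙ toVec R , trans (cong toVec e) e'))

  -- Otherwise vectors tᵢ with ρ j tᵢ ≡ 0# exactly for j ≢ i, together with p and r, would be m + 2 independent
  -- vectors in a span of m + 1 vectors.
  redundant : ∀ {m N} (vs : Vec (Vec Carrier N) (suc m)) {ρ : Fin m → Vec Carrier N → Carrier} → (∀ i → Linear (ρ i)) →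
              ∀ {p r} → InSpan vs p → InSpan vs r → (∀ i → ρ i p ≡ 0#) → (∀ i → ρ i r ≡ 0#) →
              (∀ a b → a ⊙ p ⊕ b ⊙ r ≡ 𝟎 → a ≡ 0# × b ≡ 0#) →
              ∃[ i ] (∀ {w} → InSpan vs w → (∀ j → i ≢ j → ρ j w ≡ 0#) → ρ i w ≡ 0#)
  redundant {m} {N} vs {ρ} lin {p} {r} (p′ , ep) (r′ , er) zp zr p,r-independent = search (Finₚ.any? (λ i → ¬? (witness? i)))
    where
    Isolates : Fin m → Vec Carrier (suc m) → Set
    Isolates i cs = (∀ j → i ≢ j → ρ j (lincomb cs vs) ≡ 0#) × ρ i (lincomb cs vs) ≢ 0#
    isolates? : ∀ i cs → Dec (Isolates i cs)
    isolates? i cs = Finₚ.all? (λ j → ¬? (i Fin.≟ j) →-dec (ρ j (lincomb cs vs) ≟ 0#)) ×-dec ¬? (ρ i (lincomb cs vs) ≟ 0#)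
    witness? : ∀ i → Dec (∃[ cs ] Isolates i cs)
    witness? i = anyVec? (isolates? i)
    isolate : ∀ {φ : Vec Carrier N → Carrier} → Linear φ → ∀ {k} (es : Vec Carrier k) (t : Fin k → Vec Carrier N) i →
              (∀ j → i ≢ j → φ (t j) ≡ 0#) → φ (lincomb es (Vec.tabulate t)) ≡ lookup es i * φ (t i)
    isolate {φ} l (e ∷ es) t Fin.zero z = trans (at-combination l e _ _) (trans (cong (e * φ (t Fin.zero) +_)
      (vanish l es _ (λ j → trans (cong φ (Vecₚ.lookup∘tabulate (t ∘ Fin.suc) j)) (z (Fin.suc j) (λ ()))))) (+-identityʳ _))
    isolate {φ} l (e ∷ es) t (Fin.suc i) z = trans (at-combination l e _ _) (trans (cong₂ (λ x y → e * x + y)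
      (z Fin.zero (λ ())) (isolate l es (t ∘ Fin.suc) i (λ j ne → z (Fin.suc j) (ne ∘ Finₚ.suc-injective)))) (trans (cong (_+ lookup es i * φ (t (Fin.suc i))) (zeroʳ e)) (+-identityˡ _)))
    impossible : ¬ (∀ i → ∃[ cs ] Isolates i cs)
    impossible have = contradict (underdetermined (suc m) (λ l → Linear-lincomb rows l))
      where
      t : Fin m → Vec Carrier (suc m)
      t i = proj₁ (have i)
      rows : Vec (Vec Carrier (suc m)) (suc (suc m))
      rows = p′ ∷ r′ ∷ Vec.tabulate t
      contradict : ¬ (∃[ w ] (w ≢ 𝟎 × ∀ l → lookup (lincomb w rows) l ≡ 0#))
      contradict (a ∷ b ∷ es , w≢𝟎 , z) = w≢𝟎 (cong₂ _∷_ (proj₁ ab≡0) (cong₂ _∷_ (proj₂ ab≡0) es≡𝟎))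
        where
        T : Fin m → Vec Carrier N
        T i = lincomb (t i) vs
        relation : a ⊙ p ⊕ (b ⊙ r ⊕ lincomb es (Vec.tabulate T)) ≡ 𝟎
        relation = begin
          a ⊙ p ⊕ (b ⊙ r ⊕ lincomb es (Vec.tabulate T))
            ≡⟨ cong₂ (λ x y → a ⊙ x ⊕ y) ep (cong₂ (λ x y → b ⊙ x ⊕ lincomb es y) er (Vecₚ.tabulate-∘ (λ c → lincomb c vs) t)) ⟩
          lincomb (a ∷ b ∷ es) (Vec.map (λ c → lincomb c vs) rows)
            ≡⟨ lincomb-lincomb (a ∷ b ∷ es) rows vs ⟩
          lincomb (lincomb (a ∷ b ∷ es) rows) vs
            ≡⟨ cong (λ c → lincomb c vs) (lookup≡0⇒≡𝟎 (lincomb (a ∷ b ∷ es) rows) z) ⟩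
          lincomb 𝟎 vs
            ≡⟨ lincomb-𝟎 vs ⟩
          𝟎 ∎
          where open ≡-Reasoning
        -- `ρ i` vanishes at `p`, at `r` and at every isolating vector but the i-th, so applied to
        -- the relation it isolates the i-th coefficient. Then only a relation between `p` and `r`
        -- is left.
        es≡𝟎 : es ≡ 𝟎
        es≡𝟎 = lookup≡0⇒≡𝟎 es (λ i → x*y≡0⇒y≡0 (proj₂ (proj₂ (have i))) (begin
          ρ i (T i) * lookup es i ≡⟨ *-comm _ _ ⟩
          lookup es i * ρ i (T i) ≡⟨ isolate (lin i) es T i (λ j ne → proj₁ (proj₂ (have j)) i (ne ∘ sym)) ⟨
          ρ i (lincomb es (Vec.tabulate T)) ≡⟨ +-identityˡ _ ⟨
          0# + ρ i (lincomb es (Vec.tabulate T)) ≡⟨ cong (_+ ρ i (lincomb es (Vec.tabulate T))) (trans (cong (b *_) (zr i)) (zeroʳ b)) ⟨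
          b * ρ i r + ρ i (lincomb es (Vec.tabulate T)) ≡⟨ at-combination (lin i) b r _ ⟨
          ρ i (b ⊙ r ⊕ lincomb es (Vec.tabulate T)) ≡⟨ +-identityˡ _ ⟨
          0# + ρ i (b ⊙ r ⊕ lincomb es (Vec.tabulate T)) ≡⟨ cong (_+ ρ i (b ⊙ r ⊕ lincomb es (Vec.tabulate T))) (trans (cong (a *_) (zp i)) (zeroʳ a)) ⟨
          a * ρ i p + ρ i (b ⊙ r ⊕ lincomb es (Vec.tabulate T)) ≡⟨ at-combination (lin i) a p _ ⟨
          ρ i (a ⊙ p ⊕ (b ⊙ r ⊕ lincomb es (Vec.tabulate T))) ≡⟨ cong (ρ i) relation ⟩
          ρ i 𝟎 ≡⟨ at-𝟎 (lin i) ⟩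
          0# ∎))
          where open ≡-Reasoning
        ab≡0 : a ≡ 0# × b ≡ 0#
        ab≡0 = p,r-independent a b (trans (cong (a ⊙ p ⊕_) (sym (trans (cong (λ e → b ⊙ r ⊕ e)
          (trans (cong (λ es → lincomb es (Vec.tabulate T)) es≡𝟎) (lincomb-𝟎 (Vec.tabulate T)))) (⊕-identityʳ _)))) relation)
    search : Dec (∃[ i ] ¬ (∃[ cs ] Isolates i cs)) → ∃[ i ] (∀ {w} → InSpan vs w → (∀ j → i ≢ j → ρ j w ≡ 0#) → ρ i w ≡ 0#)
    search (yes (i , none)) = i , λ { (cs , refl) off → decidable-stable (ρ i (lincomb cs vs) ≟ 0#) (λ ne → none (cs , off , ne)) }
    search (no none) = ⊥-elim (impossible (λ i → decidable-stable (witness? i) (λ no-w → none (i , no-w))))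

-- For an undecided predicate a least witness exists only up to double negation. It is applied to
-- `HasRelation`, which quantifies over infinite sequences.
¬¬-least : ∀ (P : ℕ → Set) n → P n → ¬ ¬ (∃[ r ] (P r × ∀ s → s ℕ.< r → ¬ P s))
¬¬-least P n Pn none = below (suc n) n ℕₚ.≤-refl Pn
  where
  below : ∀ k r → r ℕ.< k → ¬ P r
  below (suc k) r (s≤s r≤k) Pr = none (r , Pr , λ s s<r → below k s (ℕₚ.<-≤-trans s<r r≤k))

-- The degree of a finite field generated by one element.

module DegreeOfExtension (F : FiniteField) {p h : ℕ} (pr : Prime p) (q≡p^h : FiniteField.order F ≡ p ℕ.^ h) (K : FiniteField) where
  private module F = LinearAlgebra F
  open FiniteFieldProps K
  open Solver

  private
    q = F.order

  module _ (ι : F.Carrier → Carrier) where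
    polyᴷ : ∀ {l} → Vec F.Carrier l → Carrier → Carrier
    polyᴷ [] y = 0#
    polyᴷ (a ∷ v) y = ι a + y * polyᴷ v y

    private
      -- After `v` the sequence repeats `top` forever, but evaluation with bound `suc l` reads just
      -- one copy, the leading coefficient.
      coeffs : ∀ {l} → Vec F.Carrier l → Carrier → ℕ → Carrier
      coeffs [] top j = top
      coeffs (a ∷ v) top zero = ι a
      coeffs (a ∷ v) top (suc j) = coeffs v top j

      coeffs-top : ∀ {l} (v : Vec F.Carrier l) top → coeffs v top l ≡ top
      coeffs-top [] top = refl
      coeffs-top (a ∷ v) top = coeffs-top v top

      eval-coeffs : ∀ {l} (v : Vec F.Carrier l) top y → eval (suc l) (coeffs v top) y ≡ polyᴷ v y + top * y ^ l
      eval-coeffs [] top y = trans (cong (top +_) (zeroʳ y)) (trans (+-identityʳ _) (sym (trans (+-identityˡ _) (*-identityʳ _))))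
      eval-coeffs {suc l} (a ∷ v) top y = trans (cong (λ z → ι a + y * z) (eval-coeffs v top y))
        (solve 5 (λ a y P t z → a :+ y :* (P :+ t :* z) := (a :+ y :* P) :+ t :* (y :* z)) refl (ι a) y (polyᴷ v y) top (y ^ l))

      too-many-roots : ∀ {l} (v : Vec F.Carrier l) {top} → top ≢ 0# → (rs : List Carrier) → Unique rs → suc l ℕ.≤ length rs →
                       ¬ (∀ {y} → y ∈ rs → polyᴷ v y + top * y ^ l ≡ 0#)
      too-many-roots {l} v {top} top≢0 rs u len z = top≢0 (trans (sym (coeffs-top v top))
        (roots⇒coeff≡0 (suc l) (coeffs v top) rs u len (λ {y} y∈ → trans (eval-coeffs v top y) (z y∈)) l ℕₚ.≤-refl))

    module _ (ι-0 : ι F.0# ≡ 0#) (ι-1 : ι F.1# ≡ 1#) (ι-* : ∀ a b → ι (a F.* b) ≡ ι a * ι b)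
             {r} (order-K : order ≡ q ℕ.^ r) (x : Carrier)
             (generates : ∀ y → ∃[ v ] (y ≡ polyᴷ {r} v x)) (c : Vec F.Carrier r) (relation : polyᴷ c x ≡ x ^ r)
             {m} (x^Q≡x : x ^ (q ℕ.^ m) ≡ x) (x^q^d≢x : ∀ {d} → 1 ℕ.≤ d → d ℕ.< m → x ^ (q ℕ.^ d) ≢ x) where
      private
        open Characteristic {h = h ℕ.* r} pr (trans order-K (trans (cong (ℕ._^ r) q≡p^h) (ℕₚ.^-*-assoc p h r)))

        frob : ∀ i a b → (a + b) ^ (q ℕ.^ i) ≡ a ^ (q ℕ.^ i) + b ^ (q ℕ.^ i)
        frob i a b = subst (λ e → (a + b) ^ e ≡ a ^ e + b ^ e) (sym (trans (cong (ℕ._^ i) q≡p^h) (ℕₚ.^-*-assoc p h i)))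
          (frobenius^′ pr p≡0 (h ℕ.* i) a b (*-comm a b))

        ι-^ : ∀ a n → ι (a F.^ n) ≡ ι a ^ n
        ι-^ a zero = ι-1
        ι-^ a (suc n) = trans (ι-* a _) (cong (ι a *_) (ι-^ a n))

        F-fixed : ∀ i a → a F.^ (q ℕ.^ i) ≡ a
        F-fixed zero a = F.*-identityʳ a
        F-fixed (suc i) a = trans (sym (F.^-assocʳ a q (q ℕ.^ i))) (trans (cong (F._^ (q ℕ.^ i)) (F.fermat a)) (F-fixed i a))

        ι-fixed : ∀ i a → ι a ^ (q ℕ.^ i) ≡ ι a
        ι-fixed i a = trans (sym (ι-^ a (q ℕ.^ i))) (cong ι (F-fixed i a))

        0^q^i : ∀ i → 0# ^ (q ℕ.^ i) ≡ 0#
        0^q^i i = trans (cong (_^ (q ℕ.^ i)) (sym ι-0)) (trans (ι-fixed i _) ι-0)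

        polyᴷ-frob : ∀ {l} i (v : Vec F.Carrier l) y → polyᴷ v y ^ (q ℕ.^ i) ≡ polyᴷ v (y ^ (q ℕ.^ i))
        polyᴷ-frob i [] y = 0^q^i i
        polyᴷ-frob i (a ∷ v) y = trans (frob i _ _) (cong₂ _+_ (ι-fixed i a)
          (trans (^-distrib-* y _ (q ℕ.^ i)) (cong (y ^ (q ℕ.^ i) *_) (polyᴷ-frob i v y))))

        frob-injective : ∀ i {a b} → a ^ (q ℕ.^ i) ≡ b ^ (q ℕ.^ i) → a ≡ b
        frob-injective i {a} {b} e with (a + - b) ≟ 0#
        ... | yes z = x-y≡0⇒x≡y z
        ... | no nz = ⊥-elim (^-nonzero (q ℕ.^ i) nz (+-cancelʳ (b ^ (q ℕ.^ i)) _ _ (trans (sym (frob i (a + - b) b))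
                (trans (cong (_^ (q ℕ.^ i)) (solve 2 (λ a b → (a :- b) :+ b := a) refl a b)) (trans e (sym (+-identityˡ _)))))))

        1≤q : 1 ℕ.≤ q
        1≤q = ℕₚ.<⇒≤ F.2≤order

        conjugate : ℕ → Carrier
        conjugate i = x ^ (q ℕ.^ i)

        -- Powers with exponent q^i can be cancelled, so equal conjugates would give x^(q^(j-i)) =
        -- x.
        distinct : ∀ {i j} → i ℕ.< j → j ℕ.< m → conjugate i ≢ conjugate j
        distinct {i} {j} i<j j<m e = x^q^d≢x (ℕₚ.m<n⇒0<n∸m i<j) (ℕₚ.≤-<-trans (ℕₚ.m∸n≤m j i) j<m)
          (sym (frob-injective i (trans e (trans (cong (x ^_) (trans (cong (q ℕ.^_) (sym (ℕₚ.m∸n+n≡m (ℕₚ.<⇒≤ i<j)))) (ℕₚ.^-distribˡ-+-* q (j ℕ.∸ i) i)))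
            (sym (^-assocʳ x (q ℕ.^ (j ℕ.∸ i)) (q ℕ.^ i)))))))

        -1≢0 : - 1# ≢ 0#
        -1≢0 e = 0≢1 (trans (sym -0≡0) (trans (cong -_ (sym e)) (-‿involutive 1#)))

        -- The relation has coefficients from GF(q), which are fixed by q-th powers, so all `m`
        -- distinct conjugates of `x` are roots of a polynomial of degree `r`.
        m≤r : m ℕ.≤ r
        m≤r = ℕₚ.≮⇒≥ λ r<m → too-many-roots c -1≢0 (List.applyUpTo conjugate m) (applyUpTo⁺₁ conjugate m distinct)
          (ℕₚ.≤-trans r<m (ℕₚ.≤-reflexive (sym (Listₚ.length-applyUpTo conjugate m))))
          λ y∈ → let i , _ , e = ∈-applyUpTo⁻ conjugate y∈ in subst (λ y → polyᴷ c y + - 1# * y ^ r ≡ 0#) (sym e) (root i)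
          where
          root : ∀ i → polyᴷ c (conjugate i) + - 1# * conjugate i ^ r ≡ 0#
          root i = begin
            polyᴷ c (conjugate i) + - 1# * conjugate i ^ r ≡⟨ cong₂ _+_ (sym (polyᴷ-frob i c x)) (-1*x≈-x _) ⟩
            polyᴷ c x ^ (q ℕ.^ i) + - (conjugate i ^ r) ≡⟨ cong₂ (λ a b → a ^ (q ℕ.^ i) + - b) relation
                (trans (^-assocʳ x (q ℕ.^ i) r) (trans (cong (x ^_) (ℕₚ.*-comm (q ℕ.^ i) r)) (sym (^-assocʳ x r (q ℕ.^ i))))) ⟩
            (x ^ r) ^ (q ℕ.^ i) + - ((x ^ r) ^ (q ℕ.^ i)) ≡⟨ -‿inverseʳ _ ⟩
            0# ∎
            where open ≡-Reasoning

        all-fixed : ∀ y → y ^ (q ℕ.^ m) ≡ y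
        all-fixed y with generates y
        ... | v , refl = trans (polyᴷ-frob m v x) (cong (polyᴷ v) x^Q≡x)

        -- Every element is a polynomial in `x` over GF(q) and hence fixed by the power q^m. If m <
        -- r, then X^(q^m) - X would have q^r roots, more than its degree.
        r≤m : 1 ℕ.≤ m → r ℕ.≤ m
        r≤m 1≤m = ℕₚ.≮⇒≥ λ m<r → go (q ℕ.^ m) refl (ℕₚ.≤-trans F.2≤order (ℕₚ.≤-trans (ℕₚ.≤-reflexive (sym (ℕₚ.^-identityʳ q))) (ℕₚ.^-monoʳ-≤ q {{ℕ.>-nonZero 1≤q}} 1≤m)))
                                       (ℕₚ.≤-trans (ℕₚ.^-monoʳ-< q F.2≤order m<r) (ℕₚ.≤-reflexive (sym order-K)))
          where
          polyᴷ-𝟎 : ∀ l y → polyᴷ (replicate l F.0#) y ≡ 0#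
          polyᴷ-𝟎 zero y = refl
          polyᴷ-𝟎 (suc l) y = trans (cong₂ (λ a b → a + y * b) ι-0 (polyᴷ-𝟎 l y)) (trans (+-identityˡ _) (zeroʳ y))
          go : ∀ Q → q ℕ.^ m ≡ Q → 2 ℕ.≤ Q → ¬ (suc Q ℕ.≤ order)
          go (suc zero) e (s≤s ())
          -- Here q^m is `suc (suc Q)`, and the vector with top -1 encodes X - X^(q^m). Knowing q^m
          -- ≥ 2 keeps the two exponents apart.
          go (suc (suc Q)) e _ len = too-many-roots (F.0# ∷ F.1# ∷ replicate Q F.0#) -1≢0 elements unique len
            λ {y} _ → begin
              (ι F.0# + y * (ι F.1# + y * polyᴷ (replicate Q F.0#) y)) + - 1# * y ^ suc (suc Q)
                ≡⟨ cong₂ (λ a b → a + - 1# * b) (trans (cong₂ _+_ ι-0 (cong (y *_) (cong₂ (λ a b → a + y * b) ι-1 (polyᴷ-𝟎 Q y)))) refl)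
                     (trans (cong (y ^_) (sym e)) (all-fixed y)) ⟩
              (0# + y * (1# + y * 0#)) + - 1# * y
                ≡⟨ cong₂ _+_ (trans (+-identityˡ _) (trans (cong (y *_) (trans (cong (1# +_) (zeroʳ y)) (+-identityʳ 1#))) (*-identityʳ y)))
                     (-1*x≈-x y) ⟩
              y + - y
                ≡⟨ -‿inverseʳ y ⟩
              0# ∎
            where open ≡-Reasoning

      degree : 1 ℕ.≤ m → r ≡ m
      degree 1≤m = ℕₚ.≤-antisym (r≤m 1≤m) m≤r

-- The embedding `scalar` is described only through its action on coordinates; its additivity and
-- its values at 0 and 1 follow because `to` is a bijection.
record Extension (F : FiniteField) (m : ℕ) : Set₁ where
  open LinearAlgebra F using (_⊕_; _⊙_)
  private module F = FiniteField F
  field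
    K : FiniteField
  private module K = FiniteField K
  field
    to : K.Carrier → Vec F.Carrier m
    from : Vec F.Carrier m → K.Carrier
    to-from : ∀ v → to (from v) ≡ v
    from-to : ∀ a → from (to a) ≡ a
    order-K : K.order ≡ F.order ℕ.^ m
    to-+ : ∀ a b → to (a K.+ b) ≡ to a ⊕ to b
    scalar : F.Carrier → K.Carrier
    to-scalar-* : ∀ c a → to (scalar c K.* a) ≡ c ⊙ to a

-- Construction of GF(q^m) from periodic sequences.

module ShiftModule (F : FiniteField) where
  open LinearAlgebra F public
  open Solver

  Seq : Set
  Seq = ℕ → Carrier

  -- The polynomial with coefficient vector v acting on sequences, the variable acting as the shift.
  act : ∀ {l} → Vec Carrier l → Seq → Seq
  act [] s i = 0#
  act (a ∷ v) s i = a * s i + act v s (suc i)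

  act-cong : ∀ {l} (v : Vec Carrier l) {s t : Seq} → (∀ i → s i ≡ t i) → ∀ i → act v s i ≡ act v t i
  act-cong [] e i = refl
  act-cong (a ∷ v) e i = cong₂ (λ x y → a * x + y) (e i) (act-cong v e (suc i))

  act-shift : ∀ {l} n (v : Vec Carrier l) s i → act v (λ j → s (j ℕ.+ n)) i ≡ act v s (i ℕ.+ n)
  act-shift n [] s i = refl
  act-shift n (a ∷ v) s i = cong (a * s (i ℕ.+ n) +_) (act-shift n v s (suc i))

  act-suc : ∀ {l} (v : Vec Carrier l) s i → act v (λ j → s (suc j)) i ≡ act v s (suc i)
  act-suc [] s i = refl
  act-suc (a ∷ v) s i = cong (a * s (suc i) +_) (act-suc v s (suc i))

  act-comb : ∀ {l} (v : Vec Carrier l) c s t i → act v (λ j → c * s j + t j) i ≡ c * act v s i + act v t i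
  act-comb [] c s t i = sym (trans (+-identityʳ _) (zeroʳ c))
  act-comb (a ∷ v) c s t i = trans (cong (a * (c * s i + t i) +_) (act-comb v c s t (suc i)))
    (solve 6 (λ a c s t x y → a :* (c :* s :+ t) :+ (c :* x :+ y) := c :* (a :* s :+ x) :+ (a :* t :+ y)) refl a c (s i) (t i) _ _)

  act-0 : ∀ {l} (v : Vec Carrier l) i → act v (λ _ → 0#) i ≡ 0#
  act-0 [] i = refl
  act-0 (a ∷ v) i = trans (cong (a * 0# +_) (act-0 v (suc i))) (trans (+-identityʳ _) (zeroʳ a))

  act-⊙⊕ : ∀ {l} c (u v : Vec Carrier l) s i → act (c ⊙ u ⊕ v) s i ≡ c * act u s i + act v s i
  act-⊙⊕ c [] [] s i = sym (trans (+-identityʳ _) (zeroʳ c))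
  act-⊙⊕ c (a ∷ u) (b ∷ v) s i = trans (cong ((c * a + b) * s i +_) (act-⊙⊕ c u v s (suc i)))
    (solve 6 (λ c a b s x y → (c :* a :+ b) :* s :+ (c :* x :+ y) := c :* (a :* s :+ x) :+ (b :* s :+ y)) refl c a b (s i) _ _)

  act-⊕ : ∀ {l} (u v : Vec Carrier l) s i → act (u ⊕ v) s i ≡ act u s i + act v s i
  act-⊕ u v s i = trans (cong (λ u → act (u ⊕ v) s i) (sym (⊙-identity u))) (trans (act-⊙⊕ 1# u v s i) (cong (_+ act v s i) (*-identityˡ _)))

  act-𝟎 : ∀ l s i → act (𝟎 {l}) s i ≡ 0#
  act-𝟎 zero s i = refl
  act-𝟎 (suc l) s i = trans (cong₂ _+_ (zeroˡ _) (act-𝟎 l s (suc i))) (+-identityˡ 0#)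

  act-⊙ : ∀ {l} c (u : Vec Carrier l) s i → act (c ⊙ u) s i ≡ c * act u s i
  act-⊙ {l} c u s i = trans (cong (λ u → act u s i) (sym (⊕-identityʳ (c ⊙ u)))) (trans (act-⊙⊕ c u 𝟎 s i)
    (trans (cong (c * act u s i +_) (act-𝟎 l s i)) (+-identityʳ _)))

  act-comm : ∀ {k l} (u : Vec Carrier k) (v : Vec Carrier l) s i → act u (act v s) i ≡ act v (act u s) i
  act-comm [] v s i = sym (act-0 v i)
  act-comm (a ∷ u) v s i = trans (cong (a * act v s i +_) (act-comm u v s (suc i)))
    (sym (trans (act-comb v a s (λ j → act u s (suc j)) i) (cong (a * act v s i +_) (act-suc v (act u s) i))))

  act-∷ʳ : ∀ {l} (v : Vec Carrier l) a s i → act (v ∷ʳ a) s i ≡ act v s i + a * s (i ℕ.+ l)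
  act-∷ʳ [] a s i = trans (+-comm _ _) (cong (λ j → 0# + a * s j) (sym (ℕₚ.+-identityʳ i)))
  act-∷ʳ {suc l} (b ∷ v) a s i = trans (cong (b * s i +_) (act-∷ʳ v a s (suc i)))
    (trans (sym (+-assoc _ _ _)) (cong (λ j → b * s i + act v s (suc i) + a * s j) (sym (ℕₚ.+-suc i l))))

  module _ {p h : ℕ} (pr : Prime p) (q≡p^h : order ≡ p ℕ.^ h) (m : ℕ) (1≤m : 1 ℕ.≤ m) where

    private
      Q = order ℕ.^ m
      period = Q ℕ.∸ 1

      2≤Q : 2 ℕ.≤ Q
      2≤Q = ℕₚ.≤-trans 2≤order (ℕₚ.≤-trans (ℕₚ.≤-reflexive (sym (ℕₚ.^-identityʳ order)))
              (ℕₚ.^-monoʳ-≤ order {{ℕ.>-nonZero (ℕₚ.<⇒≤ 2≤order)}} 1≤m))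

      1+period≡Q : suc period ≡ Q
      1+period≡Q = ℕₚ.m+[n∸m]≡n {1} (ℕₚ.<⇒≤ 2≤Q)

    Periodic : Seq → Set
    Periodic s = ∀ i → s (i ℕ.+ period) ≡ s i

    -- The action of X^(q^d) - X.
    Δ : ℕ → Seq → Seq
    Δ d s i = s (i ℕ.+ order ℕ.^ d) + - s (suc i)

    private
      Δ-comb : ∀ d s i → Δ d s i ≡ (- 1#) * s (suc i) + s (i ℕ.+ order ℕ.^ d)
      Δ-comb d s i = trans (+-comm _ _) (cong (_+ s (i ℕ.+ order ℕ.^ d)) (trans (cong -_ (sym (*-identityˡ _))) (-‿distribˡ-* 1# _)))

      Δ-cong : ∀ d {s t : Seq} → (∀ i → s i ≡ t i) → ∀ i → Δ d s i ≡ Δ d t i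
      Δ-cong d e i = cong₂ (λ x y → x + - y) (e _) (e _)

      act-Δ : ∀ {l} (v : Vec Carrier l) d s i → act v (Δ d s) i ≡ Δ d (act v s) i
      act-Δ v d s i = begin
        act v (Δ d s) i ≡⟨ act-cong v (Δ-comb d s) i ⟩
        act v (λ j → (- 1#) * s (suc j) + s (j ℕ.+ order ℕ.^ d)) i ≡⟨ act-comb v (- 1#) _ _ i ⟩
        (- 1#) * act v (λ j → s (suc j)) i + act v (λ j → s (j ℕ.+ order ℕ.^ d)) i
                                                                           ≡⟨ cong₂ (λ x y → (- 1#) * x + y) (act-suc v s i) (act-shift _ v s i) ⟩
        (- 1#) * act v s (suc i) + act v s (i ℕ.+ order ℕ.^ d) ≡⟨ Δ-comb d (act v s) i ⟨
        Δ d (act v s) i ∎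
        where open ≡-Reasoning

      act-periodic : ∀ {l} (v : Vec Carrier l) {s} → Periodic s → Periodic (act v s)
      act-periodic v {s} per i = trans (sym (act-shift period v s i)) (act-cong v per i)

      Δ-periodic : ∀ d {s} → Periodic s → Periodic (Δ d s)
      Δ-periodic d {s} per i = cong₂ (λ x y → x + - y)
        (trans (cong s (trans (ℕₚ.+-assoc i period _) (trans (cong (i ℕ.+_) (ℕₚ.+-comm period _)) (sym (ℕₚ.+-assoc i _ period))))) (per _)) (per (suc i))

      Δ-comm : ∀ d e s i → Δ d (Δ e s) i ≡ Δ e (Δ d s) i
      Δ-comm d e s i = trans (cong₂ (λ x y → (s x + - s (suc (i ℕ.+ order ℕ.^ d))) + - (s y + - s (suc (suc i)))) swap refl)
        (solve 4 (λ a b c d → (a :- b) :- (c :- d) := (a :- c) :- (b :- d)) refl (s (i ℕ.+ order ℕ.^ e ℕ.+ order ℕ.^ d)) _ _ _)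
        where
        swap : i ℕ.+ order ℕ.^ d ℕ.+ order ℕ.^ e ≡ i ℕ.+ order ℕ.^ e ℕ.+ order ℕ.^ d
        swap = trans (ℕₚ.+-assoc i _ _) (trans (cong (i ℕ.+_) (ℕₚ.+-comm (order ℕ.^ d) (order ℕ.^ e))) (sym (ℕₚ.+-assoc i _ _)))

    -- Additive operators on sequences form a semiring, in which (Δ d)^Q = (shift by q^d)^Q − shift^Q.
    private
      record Operator : Set where
        field
          ap : Seq → Seq
          ap-cong : ∀ {s t : Seq} → (∀ i → s i ≡ t i) → ∀ i → ap s i ≡ ap t i
          ap-+ : ∀ s t i → ap (λ j → s j + t j) i ≡ ap s i + ap t i
          ap-0 : ∀ i → ap (λ _ → 0#) i ≡ 0#
      open Operator

      operators : Semiring _ _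
      operators = record
        { Carrier = Operator
        ; _≈_ = λ f g → ∀ s i → ap f s i ≡ ap g s i
        ; _+_ = λ f g → record
            { ap = λ s i → ap f s i + ap g s i
            ; ap-cong = λ e i → cong₂ _+_ (ap-cong f e i) (ap-cong g e i)
            ; ap-+ = λ s t i → trans (cong₂ _+_ (ap-+ f s t i) (ap-+ g s t i))
                (solve 4 (λ a b c d → (a :+ b) :+ (c :+ d) := (a :+ c) :+ (b :+ d)) refl (ap f s i) _ _ _)
            ; ap-0 = λ i → trans (cong₂ _+_ (ap-0 f i) (ap-0 g i)) (+-identityˡ 0#) }
        ; _*_ = λ f g → record
            { ap = λ s → ap f (ap g s)
            ; ap-cong = λ e → ap-cong f (ap-cong g e)
            ; ap-+ = λ s t i → trans (ap-cong f (ap-+ g s t) i) (ap-+ f _ _ i)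
            ; ap-0 = λ i → trans (ap-cong f (ap-0 g) i) (ap-0 f i) }
        ; 0# = record { ap = λ _ _ → 0# ; ap-cong = λ _ _ → refl ; ap-+ = λ _ _ _ → sym (+-identityˡ 0#) ; ap-0 = λ _ → refl }
        ; 1# = record { ap = λ s → s ; ap-cong = λ e → e ; ap-+ = λ _ _ _ → refl ; ap-0 = λ _ → refl }
        ; isSemiring = record
            { isSemiringWithoutAnnihilatingZero = record
                { +-isCommutativeMonoid = record
                    { isMonoid = record
                        { isSemigroup = record
                            { isMagma = record
                                { isEquivalence = record { refl = λ _ _ → refl ; sym = λ e s i → sym (e s i) ; trans = λ e f s i → trans (e s i) (f s i) }
                                ; ∙-cong = λ e f s i → cong₂ _+_ (e s i) (f s i) }
                            ; assoc = λ f g k s i → +-assoc _ _ _ }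
                        ; identity = (λ f s i → +-identityˡ _) , (λ f s i → +-identityʳ _) }
                    ; comm = λ f g s i → +-comm _ _ }
                ; *-cong = λ {f} {f'} {g} {g'} e e' s i → trans (ap-cong f (e' s) i) (e (ap g' s) i)
                ; *-assoc = λ f g k s i → refl
                ; *-identity = (λ f s i → refl) , (λ f s i → refl)
                ; distrib = (λ f g k s i → ap-+ f _ _ i) , (λ f g k s i → refl) }
            ; zero = (λ f s i → refl) , (λ f s i → ap-0 f i) } }

      module Op = Semiring operators
      open import Algebra.Properties.Semiring.Exp operators using () renaming (_^_ to _^ᵒ_; ^-homo-* to ^ᵒ-homo-*; ^-congˡ to ^ᵒ-congˡ)
      open import Algebra.Properties.Semiring.Mult operators using () renaming (_×_ to _·ᵒ_)

      shiftᵒ : ℕ → Operator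
      shiftᵒ n = record { ap = λ s i → s (i ℕ.+ n) ; ap-cong = λ e i → e _ ; ap-+ = λ _ _ _ → refl ; ap-0 = λ _ → refl }

      Δᵒ : ℕ → Operator
      Δᵒ d = record
        { ap = Δ d ; ap-cong = Δ-cong d
        ; ap-+ = λ s t i → solve 4 (λ a b c d → (a :+ b) :- (c :+ d) := (a :- c) :+ (b :- d)) refl (s _) (t _) (s _) (t _)
        ; ap-0 = λ _ → -‿inverseʳ 0# }

      shiftᵒ-^ : ∀ a n s i → ap (shiftᵒ a ^ᵒ n) s i ≡ s (i ℕ.+ n ℕ.* a)
      shiftᵒ-^ a zero s i = cong s (sym (ℕₚ.+-identityʳ i))
      shiftᵒ-^ a (suc n) s i = trans (shiftᵒ-^ a n s (i ℕ.+ a)) (cong s (ℕₚ.+-assoc i a (n ℕ.* a)))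

      ·ᵒ-ap : ∀ n s i → ap (n ·ᵒ Op.1#) s i ≡ ⟦ n ⟧ * s i
      ·ᵒ-ap zero s i = sym (zeroˡ _)
      ·ᵒ-ap (suc n) s i = trans (cong (s i +_) (·ᵒ-ap n s i)) (trans (cong (_+ ⟦ n ⟧ * s i) (sym (*-identityˡ (s i)))) (sym (distribʳ (s i) 1# ⟦ n ⟧)))

      open Characteristic {h = h} pr q≡p^h using (p≡0)

      -- Semisimplicity of the shift: on sequences of period Q - 1 the Q-th power of any shift acts
      -- as that shift, so by Frobenius `Δ d` equals its own Q-th power there. As Q ≥ 2, that power
      -- vanishes once the square does.
      Δ²≡0⇒Δ≡0 : ∀ d {t} → Periodic t → (∀ i → Δ d (Δ d t) i ≡ 0#) → ∀ i → Δ d t i ≡ 0#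
      Δ²≡0⇒Δ≡0 d {t} per z i = x≡y⇒x-y≡0 (begin
        t (i ℕ.+ order ℕ.^ d) ≡⟨ reduce (order ℕ.^ d) i ⟨
        t (i ℕ.+ Q ℕ.* order ℕ.^ d) ≡⟨ shiftᵒ-^ (order ℕ.^ d) Q t i ⟨
        ap (shiftᵒ (order ℕ.^ d) ^ᵒ Q) t i ≡⟨ sym (^ᵒ-congˡ Q {Δᵒ d Op.+ shiftᵒ 1} {shiftᵒ (order ℕ.^ d)} split t i) ⟩
        ap ((Δᵒ d Op.+ shiftᵒ 1) ^ᵒ Q) t i ≡⟨ frob t i ⟩
        ap (Δᵒ d ^ᵒ Q) t i + ap (shiftᵒ 1 ^ᵒ Q) t i ≡⟨ cong₂ _+_ (Δ^Q Q 2≤Q i) (shiftᵒ-^ 1 Q t i) ⟩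
        0# + t (i ℕ.+ Q ℕ.* 1) ≡⟨ trans (+-identityˡ _) (reduce 1 i) ⟩
        t (i ℕ.+ 1) ≡⟨ cong t (ℕₚ.+-comm i 1) ⟩
        t (suc i) ∎)
        where
        open ≡-Reasoning
        split : Op._≈_ (Δᵒ d Op.+ shiftᵒ 1) (shiftᵒ (order ℕ.^ d))
        split s i = trans (cong (λ j → (s (i ℕ.+ order ℕ.^ d) + - s (suc i)) + s j) (ℕₚ.+-comm i 1))
          (solve 2 (λ a b → (a :- b) :+ b := a) refl (s (i ℕ.+ order ℕ.^ d)) (s (suc i)))
        commute : Op._≈_ (Δᵒ d Op.* shiftᵒ 1) (shiftᵒ 1 Op.* Δᵒ d)
        commute s i = cong (λ j → s j + - s (suc i ℕ.+ 1)) (trans (ℕₚ.+-assoc i _ 1) (trans (cong (i ℕ.+_) (ℕₚ.+-comm _ 1)) (sym (ℕₚ.+-assoc i 1 _))))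
        frob : Op._≈_ ((Δᵒ d Op.+ shiftᵒ 1) ^ᵒ Q) ((Δᵒ d ^ᵒ Q) Op.+ (shiftᵒ 1 ^ᵒ Q))
        frob = subst (λ e → Op._≈_ ((Δᵒ d Op.+ shiftᵒ 1) ^ᵒ e) ((Δᵒ d ^ᵒ e) Op.+ (shiftᵒ 1 ^ᵒ e)))
          (sym (trans (cong (ℕ._^ m) q≡p^h) (ℕₚ.^-*-assoc p h m)))
          (Frobenius.frobenius^ operators pr (λ s i → trans (·ᵒ-ap p s i) (trans (cong (_* s i) p≡0) (zeroˡ _))) (h ℕ.* m) (Δᵒ d) (shiftᵒ 1) commute)
        -- Q·a is `a` plus `a` periods.
        reduce : ∀ a i → t (i ℕ.+ Q ℕ.* a) ≡ t (i ℕ.+ a)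
        reduce a i = trans (cong (λ Q → t (i ℕ.+ Q ℕ.* a)) (sym 1+period≡Q)) (trans (cong t (sym (ℕₚ.+-assoc i a _)))
          (trans (cong (λ z → t (i ℕ.+ a ℕ.+ z)) (ℕₚ.*-comm period a)) (multiples a (i ℕ.+ a))))
          where
          multiples : ∀ a i → t (i ℕ.+ a ℕ.* period) ≡ t i
          multiples zero i = cong t (ℕₚ.+-identityʳ i)
          multiples (suc a) i = trans (cong t (sym (ℕₚ.+-assoc i period _))) (trans (multiples a (i ℕ.+ period)) (per i))
        Δ^Q : ∀ n → 2 ℕ.≤ n → ∀ i → ap (Δᵒ d ^ᵒ n) t i ≡ 0#
        Δ^Q (suc zero) (s≤s ())
        Δ^Q (suc (suc n)) _ i = begin
          ap (Δᵒ d ^ᵒ suc (suc n)) t i ≡⟨ cong (λ n → ap (Δᵒ d ^ᵒ n) t i) (ℕₚ.+-comm 2 n) ⟩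
          ap (Δᵒ d ^ᵒ (n ℕ.+ 2)) t i ≡⟨ ^ᵒ-homo-* (Δᵒ d) n 2 t i ⟩
          ap (Δᵒ d ^ᵒ n) (Δ d (Δ d t)) i ≡⟨ ap-cong (Δᵒ d ^ᵒ n) z i ⟩
          ap (Δᵒ d ^ᵒ n) (λ _ → 0#) i ≡⟨ ap-0 (Δᵒ d ^ᵒ n) i ⟩
          0# ∎

      -- Divisibility of w by X^(q^d) − X makes that polynomial act injectively on the multiples of w, by Δ²≡0⇒Δ≡0.
      Suitable : Seq → Set
      Suitable w = Periodic w × (∀ {d} → 1 ℕ.≤ d → d ℕ.< m → ∃[ t ] (Periodic t × ∀ i → w i ≡ Δ d t i))

      suitable-act : ∀ {l} (v : Vec Carrier l) {w} → Suitable w → Suitable (act v w)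
      suitable-act v (per , div) = act-periodic v per , λ {d} 1≤d d<m → let t , per' , e = div 1≤d d<m in
        act v t , act-periodic v per' , λ i → trans (act-cong v e i) (act-Δ v d t i)

      suitable-Δ : ∀ {w d} → Suitable w → 1 ℕ.≤ d → d ℕ.< m → (∀ i → Δ d w i ≡ 0#) → ∀ i → w i ≡ 0#
      suitable-Δ {w} {d} (_ , div) 1≤d d<m z = let t , per , e = div 1≤d d<m in
        λ i → trans (e i) (Δ²≡0⇒Δ≡0 d per (λ j → trans (Δ-cong d (λ i → sym (e i)) j) (z j)) i)

      -- The degree of the product of the polynomials X^(q^d) − X for 1 ≤ d ≤ n.
      exponentSum : ℕ → ℕ
      exponentSum zero = 0
      exponentSum (suc n) = order ℕ.^ suc n ℕ.+ exponentSum n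

      -- Ensures that the degree q + ... + q^(m-1) is below the period q^m - 1, so that one period
      -- has room for a sequence whose first nonzero entry stands at that index.
      exponentSum< : ∀ n → 2 ℕ.+ exponentSum n ℕ.≤ order ℕ.^ suc n
      exponentSum< zero = ℕₚ.≤-trans 2≤order (ℕₚ.≤-reflexive (sym (ℕₚ.^-identityʳ order)))
      exponentSum< (suc n) = ℕₚ.≤-trans (ℕₚ.≤-reflexive (trans (sym (ℕₚ.+-assoc 2 (order ℕ.^ suc n) _))
          (trans (cong (ℕ._+ exponentSum n) (ℕₚ.+-comm 2 (order ℕ.^ suc n))) (ℕₚ.+-assoc (order ℕ.^ suc n) 2 _))))
        (ℕₚ.≤-trans (ℕₚ.+-monoʳ-≤ (order ℕ.^ suc n) (exponentSum< n))
          (ℕₚ.≤-trans (ℕₚ.≤-reflexive (cong (order ℕ.^ suc n ℕ.+_) (sym (ℕₚ.+-identityʳ _)))) (ℕₚ.*-monoˡ-≤ (order ℕ.^ suc n) 2≤order)))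

      products : ℕ → Seq → Seq
      products zero s = s
      products (suc n) s = products n (Δ (suc n) s)

      products-periodic : ∀ n {s} → Periodic s → Periodic (products n s)
      products-periodic zero per = per
      products-periodic (suc n) per = products-periodic n (Δ-periodic (suc n) per)

      products-cong : ∀ n {s t : Seq} → (∀ i → s i ≡ t i) → ∀ i → products n s i ≡ products n t i
      products-cong zero e = e
      products-cong (suc n) e = products-cong n (Δ-cong (suc n) e)

      products-Δ : ∀ n d s i → products n (Δ d s) i ≡ Δ d (products n s) i
      products-Δ zero d s i = refl
      products-Δ (suc n) d s i = trans (products-cong n (Δ-comm (suc n) d s) i) (products-Δ n d (Δ (suc n) s) i)

      products-div : ∀ n {s} → Periodic s → ∀ {d} → 1 ℕ.≤ d → d ℕ.≤ n → ∃[ t ] (Periodic t × ∀ i → products n s i ≡ Δ d t i)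
      products-div zero per (s≤s _) ()
      products-div (suc n) {s} per {d} 1≤d d≤n with ℕₚ.m≤n⇒m<n∨m≡n d≤n
      ... | inj₁ (s≤s d≤n') = products-div n (Δ-periodic (suc n) per) 1≤d d≤n'
      ... | inj₂ refl = products n s , products-periodic n per , products-Δ n (suc n) s

      LeadsAt : ℕ → Seq → Set
      LeadsAt D s = (∀ j → j ℕ.< D → s j ≡ 0#) × s D ≡ 1#

      -- Each factor moves the first nonzero entry forward by q^d: the entry read by the term -X
      -- comes strictly before it because q^d ≥ 2. After all factors the entry 1 arrives at index 0,
      -- which proves `w₀` nonzero.
      products-lead : ∀ n {s} → LeadsAt (exponentSum n) s → products n s 0 ≡ 1#
      products-lead zero (_ , e) = e
      products-lead (suc n) {s} (z , e) = products-lead n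
        ( (λ j j<D → trans (cong₂ (λ x y → x + - y) (z _ (subst (ℕ._< D′) (ℕₚ.+-comm N j) (ℕₚ.+-monoʳ-< N j<D))) (z _ (1+j< (ℕₚ.<⇒≤ j<D)))) (-‿inverseʳ 0#))
        , trans (cong₂ (λ x y → x + - y) (trans (cong s (ℕₚ.+-comm (exponentSum n) N)) e) (z _ (1+j< ℕₚ.≤-refl))) (trans (cong (1# +_) -0≡0) (+-identityʳ 1#)) )
        where
        N = order ℕ.^ suc n
        D′ = N ℕ.+ exponentSum n
        1+j< : ∀ {j} → j ℕ.≤ exponentSum n → suc j ℕ.< D′
        1+j< {j} j≤ = ℕₚ.+-mono-≤ {2} {N} (ℕₚ.≤-trans (ℕₚ.m≤m+n 2 (exponentSum n)) (exponentSum< n)) j≤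

      m′ = m ℕ.∸ 1
      1+m′≡m : suc m′ ≡ m
      1+m′≡m = ℕₚ.m+[n∸m]≡n 1≤m

      instance
        period-nonZero : ℕ.NonZero period
        period-nonZero = ℕ.>-nonZero (ℕₚ.≤-pred (ℕₚ.≤-trans 2≤Q (ℕₚ.≤-reflexive (sym 1+period≡Q))))

      indicator₀ : Seq
      indicator₀ j with j ℕ.≟ exponentSum m′
      ... | yes _ = 1#
      ... | no _ = 0#

      indicator : Seq
      indicator i = indicator₀ (i DivMod.% period)

      exponentSum<period : exponentSum m′ ℕ.< period
      exponentSum<period = ℕₚ.≤-pred (ℕₚ.≤-trans (subst (λ m → 2 ℕ.+ exponentSum m′ ℕ.≤ order ℕ.^ m) 1+m′≡m (exponentSum< m′))
                             (ℕₚ.≤-reflexive (sym 1+period≡Q)))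

      indicator-periodic : Periodic indicator
      indicator-periodic i = cong indicator₀ (DivMod.[m+n]%n≡m%n i period)

      indicator-leads : LeadsAt (exponentSum m′) indicator
      indicator-leads = below , at
        where
        below : ∀ j → j ℕ.< exponentSum m′ → indicator j ≡ 0#
        below j j<D rewrite DivMod.m<n⇒m%n≡m (ℕₚ.<-trans j<D exponentSum<period) with j ℕ.≟ exponentSum m′
        ... | yes e = ⊥-elim (ℕₚ.<⇒≢ j<D e)
        ... | no _ = refl
        at : indicator (exponentSum m′) ≡ 1#
        at rewrite DivMod.m<n⇒m%n≡m exponentSum<period with exponentSum m′ ℕ.≟ exponentSum m′
        ... | yes _ = refl
        ... | no ne = ⊥-elim (ne refl)

      w₀ : Seq
      w₀ = products m′ indicator

      w₀-suitable : Suitable w₀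
      w₀-suitable = products-periodic m′ indicator-periodic , λ 1≤d d<m →
        products-div m′ indicator-periodic 1≤d (ℕₚ.≤-pred (ℕₚ.≤-trans d<m (ℕₚ.≤-reflexive (sym 1+m′≡m))))

      -- Some nonzero suitable sequence is annihilated by a monic polynomial of degree `r`. The
      -- sequence is not fixed, so a least `r` is least over all suitable sequences at once.
      HasRelation : ℕ → Set
      HasRelation r = ∃[ w ] (Suitable w × ¬ (∀ i → w i ≡ 0#) × ∃[ c ] (∀ i → w (i ℕ.+ r) ≡ act {r} c w i))

      w₀-relation : HasRelation period
      w₀-relation = w₀ , w₀-suitable , (λ z → 0≢1 (trans (sym (z 0)) (products-lead m′ indicator-leads))) , unit period ℕₚ.≤-refl , λ i →
          trans (proj₁ w₀-suitable i) (sym (act-unit period ℕₚ.≤-refl i))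
        where
        -- The constant polynomial 1 as a coefficient vector, which turns periodicity into a
        -- relation; the empty vector is a placeholder, as the period is nonzero.
        unit : ∀ l → l ℕ.≤ period → Vec Carrier l
        unit zero _ = []
        unit (suc l) _ = 1# ∷ 𝟎
        act-unit : ∀ l (le : l ℕ.≤ period) → .{{ℕ.NonZero l}} → ∀ i → act (unit l le) w₀ i ≡ w₀ i
        act-unit (suc l) _ i = trans (cong₂ _+_ (*-identityˡ _) (act-𝟎 l w₀ (suc i))) (+-identityʳ _)

      -- Minimality makes the module F[X]·w simple, hence a field.
      module FromMinimalRelation (r′ : ℕ) (minimal : ∀ s → s ℕ.< suc r′ → ¬ HasRelation s)
               (w : Seq) (suitable : Suitable w) (w≢0 : ¬ (∀ i → w i ≡ 0#))
               (c : Vec Carrier (suc r′)) (relation : ∀ i → w (i ℕ.+ suc r′) ≡ act c w i) where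
        r = suc r′

        -- Zero leading coefficients are stripped; a nonzero one is divided out and yields a monic
        -- relation of smaller order, against minimality. Minimality holds for every suitable
        -- sequence, so `s` need not be `w`.
        no-short-relation : ∀ l → l ℕ.≤ r → ∀ {s} → Suitable s → ¬ (∀ i → s i ≡ 0#) → (v : Vec Carrier l) → (∀ i → act v s i ≡ 0#) → v ≡ 𝟎
        no-short-relation zero _ su nz [] z = refl
        no-short-relation (suc l) l<r {s} su nz v z with Vec.initLast v
        ... | u , a , refl with a ≟ 0#
        ... | yes refl with no-short-relation l (ℕₚ.<⇒≤ l<r) su nz u
              (λ i → trans (sym (trans (act-∷ʳ u 0# s i) (trans (cong (act u s i +_) (zeroˡ _)) (+-identityʳ _)))) (z i))
        ... | refl = 𝟎∷ʳ l
          where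
          𝟎∷ʳ : ∀ l → 𝟎 {l} ∷ʳ 0# ≡ 𝟎
          𝟎∷ʳ zero = refl
          𝟎∷ʳ (suc l) = cong (0# ∷_) (𝟎∷ʳ l)
        no-short-relation (suc l) l<r {s} su nz v z | u , a , refl | no a≢0 =
          ⊥-elim (minimal l l<r (s , su , nz , - (a ⁻¹) ⊙ u , λ i → begin
            s (i ℕ.+ l) ≡⟨ *-identityˡ _ ⟨
            1# * s (i ℕ.+ l) ≡⟨ cong (_* s (i ℕ.+ l)) (⁻¹-inverseˡ a≢0) ⟨
            a ⁻¹ * a * s (i ℕ.+ l) ≡⟨ solve 4 (λ j a x P → j :* a :* x := j :* (P :+ a :* x) :+ :- j :* P) refl (a ⁻¹) a (s (i ℕ.+ l)) (act u s i) ⟩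
            a ⁻¹ * (act u s i + a * s (i ℕ.+ l)) + - (a ⁻¹) * act u s i
                                                         ≡⟨ cong₂ (λ x y → a ⁻¹ * x + y) (trans (sym (act-∷ʳ u a s i)) (z i)) (sym (act-⊙ (- (a ⁻¹)) u s i)) ⟩
            a ⁻¹ * 0# + act (- (a ⁻¹) ⊙ u) s i ≡⟨ trans (cong (_+ act (- (a ⁻¹) ⊙ u) s i) (zeroʳ _)) (+-identityˡ _) ⟩
            act (- (a ⁻¹) ⊙ u) s i ∎))
          where open ≡-Reasoning

        E : Set
        E = Vec Carrier r

        ev : E → Seq
        ev v = act v w

        act-difference : ∀ (u v : E) s i → act (- 1# ⊙ v ⊕ u) s i ≡ - act v s i + act u s i
        act-difference u v s i = trans (act-⊙⊕ (- 1#) v u s i) (cong (_+ act u s i) (-1*x≈-x _))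

        act-injective : ∀ {s} → Suitable s → ¬ (∀ i → s i ≡ 0#) → (u v : E) → (∀ i → act u s i ≡ act v s i) → u ≡ v
        act-injective {s} su nz u v e = difference≡𝟎⇒≡ u v (no-short-relation r ℕₚ.≤-refl su nz _ (λ i →
          trans (act-difference u v s i) (trans (cong (- act v s i +_) (e i)) (-‿inverseˡ _))))

        -- Makes the action on `w` faithful, so the ring laws of `E` are checked on sequences, where
        -- actions commute, and no division of polynomials is carried out.
        ev-injective : ∀ {u v : E} → (∀ i → ev u i ≡ ev v i) → u ≡ v
        ev-injective {u} {v} = act-injective suitable w≢0 u v

        -- Multiplication by X modulo the relation: the top coefficient `a` would overflow to degree
        -- `r` and is replaced by `a ⊙ c`.
        X· : E → E
        X· v = let u , a , _ = Vec.initLast v in a ⊙ c ⊕ (0# ∷ u)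

        ev-X· : ∀ v i → ev (X· v) i ≡ ev v (suc i)
        ev-X· v i with Vec.initLast v
        ... | u , a , refl = begin
          act (a ⊙ c ⊕ (0# ∷ u)) w i ≡⟨ act-⊙⊕ a c (0# ∷ u) w i ⟩
          a * act c w i + (0# * w i + act u w (suc i)) ≡⟨ cong₂ (λ x y → a * x + y) (sym (relation i)) (trans (cong (_+ act u w (suc i)) (zeroˡ _)) (+-identityˡ _)) ⟩
          a * w (i ℕ.+ suc r′) + act u w (suc i) ≡⟨ +-comm _ _ ⟩
          act u w (suc i) + a * w (i ℕ.+ suc r′) ≡⟨ cong (λ j → act u w (suc i) + a * w j) (ℕₚ.+-suc i r′) ⟩
          act u w (suc i) + a * w (suc i ℕ.+ r′) ≡⟨ act-∷ʳ u a w (suc i) ⟨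
          act (u ∷ʳ a) w (suc i) ∎
          where open ≡-Reasoning

        mulᵥ : ∀ {l} → Vec Carrier l → E → E
        mulᵥ [] u = 𝟎
        mulᵥ (a ∷ v) u = a ⊙ u ⊕ X· (mulᵥ v u)

        mul : E → E → E
        mul = mulᵥ

        ev-mulᵥ : ∀ {l} (v : Vec Carrier l) u i → ev (mulᵥ v u) i ≡ act v (ev u) i
        ev-mulᵥ [] u i = act-𝟎 r w i
        ev-mulᵥ (a ∷ v) u i = trans (act-⊙⊕ a u (X· (mulᵥ v u)) w i) (cong (a * ev u i +_) (trans (ev-X· (mulᵥ v u) i) (ev-mulᵥ v u (suc i))))

        ev-mul : ∀ v u i → ev (mul v u) i ≡ act v (ev u) i
        ev-mul = ev-mulᵥ

        one : E
        one = 1# ∷ 𝟎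

        act-one : ∀ s i → act one s i ≡ s i
        act-one s i = trans (cong₂ _+_ (*-identityˡ _) (act-𝟎 r′ s (suc i))) (+-identityʳ _)

        neg : E → E
        neg = Vec.map -_

        mul-comm : ∀ u v → mul u v ≡ mul v u
        mul-comm u v = ev-injective (λ i → trans (ev-mul u v i) (trans (act-comm u v w i) (sym (ev-mul v u i))))

        mul-assoc : ∀ a b d → mul (mul a b) d ≡ mul a (mul b d)
        mul-assoc a b d = ev-injective λ i → begin
          ev (mul (mul a b) d) i ≡⟨ ev-mul (mul a b) d i ⟩
          act (mul a b) (act d w) i ≡⟨ act-comm (mul a b) d w i ⟩
          act d (ev (mul a b)) i ≡⟨ act-cong d (ev-mul a b) i ⟩
          act d (act a (act b w)) i ≡⟨ act-comm d a (act b w) i ⟩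
          act a (act d (act b w)) i ≡⟨ act-cong a (act-comm d b w) i ⟩
          act a (act b (act d w)) i ≡⟨ act-cong a (ev-mul b d) i ⟨
          act a (ev (mul b d)) i ≡⟨ ev-mul a (mul b d) i ⟨
          ev (mul a (mul b d)) i ∎
          where open ≡-Reasoning

        mul-oneˡ : ∀ u → mul one u ≡ u
        mul-oneˡ u = ev-injective (λ i → trans (ev-mul one u i) (act-one (ev u) i))

        mul-distribʳ : ∀ a u v → mul (u ⊕ v) a ≡ mul u a ⊕ mul v a
        mul-distribʳ a u v = ev-injective λ i → trans (ev-mul (u ⊕ v) a i) (trans (act-⊕ u v (ev a) i)
          (sym (trans (act-⊕ (mul u a) (mul v a) w i) (cong₂ _+_ (ev-mul u a i) (ev-mul v a i)))))

        mul-distribˡ : ∀ a u v → mul a (u ⊕ v) ≡ mul a u ⊕ mul a v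
        mul-distribˡ a u v = trans (mul-comm a _) (trans (mul-distribʳ a u v) (cong₂ _⊕_ (mul-comm u a) (mul-comm v a)))

        ev-nonzero : ∀ {u} → u ≢ 𝟎 → ¬ (∀ i → ev u i ≡ 0#)
        ev-nonzero {u} ne z = ne (no-short-relation r ℕₚ.≤-refl suitable w≢0 u z)

        -- The sequence `act u w` is again suitable and nonzero, so multiplication by `u` is
        -- injective; on the finite set `E` it then reaches `one`.
        E-inverse : ∀ u → u ≢ 𝟎 → ∃[ v ] (mul u v ≡ one)
        E-inverse u ne = let v , _ , e = ∈-map⁻ (λ v → mul v u) one∈ in v , trans (mul-comm u v) (sym e)
          where
          inj : ∀ {v v'} → mul v u ≡ mul v' u → v ≡ v'
          inj {v} {v'} e = act-injective (suitable-act u suitable) (ev-nonzero ne) v v'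
            (λ i → trans (sym (ev-mul v u i)) (trans (cong (λ z → ev z i) e) (ev-mul v' u i)))
          one∈ : one ∈ List.map (λ v → mul v u) (allVecs r)
          one∈ = ∈-resp-↭ (unique-⊆⇒↭ (Unique-map⁺ inj (allVecs-unique r)) (λ {z} _ → allVecs-complete z)
                   (ℕₚ.≤-reflexive (sym (Listₚ.length-map _ (allVecs r))))) (allVecs-complete one)

        field-E : FiniteField
        field-E = record
          { Carrier = E ; _+_ = _⊕_ ; _*_ = mul ; -_ = neg ; 0# = 𝟎 ; 1# = one
          ; isCommutativeRing = record
              { isRing = record
                  { +-isAbelianGroup = record
                      { isGroup = record
                          { isMonoid = record
                              { isSemigroup = record
                                  { isMagma = record { isEquivalence = ≡.isEquivalence ; ∙-cong = cong₂ _⊕_ }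
                                  ; assoc = Vecₚ.zipWith-assoc +-assoc }
                              ; identity = ⊕-identityˡ , ⊕-identityʳ }
                          ; inverse = Vecₚ.zipWith-inverseˡ -‿inverseˡ , Vecₚ.zipWith-inverseʳ -‿inverseʳ
                          ; ⁻¹-cong = cong neg }
                      ; comm = Vecₚ.zipWith-comm +-comm }
                  ; *-cong = cong₂ mul
                  ; *-assoc = mul-assoc
                  ; *-identity = mul-oneˡ , (λ u → trans (mul-comm u one) (mul-oneˡ u))
                  ; distrib = mul-distribˡ , mul-distribʳ }
              ; *-comm = mul-comm }
          ; 0≢1 = λ e → 0≢1 (Vecₚ.∷-injectiveˡ e)
          ; inverse = E-inverse
          ; _≟_ = Vecₚ.≡-dec _≟_
          ; elements = allVecs r
          ; complete = allVecs-complete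
          ; unique = allVecs-unique r }

        ι : Carrier → E
        ι a = a ⊙ one

        ev-one : ∀ i → ev one i ≡ w i
        ev-one = act-one w

        ι-mul : ∀ a u → mul (ι a) u ≡ a ⊙ u
        ι-mul a u = ev-injective λ i → trans (ev-mul (ι a) u i) (trans (act-⊙ a one (ev u) i)
          (trans (cong (a *_) (act-one (ev u) i)) (sym (act-⊙ a u w i))))

        x : E
        x = X· one

        ev-x-mul : ∀ u i → ev (mul x u) i ≡ ev u (suc i)
        ev-x-mul u i = begin
          ev (mul x u) i ≡⟨ ev-mul x u i ⟩
          act x (act u w) i ≡⟨ act-comm x u w i ⟩
          act u (ev x) i ≡⟨ act-cong u (λ j → trans (ev-X· one j) (ev-one (suc j))) i ⟩
          act u (λ j → w (suc j)) i ≡⟨ act-suc u w i ⟩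
          ev u (suc i) ∎
          where open ≡-Reasoning

        private
          module E′ = FieldProps field-E
        open DegreeOfExtension F {h = h} pr q≡p^h field-E

        ev-x^ : ∀ n i → ev (x E′.^ n) i ≡ w (i ℕ.+ n)
        ev-x^ zero i = trans (ev-one i) (cong w (sym (ℕₚ.+-identityʳ i)))
        ev-x^ (suc n) i = trans (ev-x-mul (x E′.^ n) i) (trans (ev-x^ n (suc i)) (cong w (sym (ℕₚ.+-suc i n))))

        ev-poly : ∀ {l} (v : Vec Carrier l) i → ev (polyᴷ ι v x) i ≡ act v w i
        ev-poly [] i = act-𝟎 r w i
        ev-poly (a ∷ v) i = trans (act-⊕ (ι a) (mul x (polyᴷ ι v x)) w i) (cong₂ _+_
          (trans (act-⊙ a one w i) (cong (a *_) (ev-one i)))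
          (trans (ev-x-mul (polyᴷ ι v x) i) (ev-poly v (suc i))))

        -- The period Q - 1 of `w` gives x^Q = x, and suitability excludes x^(q^d) = x for 1 ≤ d <
        -- m, since otherwise `Δ d` would annihilate `w`.
        r≡m : r ≡ m
        r≡m = degree ι (⊙-zeroˡ one) (⊙-identity one) (λ a b → trans (sym (⊙-assoc a b one)) (sym (ι-mul a (ι b))))
          (length-allVecs r) x (λ y → y , ev-injective (λ i → sym (ev-poly y i))) c
          (ev-injective (λ i → trans (ev-poly c i) (trans (sym (relation i)) (sym (ev-x^ r i)))))
          (ev-injective (λ i → trans (ev-x^ Q i) (trans (cong w (trans (cong (i ℕ.+_) (sym 1+period≡Q)) (ℕₚ.+-suc i period)))
            (trans (proj₁ suitable (suc i)) (sym (trans (ev-X· one i) (ev-one (suc i))))))))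
          (λ {d} 1≤d d<m e → w≢0 (suitable-Δ suitable 1≤d d<m (λ i → x≡y⇒x-y≡0
            (trans (sym (ev-x^ (order ℕ.^ d) i)) (trans (cong (λ z → ev z i) e) (trans (ev-X· one i) (ev-one (suc i))))))))
          1≤m

        extension : Extension F m
        extension = subst (Extension F) r≡m (record
          { K = field-E ; to = λ v → v ; from = λ v → v ; to-from = λ _ → refl ; from-to = λ _ → refl
          ; order-K = length-allVecs r ; to-+ = λ _ _ → refl ; scalar = ι ; to-scalar-* = ι-mul })

    ¬¬extension : ¬ ¬ Extension F m
    ¬¬extension none = ¬¬-least HasRelation period w₀-relation λ
      { (zero , (w , _ , w≢0 , [] , relation) , _) → w≢0 (λ i → trans (cong w (sym (ℕₚ.+-identityʳ i))) (relation i))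
      ; (suc r′ , (w , suitable , w≢0 , c , relation) , minimal) →
          none (FromMinimalRelation.extension r′ minimal w suitable w≢0 c relation) }

-- Functionals with values in the extension field.

module ExtensionFunctionals (F : FiniteField) {m : ℕ} (E : Extension F m) where
  open LinearAlgebra F
  open Solver
  open Extension E
  module K = Redei K

  to-injective : ∀ {a b} → to a ≡ to b → a ≡ b
  to-injective {a} {b} e = trans (sym (from-to a)) (trans (cong from e) (from-to b))

  from-⊕ : ∀ u v → from (u ⊕ v) ≡ from u K.+ from v
  from-⊕ u v = to-injective (trans (to-from _) (sym (trans (to-+ _ _) (cong₂ _⊕_ (to-from u) (to-from v)))))

  from-⊙ : ∀ c v → from (c ⊙ v) ≡ scalar c K.* from v
  from-⊙ c v = to-injective (trans (to-from _) (sym (trans (to-scalar-* c _) (cong (c ⊙_) (to-from v)))))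

  to-0 : to K.0# ≡ 𝟎
  to-0 = trans (cong to (sym (K.zeroʳ (scalar 0#)))) (trans (to-scalar-* 0# K.0#) (⊙-zeroˡ _))

  from-𝟎 : from 𝟎 ≡ K.0#
  from-𝟎 = trans (cong from (sym to-0)) (from-to K.0#)

  from≡0⇒≡𝟎 : ∀ {v} → from v ≡ K.0# → v ≡ 𝟎
  from≡0⇒≡𝟎 {v} e = trans (sym (to-from v)) (trans (cong to e) to-0)

  one : Vec Carrier m
  one = to K.1#

  one≢𝟎 : one ≢ 𝟎
  one≢𝟎 e = K.0≢1 (to-injective (trans to-0 (sym e)))

  to-scalar : ∀ c → to (scalar c) ≡ c ⊙ one
  to-scalar c = trans (cong to (sym (K.*-identityʳ (scalar c)))) (to-scalar-* c K.1#)

  scalar-+ : ∀ a b → scalar (a + b) ≡ scalar a K.+ scalar b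
  scalar-+ a b = to-injective (trans (to-scalar _) (trans (⊙-distribʳ a b one) (sym (trans (to-+ _ _) (cong₂ _⊕_ (to-scalar a) (to-scalar b))))))

  scalar-0 : scalar 0# ≡ K.0#
  scalar-0 = to-injective (trans (to-scalar 0#) (trans (⊙-zeroˡ one) (sym to-0)))

  scalar-1 : scalar 1# ≡ K.1#
  scalar-1 = to-injective (trans (to-scalar 1#) (⊙-identity one))

  -- With `scalar≡1` it brings counts modulo p computed in `K` back to GF(q).
  scalar≡0 : ∀ {c} → scalar c ≡ K.0# → c ≡ 0#
  scalar≡0 {c} e = ⊙-cancel one≢𝟎 (trans (sym (to-scalar c)) (trans (cong to e) to-0))

  scalar≡1 : ∀ {c} → scalar c ≡ K.1# → c ≡ 1#
  scalar≡1 {c} e = x-y≡0⇒x≡y (scalar≡0 (K.+-cancelʳ K.1# _ _ (begin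
      scalar (c + - 1#) K.+ K.1# ≡⟨ cong (scalar (c + - 1#) K.+_) (sym scalar-1) ⟩
      scalar (c + - 1#) K.+ scalar 1# ≡⟨ scalar-+ _ _ ⟨
      scalar ((c + - 1#) + 1#) ≡⟨ cong scalar (solve 2 (λ c o → (c :- o) :+ o := c) refl c 1#) ⟩
      scalar c ≡⟨ e ⟩
      K.1# ≡⟨ K.+-identityˡ _ ⟨
      K.0# K.+ K.1# ∎)))
    where open ≡-Reasoning

  scalar-ind : ∀ {A : Set} (d : Dec A) → K.ind d ≡ scalar (ind d)
  scalar-ind (yes _) = sym scalar-1
  scalar-ind (no _) = sym scalar-0

  scalar-∑ : ∀ {A : Set} (xs : List A) (f : A → Carrier) → K.∑ xs (scalar ∘ f) ≡ scalar (∑ xs f)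
  scalar-∑ [] f = sym scalar-0
  scalar-∑ (x ∷ xs) f = trans (cong (scalar (f x) K.+_) (scalar-∑ xs f)) (sym (scalar-+ _ _))

  record Linearᴷ {N} (φ : Vec Carrier N → K.Carrier) : Set where
    field
      additiveᴷ : ∀ u v → φ (u ⊕ v) ≡ φ u K.+ φ v
      homogeneousᴷ : ∀ c v → φ (c ⊙ v) ≡ scalar c K.* φ v
  open Linearᴷ public

  Linearᴷ-comb : ∀ {N} {φ ψ : Vec Carrier N → K.Carrier} t → Linearᴷ φ → Linearᴷ ψ → Linearᴷ (λ v → φ v K.+ t K.* ψ v)
  Linearᴷ-comb {φ = φ} {ψ} t l m = record
    { additiveᴷ = λ u v → trans (cong₂ (λ x y → x K.+ t K.* y) (additiveᴷ l u v) (additiveᴷ m u v))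
        (KS.solve 5 (λ a b c d t → (a KS.:+ b) KS.:+ t KS.:* (c KS.:+ d) KS.:= (a KS.:+ t KS.:* c) KS.:+ (b KS.:+ t KS.:* d)) refl (φ u) (φ v) (ψ u) (ψ v) t)
    ; homogeneousᴷ = λ c v → trans (cong₂ (λ x y → x K.+ t K.* y) (homogeneousᴷ l c v) (homogeneousᴷ m c v))
        (KS.solve 4 (λ c a t b → c KS.:* a KS.:+ t KS.:* (c KS.:* b) KS.:= c KS.:* (a KS.:+ t KS.:* b)) refl (scalar c) (φ v) t (ψ v)) }
    where module KS = K.Solver

  Linearᴷ-zero : ∀ {N} → Linearᴷ {N} (λ _ → K.0#)
  Linearᴷ-zero = record { additiveᴷ = λ _ _ → sym (K.+-identityˡ K.0#) ; homogeneousᴷ = λ _ _ → sym (K.zeroʳ _) }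

  coordinate-linear : ∀ {N} {φ : Vec Carrier N → K.Carrier} → Linearᴷ φ → ∀ i → Linear (λ v → lookup (to (φ v)) i)
  coordinate-linear {φ = φ} l i = record
    { additive = λ u v → trans (cong (λ w → lookup w i) (trans (cong to (additiveᴷ l u v)) (to-+ _ _))) (Vecₚ.lookup-zipWith _+_ i (to (φ u)) (to (φ v)))
    ; homogeneous = λ c v → trans (cong (λ w → lookup w i) (trans (cong to (homogeneousᴷ l c v)) (to-scalar-* c _))) (Vecₚ.lookup-map i (c *_) (to (φ v))) }

  coordinates≡0⇒≡0 : ∀ a → (∀ i → lookup (to a) i ≡ 0#) → a ≡ K.0#
  coordinates≡0⇒≡0 a z = to-injective (trans (lookup≡0⇒≡𝟎 (to a) z) (sym to-0))

  -- Packs `m` functionals into one whose zeros are their common zeros, so that a subspace of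
  -- codimension at most `m` becomes the kernel of a single functional.
  assemble : ∀ {N} → (Fin m → Vec Carrier N → Carrier) → Vec Carrier N → K.Carrier
  assemble ρ v = from (tabulate (λ i → ρ i v))

  assemble-linear : ∀ {N} {ρ : Fin m → Vec Carrier N → Carrier} → (∀ i → Linear (ρ i)) → Linearᴷ (assemble ρ)
  assemble-linear {ρ = ρ} lin = record
    { additiveᴷ = λ u v → trans (cong from (tab-+ _ (λ i → additive (lin i) u v))) (from-⊕ _ _)
    ; homogeneousᴷ = λ c v → trans (cong from (tab-* _ (λ i → homogeneous (lin i) c v))) (from-⊙ c _) }
    where
    tab-+ : ∀ k {f g h : Fin k → Carrier} → (∀ i → f i ≡ g i + h i) → tabulate f ≡ tabulate g ⊕ tabulate h
    tab-+ zero e = refl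
    tab-+ (suc k) e = cong₂ _∷_ (e Fin.zero) (tab-+ k (e ∘ Fin.suc))
    tab-* : ∀ k {c} {f g : Fin k → Carrier} → (∀ i → f i ≡ c * g i) → tabulate f ≡ c ⊙ tabulate g
    tab-* zero e = refl
    tab-* (suc k) e = cong₂ _∷_ (e Fin.zero) (tab-* k (e ∘ Fin.suc))

  assemble≡0⇒ : ∀ {N} (ρ : Fin m → Vec Carrier N → Carrier) v → assemble ρ v ≡ K.0# → ∀ i → ρ i v ≡ 0#
  assemble≡0⇒ ρ v e i = trans (sym (Vecₚ.lookup∘tabulate (λ i → ρ i v) i))
    (trans (cong (λ w → lookup w i) (from≡0⇒≡𝟎 e)) (Vecₚ.lookup-replicate i 0#))

  ⇒assemble≡0 : ∀ {N} (ρ : Fin m → Vec Carrier N → Carrier) v → (∀ i → ρ i v ≡ 0#) → assemble ρ v ≡ K.0#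
  ⇒assemble≡0 ρ v z = trans (cong from (lookup≡0⇒≡𝟎 _ (λ i → trans (Vecₚ.lookup∘tabulate (λ i → ρ i v) i) (z i)))) from-𝟎

  -- Regards one functional over GF(q) as `K`-valued with the same zeros; it supplies functionals
  -- that are nonzero at a prescribed point.
  extend : ∀ {N} → (Vec Carrier N → Carrier) → Vec Carrier N → K.Carrier
  extend τ v = from (τ v ⊙ one)

  extend-linear : ∀ {N} {τ : Vec Carrier N → Carrier} → Linear τ → Linearᴷ (extend τ)
  extend-linear {τ = τ} l = record
    { additiveᴷ = λ u v → trans (cong (λ c → from (c ⊙ one)) (additive l u v)) (trans (cong from (⊙-distribʳ (τ u) (τ v) one)) (from-⊕ _ _))
    ; homogeneousᴷ = λ c v → trans (cong (λ c → from (c ⊙ one)) (homogeneous l c v)) (trans (cong from (sym (⊙-assoc c (τ v) one))) (from-⊙ c _)) }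

  extend≡0⇒ : ∀ {N} (τ : Vec Carrier N → Carrier) v → extend τ v ≡ K.0# → τ v ≡ 0#
  extend≡0⇒ τ v e = ⊙-cancel one≢𝟎 (from≡0⇒≡𝟎 e)

  ⇒extend≡0 : ∀ {N} (τ : Vec Carrier N → Carrier) v → τ v ≡ 0# → extend τ v ≡ K.0#
  ⇒extend≡0 τ v e = trans (cong (λ c → from (c ⊙ one)) e) (trans (cong from (⊙-zeroˡ one)) from-𝟎)

-- Points, subspaces and separating functionals.

module Geometry (F : FiniteField) where
  open LinearAlgebra F public
  open PG F public using (Subspace; Point; allPoints; PointSet; _∈S_; Blocking; MinimalBlocking)

  _≟ⱽ_ : ∀ {N} → DecidableEquality (Vec Carrier N)
  _≟ⱽ_ = Vecₚ.≡-dec _≟_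

  _≟ᴾ_ : ∀ {n} → DecidableEquality (Point n)
  P ≟ᴾ R = map′ (λ e → toVec-proportional (trans e (sym (⊙-identity (toVec R))))) (cong toVec) (toVec P ≟ⱽ toVec R)

  inSpan? : ∀ {r N} (vs : Vec (Vec Carrier N) r) w → Dec (InSpan vs w)
  inSpan? vs w = anyVec? (λ cs → w ≟ⱽ lincomb cs vs)

  subspace : ∀ {n d} (vs : Vec (Vec Carrier (suc n)) (suc d)) → LinIndep vs → Subspace n d
  subspace vs ind = record
    { basis = vs ; indep = ind ; mem = λ v → ⌊ inSpan? vs v ⌋
    ; memSpec = λ v → mk⇔ (to v (inSpan? vs v)) (from v (inSpan? vs v)) }
    where
    to : ∀ v (d : Dec (InSpan vs v)) → ⌊ d ⌋ ≡ true → InSpan vs v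
    to v (yes p) _ = p
    from : ∀ v (d : Dec (InSpan vs v)) → InSpan vs v → ⌊ d ⌋ ≡ true
    from v (yes _) _ = refl
    from v (no ¬p) p = ⊥-elim (¬p p)

  ∈S⇒InSpan : ∀ {n d} (S : Subspace n d) {P} → (P ∈S S) ≡ true → InSpan (Subspace.basis S) (toVec P)
  ∈S⇒InSpan S {P} = Equivalence.to (Subspace.memSpec S (toVec P))

  InSpan⇒∈S : ∀ {n d} (S : Subspace n d) {P} → InSpan (Subspace.basis S) (toVec P) → (P ∈S S) ≡ true
  InSpan⇒∈S S {P} = Equivalence.from (Subspace.memSpec S (toVec P))

  annihilatorOf : ∀ {n d m} → m ℕ.+ d ≡ n → (S : Subspace n d) → Annihilator (Subspace.basis S) m
  annihilatorOf {d = d} {m} eq S with annihilator (Subspace.basis S) (Subspace.indep S)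
  ... | k , eq' , A = subst (Annihilator (Subspace.basis S))
      (ℕₚ.+-cancelʳ-≡ d k m (ℕₚ.suc-injective (trans (sym (ℕₚ.+-suc k d)) (trans eq' (cong suc (sym eq)))))) A

  coordinate≢0 : ∀ {n} (P : Point n) → ∃[ i ] (lookup (toVec P) i ≢ 0#)
  coordinate≢0 P with Finₚ.any? (λ i → ¬? (lookup (toVec P) i ≟ 0#))
  ... | yes p = p
  ... | no none = ⊥-elim (toVec≢𝟎 P (lookup≡0⇒≡𝟎 (toVec P) (λ i → decidable-stable (lookup (toVec P) i ≟ 0#) (λ ne → none (i , ne)))))

  -- With p_i ≠ 0, the functionals v_j - (p_j / p_i) v_i all vanish at `P`; if all vanished at `R`
  -- too, the two vectors would be proportional.
  separate : ∀ {n} {P R : Point n} → P ≢ R → ∃[ σ ] (Linear σ × σ (toVec P) ≡ 0# × σ (toVec R) ≢ 0#)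
  separate {n} {P} {R} P≢R with coordinate≢0 P
  ... | i , pᵢ≢0 with Finₚ.any? (λ j → ¬? ((lookup r j + - (lookup p j * lookup p i ⁻¹) * lookup r i) ≟ 0#))
    where
    p = toVec P
    r = toVec R
  ... | yes (j , ne) = (λ v → lookup v j + - (lookup (toVec P) j * lookup (toVec P) i ⁻¹) * lookup v i)
                     , Linear-comb _ (Linear-lookup j) (Linear-lookup i) , at-P , ne
    where
    open Solver
    p = toVec P
    at-P : lookup p j + - (lookup p j * lookup p i ⁻¹) * lookup p i ≡ 0#
    at-P = eliminate (lookup p j) pᵢ≢0
  ... | no none = ⊥-elim (P≢R (sym (toVec-proportional {P = R} {P} {c} (ext r p zero-at))))
    where
    open Solver
    p = toVec P
    r = toVec R
    c = lookup r i * lookup p i ⁻¹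
    zero-at : ∀ j → lookup r j ≡ c * lookup p j
    zero-at j = x-y≡0⇒x≡y (trans (solve 4 (λ a b c d → a :- (b :* d) :* c := a :+ :- (c :* d) :* b) refl (lookup r j) (lookup r i) (lookup p j) (lookup p i ⁻¹))
      (decidable-stable (_ ≟ 0#) (λ ne → none (j , ne))))
    ext : ∀ {N} (u v : Vec Carrier N) → (∀ j → lookup u j ≡ c * lookup v j) → u ≡ c ⊙ v
    ext [] [] e = refl
    ext (x ∷ u) (y ∷ v) e = cong₂ _∷_ (e Fin.zero) (ext u v (e ∘ Fin.suc))

  Zero : ∀ {n k} → (Fin k → Vec Carrier (suc n) → Carrier) → Point n → Set
  Zero ρ P = ∀ i → ρ i (toVec P) ≡ 0#

  zero? : ∀ {n k} (ρ : Fin k → Vec Carrier (suc n) → Carrier) P → Dec (Zero ρ P)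
  zero? ρ P = Finₚ.all? (λ i → ρ i (toVec P) ≟ 0#)

  distinct⇒independent : ∀ {n} {P R : Point n} → P ≢ R → ∀ a b → a ⊙ toVec P ⊕ b ⊙ toVec R ≡ 𝟎 → a ≡ 0# × b ≡ 0#
  distinct⇒independent {P = P} {R} P≢R a b e with a ≟ 0#
  ... | yes refl = refl , ⊙-cancel (toVec≢𝟎 R) (trans (sym (trans (cong (_⊕ b ⊙ toVec R) (⊙-zeroˡ (toVec P))) (⊕-identityˡ _))) e)
  ... | no a≢0 = ⊥-elim (P≢R (toVec-proportional {c = - (a ⁻¹ * b)} (solve-for (toVec P) (toVec R) e)))
    where
    open Solver
    solve-for : ∀ {N} (u v : Vec Carrier N) → a ⊙ u ⊕ b ⊙ v ≡ 𝟎 → u ≡ - (a ⁻¹ * b) ⊙ v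
    solve-for [] [] _ = refl
    solve-for (x ∷ u) (y ∷ v) e = cong₂ _∷_ (begin
        x ≡⟨ *-identityˡ x ⟨
        1# * x ≡⟨ cong (_* x) (⁻¹-inverseˡ a≢0) ⟨
        a ⁻¹ * a * x ≡⟨ solve 5 (λ i a x b y → i :* a :* x := i :* (a :* x :+ b :* y) :+ :- (i :* b) :* y) refl (a ⁻¹) a x b y ⟩
        a ⁻¹ * (a * x + b * y) + - (a ⁻¹ * b) * y ≡⟨ cong (λ z → a ⁻¹ * z + - (a ⁻¹ * b) * y) (Vecₚ.∷-injectiveˡ e) ⟩
        a ⁻¹ * 0# + - (a ⁻¹ * b) * y ≡⟨ trans (cong (_+ - (a ⁻¹ * b) * y) (zeroʳ _)) (+-identityˡ _) ⟩
        - (a ⁻¹ * b) * y ∎) (solve-for u v (Vecₚ.∷-injectiveʳ e))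
      where open ≡-Reasoning

  -- Pencils and the induction on the number of zeros in D.

  module Counting {n m : ℕ} (T : Subspace n m) (D Bs : List (Point n)) (D-unique : Unique D)
    (D⊆T : ∀ {P} → P ∈ D → InSpan (Subspace.basis T) (toVec P)) where

    private
      module T = Subspace T

      V : Set
      V = Vec Carrier (suc n)

    Functionals : Set
    Functionals = Fin m → V → Carrier

    AllLinear : Functionals → Set
    AllLinear ρ = ∀ i → Linear (ρ i)

    N : Functionals → Carrier
    N ρ = ∑ Bs (λ P → ind (zero? ρ P))

    _[_≔_] : Functionals → Fin m → (V → Carrier) → Functionals
    (ρ [ i ≔ σ ]) j with i Fin.≟ j
    ... | yes _ = σ
    ... | no _ = ρ j

    ≔-linear : ∀ {ρ i σ} → AllLinear ρ → Linear σ → AllLinear (ρ [ i ≔ σ ])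
    ≔-linear {i = i} lin l j with i Fin.≟ j
    ... | yes _ = l
    ... | no _ = lin j

    ZeroOff : Functionals → Fin m → Point n → Set
    ZeroOff ρ i P = ∀ j → i ≢ j → ρ j (toVec P) ≡ 0#

    zeroOff? : ∀ ρ i P → Dec (ZeroOff ρ i P)
    zeroOff? ρ i P = Finₚ.all? (λ j → dec j (i Fin.≟ j))
      where
      dec : ∀ j → Dec (i ≡ j) → Dec (i ≢ j → ρ j (toVec P) ≡ 0#)
      dec j (yes e) = yes (λ ne → ⊥-elim (ne e))
      dec j (no ne) = map′ (λ z _ → z) (λ f → f ne) (ρ j (toVec P) ≟ 0#)

    zero-≔⇒ : ∀ ρ i σ P → Zero (ρ [ i ≔ σ ]) P → ZeroOff ρ i P × σ (toVec P) ≡ 0#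
    zero-≔⇒ ρ i σ P z = off , at
      where
      off : ZeroOff ρ i P
      off j ne with i Fin.≟ j | z j
      ... | yes e | _ = ⊥-elim (ne e)
      ... | no _ | e = e
      at : σ (toVec P) ≡ 0#
      at with i Fin.≟ i | z i
      ... | yes _ | e = e
      ... | no ne | _ = ⊥-elim (ne refl)

    ⇒zero-≔ : ∀ ρ i σ P → ZeroOff ρ i P → σ (toVec P) ≡ 0# → Zero (ρ [ i ≔ σ ]) P
    ⇒zero-≔ ρ i σ P off at j with i Fin.≟ j
    ... | yes _ = at
    ... | no ne = off j ne

    -- Each point of ⋂_{j≠i} ker ρ_j lies on 1 mod q members of the pencil spanned by σ and τ.
    pencil : ∀ ρ i (σ τ : V → Carrier) →
             ∑ elements (λ y → N (ρ [ i ≔ (λ v → σ v + y * τ v) ])) + N (ρ [ i ≔ τ ]) ≡ ∑ Bs (λ P → ind (zeroOff? ρ i P))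
    pencil ρ i σ τ = trans (cong (_+ N (ρ [ i ≔ τ ])) (∑-swap elements Bs _)) (trans (sym (∑-+ Bs _ _)) (∑-cong Bs member))
      where
      member : ∀ P → ∑ elements (λ y → ind (zero? (ρ [ i ≔ (λ v → σ v + y * τ v) ]) P)) + ind (zero? (ρ [ i ≔ τ ]) P) ≡ ind (zeroOff? ρ i P)
      member P = go (zeroOff? ρ i P) (τ (toVec P) ≟ 0#) (σ (toVec P) ≟ 0#)
        where
        s = σ (toVec P)
        t = τ (toVec P)
        σy : Carrier → V → Carrier
        σy y v = σ v + y * τ v
        term? : ∀ y → Dec (Zero (ρ [ i ≔ σy y ]) P)
        term? y = zero? (ρ [ i ≔ σy y ]) P
        last? : Dec (Zero (ρ [ i ≔ τ ]) P)
        last? = zero? (ρ [ i ≔ τ ]) P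
        s+y0 : ∀ y → t ≡ 0# → s + y * t ≡ s
        s+y0 y = x≡0⇒a+t*x≡a
        go : (d : Dec (ZeroOff ρ i P)) → Dec (t ≡ 0#) → Dec (s ≡ 0#) → ∑ elements (λ y → ind (term? y)) + ind last? ≡ ind d
        go (no ¬off) _ _ = trans (cong₂ _+_ (trans (∑-cong elements (λ y → ind-no (term? y) (λ z → ¬off (proj₁ (zero-≔⇒ ρ i (σy y) P z))))) (∑-zero elements))
          (ind-no last? (λ z → ¬off (proj₁ (zero-≔⇒ ρ i τ P z))))) (+-identityˡ 0#)
        go (yes off) (yes t≡0) (yes s≡0) = trans (cong₂ _+_
            (trans (∑-cong elements (λ y → ind-yes (term? y) (⇒zero-≔ ρ i (σy y) P off (trans (s+y0 y t≡0) s≡0))))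
              (trans (∑-const elements 1#) (trans (*-identityʳ _) order≡0)))
            (ind-yes last? (⇒zero-≔ ρ i τ P off t≡0))) (+-identityˡ 1#)
        go (yes off) (yes t≡0) (no s≢0) = trans (cong₂ _+_
            (trans (∑-cong elements (λ y → ind-no (term? y) (λ z → s≢0 (trans (sym (s+y0 y t≡0)) (proj₂ (zero-≔⇒ ρ i (σy y) P z)))))) (∑-zero elements))
            (ind-yes last? (⇒zero-≔ ρ i τ P off t≡0))) (+-identityˡ 1#)
        go (yes off) (no t≢0) _ = trans (cong₂ _+_
            (trans (∑-cong elements (λ y → ind-⇔ (term? y) (y ≟ y₀) (λ z → solved y (proj₂ (zero-≔⇒ ρ i (σy y) P z))) (λ { refl → ⇒zero-≔ ρ i (σy y₀) P off root })))
              (∑-ind-≡ y₀))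
            (ind-no last? (λ z → t≢0 (proj₂ (zero-≔⇒ ρ i τ P z))))) (+-identityʳ 1#)
          where
          open Solver
          y₀ = - (s * t ⁻¹)
          root : s + y₀ * t ≡ 0#
          root = eliminate s t≢0
          solved : ∀ y → s + y * t ≡ 0# → y ≡ y₀
          solved y e = *-cancelˡ t≢0 (trans (*-comm t y) (trans (+-cancelˡ s _ _ (trans e (sym root))) (*-comm y₀ t)))
          ∑-ind-≡ : ∀ c → ∑ elements (λ s → ind (s ≟ c)) ≡ 1#
          ∑-ind-≡ = Redei.∑-δ-elements F

    zerosInD : Functionals → List (Point n)
    zerosInD ρ = filter (zero? ρ) D

    -- Replacing ρ i by any member of the pencil of σ₁ and σ₂, or by a member other than ρ i of the pencil of ρ i and σ₁,
    -- leaves fewer zeros on D.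
    module _ {ρ : Functionals} (lin : AllLinear ρ)
             (fewer⇒N≡1 : ∀ {ρ′} → AllLinear ρ′ → length (zerosInD ρ′) ℕ.< length (zerosInD ρ) → N ρ′ ≡ 1#)
             {P R} (P∈ : P ∈ D) (R∈ : R ∈ D) (P≢R : P ≢ R) (zP : Zero ρ P) (zR : Zero ρ R)
             (i : Fin m) (off⇒zero : ∀ {Q} → Q ∈ D → ZeroOff ρ i Q → ρ i (toVec Q) ≡ 0#) where
      private
        -- By `off⇒zero` every zero of the new tuple on `D` is already a zero of `ρ`, and `Q` is a
        -- zero of `ρ` that gets lost, so the induction hypothesis applies.
        replaced : ∀ {σ Q} → Linear σ → Q ∈ D → Zero ρ Q → σ (toVec Q) ≢ 0# → N (ρ [ i ≔ σ ]) ≡ 1#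
        replaced {σ} {Q} l Q∈ zQ ne = fewer⇒N≡1 (≔-linear {ρ} {i} lin l) (unique-⊆⇒length≤ {xs = Q ∷ zerosInD (ρ [ i ≔ σ ])}
            (All.tabulate (λ {Q′} Q′∈ Q≡Q′ → ne (subst (λ X → σ (toVec X) ≡ 0#) (sym Q≡Q′)
               (proj₂ (zero-≔⇒ ρ i σ Q′ (proj₂ (∈-filter⁻ (zero? (ρ [ i ≔ σ ])) {xs = D} Q′∈)))))) ∷ Unique-filter⁺ (zero? (ρ [ i ≔ σ ])) D-unique)
            sub)
          where
          sub : ∀ {X} → X ∈ Q ∷ zerosInD (ρ [ i ≔ σ ]) → X ∈ zerosInD ρ
          sub (here refl) = ∈-filter⁺ (zero? ρ) Q∈ zQ
          sub {X} (there X∈) = ∈-filter⁺ (zero? ρ) X∈D all-zero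
            where
            X∈D = proj₁ (∈-filter⁻ (zero? (ρ [ i ≔ σ ])) {xs = D} X∈)
            off : ZeroOff ρ i X
            off = proj₁ (zero-≔⇒ ρ i σ X (proj₂ (∈-filter⁻ (zero? (ρ [ i ≔ σ ])) {xs = D} X∈)))
            all-zero : Zero ρ X
            all-zero j with i Fin.≟ j
            ... | yes refl = off⇒zero X∈D off
            ... | no i≢j = off j i≢j

        σ₁ : V → Carrier
        σ₁ v = lookup v (proj₁ (coordinate≢0 P))

        σ₁P≢0 : σ₁ (toVec P) ≢ 0#
        σ₁P≢0 = proj₂ (coordinate≢0 P)

        σ₁-linear : Linear σ₁
        σ₁-linear = Linear-lookup (proj₁ (coordinate≢0 P))

        -- Each σ₁ + yσ₂ is nonzero at `P`, where σ₂ vanishes, and σ₂ itself is nonzero at `R`. All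
        -- q + 1 members therefore count 1, and q + 1 is 1 in the field.
        good-pencil : ∑ Bs (λ Q → ind (zeroOff? ρ i Q)) ≡ 1#
        good-pencil = with-separator (separate P≢R)
          where
          with-separator : ∃[ σ ] (Linear σ × σ (toVec P) ≡ 0# × σ (toVec R) ≢ 0#) → ∑ Bs (λ Q → ind (zeroOff? ρ i Q)) ≡ 1#
          with-separator (σ₂ , l , σ₂P≡0 , σ₂R≢0) = begin
            ∑ Bs (λ Q → ind (zeroOff? ρ i Q))
              ≡⟨ pencil ρ i σ₁ σ₂ ⟨
            ∑ elements (λ y → N (ρ [ i ≔ (λ v → σ₁ v + y * σ₂ v) ])) + N (ρ [ i ≔ σ₂ ])
              ≡⟨ cong₂ _+_ (∑-cong elements (λ y → replaced (Linear-comb y σ₁-linear l) P∈ zP (λ e → σ₁P≢0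
                   (trans (sym (x≡0⇒a+t*x≡a σ₂P≡0)) e))))
                   (replaced l R∈ zR σ₂R≢0) ⟩
            ∑ elements (λ _ → 1#) + 1#
              ≡⟨ cong (_+ 1#) (trans (∑-const elements 1#) (trans (*-identityʳ _) order≡0)) ⟩
            0# + 1#
              ≡⟨ +-identityˡ 1# ⟩
            1# ∎
            where open ≡-Reasoning

      two-zeros : N ρ ≡ 1#
      two-zeros = begin
        -- Adding q = 0 as 1 + (q - 1) accounts for the other members of the pencil of `ρ i` and σ₁:
        -- one for σ₁, and q - 1 for the nonzero values of `y`. All of them are nonzero at `P`.
        N ρ ≡⟨ trans (sym (+-identityʳ _)) (cong (N ρ +_) (trans (sym order≡0) (cong ⟦_⟧ order≡1+units))) ⟩
        N ρ + (1# + ⟦ length units ⟧) ≡⟨ solve 3 (λ n o u → n :+ (o :+ u) := (n :+ u) :+ o) refl (N ρ) 1# ⟦ length units ⟧ ⟩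
        (N ρ + ⟦ length units ⟧) + 1# ≡⟨ cong₂ _+_ (cong₂ _+_ M0 Mu) (sym (replaced σ₁-linear P∈ zP σ₁P≢0)) ⟩
        (M 0# + ∑ units M) + N (ρ [ i ≔ σ₁ ]) ≡⟨ cong (_+ N (ρ [ i ≔ σ₁ ])) (∑-↭ M elements↭0∷units) ⟨
        ∑ elements M + N (ρ [ i ≔ σ₁ ]) ≡⟨ pencil ρ i (ρ i) σ₁ ⟩
        ∑ Bs (λ Q → ind (zeroOff? ρ i Q)) ≡⟨ good-pencil ⟩
        1# ∎
        where
        open ≡-Reasoning
        open Solver
        M : Carrier → Carrier
        M y = N (ρ [ i ≔ (λ v → ρ i v + y * σ₁ v) ])
        M0 : N ρ ≡ M 0#
        M0 = ∑-cong Bs (λ Q → ind-⇔ (zero? ρ Q) (zero? (ρ [ i ≔ σ₀ ]) Q)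
          (λ z → ⇒zero-≔ ρ i σ₀ Q (λ j _ → z j) (trans (drop Q) (z i)))
          (λ z j → back Q (zero-≔⇒ ρ i σ₀ Q z) j (i Fin.≟ j)))
          where
          σ₀ : V → Carrier
          σ₀ v = ρ i v + 0# * σ₁ v
          drop : ∀ Q → ρ i (toVec Q) + 0# * σ₁ (toVec Q) ≡ ρ i (toVec Q)
          drop Q = trans (cong (ρ i (toVec Q) +_) (zeroˡ _)) (+-identityʳ _)
          back : ∀ Q → ZeroOff ρ i Q × ρ i (toVec Q) + 0# * σ₁ (toVec Q) ≡ 0# → ∀ j → Dec (i ≡ j) → ρ j (toVec Q) ≡ 0#
          back Q (off , e) j (yes refl) = trans (sym (drop Q)) e
          back Q (off , e) j (no ne) = off j ne
        Mu : ⟦ length units ⟧ ≡ ∑ units M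
        Mu = trans (sym (trans (∑-const units 1#) (*-identityʳ _))) (∑-cong∈ units (λ {y} y∈ →
          sym (replaced (Linear-comb y (lin i) σ₁-linear) P∈ zP (λ e → *-nonzero (units-nonzero y∈) σ₁P≢0
            (trans (sym (trans (cong (_+ y * σ₁ (toVec P)) (zP i)) (+-identityˡ _))) e)))))

    -- When `ρ` has two distinct zeros in `D`, the subspace `T`, of vector dimension m + 1, contains
    -- two independent common zeros. So on `T` one functional is implied by the others, and this is
    -- the index at which `two-zeros` operates.
    N≡1 : (∀ {ρ} → AllLinear ρ → (∀ {P R} → P ∈ D → R ∈ D → Zero ρ P → Zero ρ R → P ≡ R) → N ρ ≡ 1#) →
          ∀ {ρ} → AllLinear ρ → N ρ ≡ 1#
    N≡1 base {ρ} lin = induct (suc (length (zerosInD ρ))) lin ℕₚ.≤-refl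
      where
      Pair : Functionals → Point n → Point n → Set
      Pair ρ P R = P ≢ R × Zero ρ P × Zero ρ R
      pair? : ∀ ρ P R → Dec (Pair ρ P R)
      pair? ρ P R = ¬? (P ≟ᴾ R) ×-dec (zero? ρ P ×-dec zero? ρ R)
      induct : ∀ bound {ρ} → AllLinear ρ → length (zerosInD ρ) ℕ.< bound → N ρ ≡ 1#
      induct (suc bound) {ρ} lin (s≤s le) = by (Any.any? (λ P → Any.any? (pair? ρ P) D) D)
        where
        by : Dec (Any.Any (λ P → Any.Any (Pair ρ P) D) D) → N ρ ≡ 1#
        by (no none) = base lin (λ {P} {R} P∈ R∈ zP zR → decidable-stable (P ≟ᴾ R) (λ ne → none (lose P∈ (lose R∈ (ne , zP , zR)))))
        by (yes some) =
          let P , P∈ , some′ = find some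
              R , R∈ , P≢R , zP , zR = find some′
              i , red = redundant T.basis {ρ} lin (D⊆T P∈) (D⊆T R∈) zP zR (distinct⇒independent P≢R)
          in two-zeros lin (λ lin′ lt → induct bound lin′ (ℕₚ.<-≤-trans lt le)) P∈ R∈ P≢R zP zR i (λ Q∈ → red (D⊆T Q∈))

∧-true : ∀ {a b} → a ∧ b ≡ true → a ≡ true × b ≡ true
∧-true {true} e = refl , e
∧-true {false} ()

bit : ∀ {A : Set} → Dec A → ℕ
bit (yes _) = 1
bit (no _) = 0

length-filter-∷ : ∀ {A : Set} {P : A → Set} (P? : ∀ x → Dec (P x)) x xs → length (filter P? (x ∷ xs)) ≡ bit (P? x) ℕ.+ length (filter P? xs)
length-filter-∷ P? x xs with P? x
... | yes _ = refl
... | no _ = refl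

-- The blocking set meets subspaces of codimension at most m in 1 mod p points.

module OneModP (F : FiniteField) {p h : ℕ} (pr : Prime p) (q≡p^h : FiniteField.order F ≡ p ℕ.^ h)
  {n m k : ℕ} (m+k≡n : m ℕ.+ k ≡ n) (1≤m : 1 ℕ.≤ m)
  (B : PG.PointSet F n) (T : PG.Subspace F n m) where

  open Geometry F

  inT offT : Point n → Bool
  inT P = B P ∧ (P ∈S T)
  offT P = B P ∧ not (P ∈S T)

  D U : List (Point n)
  D = filter (λ P → inT P Bool.≟ true) (allPoints n)
  U = filter (λ P → offT P Bool.≟ true) (allPoints n)

  ∈D⇒ : ∀ {P} → P ∈ D → inT P ≡ true
  ∈D⇒ P∈ = proj₂ (∈-filter⁻ (λ P → inT P Bool.≟ true) {xs = allPoints n} P∈)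

  ∈U⇒ : ∀ {P} → P ∈ U → offT P ≡ true
  ∈U⇒ P∈ = proj₂ (∈-filter⁻ (λ P → offT P Bool.≟ true) {xs = allPoints n} P∈)

  D-unique : Unique D
  D-unique = Unique-filter⁺ (λ P → inT P Bool.≟ true) (allNVecs-unique (suc n))

  U-unique : Unique U
  U-unique = Unique-filter⁺ (λ P → offT P Bool.≟ true) (allNVecs-unique (suc n))

  not-true : ∀ {b} → not b ≡ true → b ≢ true
  not-true {true} () 
  not-true {false} _ ()

  B⇒∈D++U : ∀ {P} → B P ≡ true → P ∈ D ++ U
  B⇒∈D++U {P} bP = go (P ∈S T) refl
    where
    go : ∀ t → (P ∈S T) ≡ t → P ∈ D ++ U
    go true e = ∈-++⁺ˡ (∈-filter⁺ (λ P → inT P Bool.≟ true) (allNVecs-complete P) (cong₂ _∧_ bP e))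
    go false e = ∈-++⁺ʳ D (∈-filter⁺ (λ P → offT P Bool.≟ true) (allNVecs-complete P) (cong₂ _∧_ bP (cong not e)))

  ∈D++U⇒B : ∀ {P} → P ∈ D ++ U → B P ≡ true
  ∈D++U⇒B P∈ = [ (λ P∈D → proj₁ (∧-true (∈D⇒ P∈D))) , (λ P∈U → proj₁ (∧-true (∈U⇒ P∈U))) ]′ (∈-++⁻ D P∈)

  D⊆T : ∀ {P} → P ∈ D → InSpan (Subspace.basis T) (toVec P)
  D⊆T {P} P∈ = ∈S⇒InSpan T {P} (proj₂ (∧-true (∈D⇒ P∈)))

  U⊈T : ∀ {P} → P ∈ U → ¬ InSpan (Subspace.basis T) (toVec P)
  U⊈T {P} P∈ h = not-true (proj₂ (∧-true {B P} (∈U⇒ P∈))) (InSpan⇒∈S T {P} h)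

  open Counting T D (D ++ U) D-unique D⊆T public using (N; N≡1; AllLinear; Functionals)

  module _ (minimal : MinimalBlocking n k B) (2|D|≤ : length D ℕ.+ length D ℕ.≤ order ℕ.^ m) (|U|≡ : length U ≡ order ℕ.^ m) where

    module _ (E : Extension F m) where
      open ExtensionFunctionals F E
      open Extension E using (order-K; scalar)

      Φ : (Point n → K.Carrier) → Set
      Φ α = ∃[ φ ] (Linearᴷ {suc n} φ × ∀ P → α P ≡ φ (toVec P))

      comb : ∀ {α β} t → Φ α → Φ β → Φ (λ P → α P K.+ t K.* β P)
      comb t (φ , l , e) (ψ , l′ , e′) = _ , Linearᴷ-comb t l l′ , λ P → cong₂ (λ x y → x K.+ t K.* y) (e P) (e′ P)

      separating : ∀ P → ∃[ α ] (Φ α × α P ≢ K.0#)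
      separating P = let i , ne = coordinate≢0 P in
        (λ R → extend (λ v → lookup v i) (toVec R)) , (_ , extend-linear (Linear-lookup i) , λ _ → refl) , λ e → ne (extend≡0⇒ (λ v → lookup v i) (toVec P) e)

      -- The `m` coordinates of φ leave a kernel of vector dimension at least k + 1; it may be
      -- larger, so a k-dimensional subspace is cut from its basis and blocked.
      meets : ∀ {B′} → Blocking n k B′ → ∀ {φ} → Linearᴷ {suc n} φ → ∃[ P ] (B′ P ≡ true × φ (toVec P) ≡ K.0#)
      meets {B′} blocking {φ} l = go (prefix-independent (suc k) Ker.basis 1+k≤rank Ker.independent)
        where
        module Ker = Kernel (kernel (standard (suc n)) (standard-independent (suc n)) m (coordinate-linear l))
        1+k≤rank : suc k ℕ.≤ Ker.rank
        1+k≤rank = ℕₚ.+-cancelˡ-≤ m _ _ (ℕₚ.≤-trans (ℕₚ.≤-reflexive (trans (ℕₚ.+-suc m k) (cong suc m+k≡n))) Ker.rank-≥)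
        go : ∃[ us ] (LinIndep {suc k} us × (∀ {w} → InSpan us w → InSpan Ker.basis w)) → ∃[ P ] (B′ P ≡ true × φ (toVec P) ≡ K.0#)
        go (us , ind , sub) = let S = subspace us ind ; P , bP , P∈S = blocking S in
          P , bP , coordinates≡0⇒≡0 _ (Ker.killed (sub (∈S⇒InSpan S {P} P∈S)))

      blocking : ∀ {α} → Φ α → ∃[ P ] (P ∈ D ++ U × α P ≡ K.0#)
      blocking (φ , l , e) = let P , bP , z = meets {B} (proj₁ minimal) l in P , B⇒∈D++U bP , trans (e P) z

      -- Each k-dimensional subspace is the kernel of the assembly of its annihilator. If all
      -- functionals had a zero other than `P`, then `B` without `P` would still block, against
      -- minimality.
      essential : ∀ {P} → P ∈ D → ¬ (∀ {α} → Φ α → ∃[ R ] (R ∈ D ++ U × R ≢ P × α R ≡ K.0#))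
      essential {P} P∈ all-meet = absurd (proj₂ minimal B∖P (λ R e → proj₁ (∧-true e)) B∖P-blocking P (proj₁ (∧-true (∈D⇒ P∈))))
        where
        B∖P : Point n → Bool
        B∖P R = B R ∧ not ⌊ R ≟ᴾ P ⌋
        kept : ∀ {R} → B R ≡ true → R ≢ P → B∖P R ≡ true
        kept {R} bR ne with R ≟ᴾ P
        ... | yes e = ⊥-elim (ne e)
        ... | no _ = cong (_∧ true) bR
        absurd : B∖P P ≢ true
        absurd e with P ≟ᴾ P | ∧-true {B P} e
        ... | no ne | _ = ne refl
        ... | yes _ | _ , ()
        B∖P-blocking : Blocking n k B∖P
        B∖P-blocking S = let R , R∈ , ne , z = all-meet (assemble A.functional , assemble-linear A.linear , λ _ → refl) in
            R , kept (∈D++U⇒B R∈) ne , InSpan⇒∈S S {R} (A.separates (assemble≡0⇒ A.functional (toVec R) z))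
          where module A = Annihilator (annihilatorOf m+k≡n S)

      private
        module A = Annihilator (annihilatorOf (trans (ℕₚ.+-comm k m) m+k≡n) T)

      -- A point outside `T` is missed by some functional of the annihilator of `T`. `avoid` merges
      -- these into one, which is possible because |U| = Q does not exceed the order of `K`.
      λ-exists : ∃[ α ] ((Φ α × (∀ {P} → P ∈ D → α P ≡ K.0#)) × (∀ {P} → P ∈ U → α P ≢ K.0#))
      λ-exists = K.avoid 𝒜 𝒜-comb zero∈𝒜 U (ℕₚ.≤-reflexive (trans |U|≡ (sym order-K))) sep
        where
        𝒜 : (Point n → K.Carrier) → Set
        𝒜 α = Φ α × (∀ {P} → P ∈ D → α P ≡ K.0#)
        𝒜-comb : ∀ {α β} t → 𝒜 α → 𝒜 β → 𝒜 (λ P → α P K.+ t K.* β P)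
        𝒜-comb t (Φα , zα) (Φβ , zβ) = comb t Φα Φβ , λ P∈ → trans (cong₂ (λ x y → x K.+ t K.* y) (zα P∈) (zβ P∈))
          (trans (K.+-identityˡ _) (K.zeroʳ t))
        zero∈𝒜 : 𝒜 (λ _ → K.0#)
        zero∈𝒜 = ((λ _ → K.0#) , Linearᴷ-zero , λ _ → refl) , λ _ → refl
        sep : ∀ {P} → P ∈ U → ∃[ α ] (𝒜 α × α P ≢ K.0#)
        sep {P} P∈ = pick (Finₚ.any? (λ i → ¬? (A.functional i (toVec P) ≟ 0#)))
          where
          pick : Dec (∃[ i ] (A.functional i (toVec P) ≢ 0#)) → ∃[ α ] (𝒜 α × α P ≢ K.0#)
          pick (no none) = ⊥-elim (U⊈T P∈ (A.separates (λ i → decidable-stable (A.functional i (toVec P) ≟ 0#) (λ ne → none (i , ne)))))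
          pick (yes (i , ne)) = (λ R → extend (A.functional i) (toVec R)) ,
            ((_ , extend-linear (A.linear i) , λ _ → refl) , λ {R} R∈ → ⇒extend≡0 (A.functional i) (toVec R) (A.kills (D⊆T R∈) i)) , λ e → ne (extend≡0⇒ (A.functional i) (toVec P) e)

      module I = K.Intersections _≟ᴾ_ Φ comb separating D U U-unique (trans |U|≡ (sym order-K))
        (ℕₚ.≤-trans 2|D|≤ (ℕₚ.≤-reflexive (sym order-K))) blocking essential
        (proj₁ (proj₁ (proj₂ λ-exists))) (proj₂ (proj₁ (proj₂ λ-exists))) (proj₂ (proj₂ λ-exists))

      -- Exactly one part contributes: without a zero on `D` the points of `U` count 1, and with a
      -- single zero on `D` they count 0.
      base : ∀ {ρ} → AllLinear ρ → (∀ {P R} → P ∈ D → R ∈ D → Zero ρ P → Zero ρ R → P ≡ R) → N ρ ≡ 1#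
      base {ρ} lin unique-zero = trans (∑-++ D U _) (by (Any.any? (zero? ρ) D))
        where
        φ : Point n → K.Carrier
        φ P = assemble ρ (toVec P)
        Φφ : Φ φ
        Φφ = assemble ρ , assemble-linear lin , λ _ → refl
        transfer : K.∑ U (λ u → K.δ (φ u) K.0#) ≡ scalar (∑ U (λ u → ind (zero? ρ u)))
        transfer = trans (K.∑-cong U (λ u → trans (K.ind-⇔ (φ u K.≟ K.0#) (zero? ρ u) (assemble≡0⇒ ρ (toVec u)) (⇒assemble≡0 ρ (toVec u))) (scalar-ind (zero? ρ u))))
          (scalar-∑ U (λ u → ind (zero? ρ u)))
        by : Dec (Any.Any (Zero ρ) D) → ∑ D (λ P → ind (zero? ρ P)) + ∑ U (λ P → ind (zero? ρ P)) ≡ 1#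
        by (no none) = trans (cong₂ _+_
            (trans (∑-cong∈ D (λ {P} P∈ → ind-no (zero? ρ P) (λ z → none (lose P∈ z)))) (∑-zero D))
            (scalar≡1 (trans (sym transfer) (I.off-D⇒one Φφ (λ {P} P∈ e → none (lose P∈ (assemble≡0⇒ ρ (toVec P) e))))))) (+-identityˡ 1#)
        by (yes some) = let P , P∈ , z = find some in trans (cong₂ _+_
            (once P P∈ z D D-unique P∈ (λ R∈ → R∈))
            (scalar≡0 (trans (sym transfer) (I.on-D⇒zero Φφ P∈ (⇒assemble≡0 ρ (toVec P) z))))) (+-identityʳ 1#)
          where
          others : ∀ P → P ∈ D → Zero ρ P → ∀ xs → P ∉ xs → (∀ {R} → R ∈ xs → R ∈ D) → ∑ xs (λ R → ind (zero? ρ R)) ≡ 0#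
          others P P∈ z xs P∉ sub = trans (∑-cong∈ xs (λ {R} R∈ → ind-no (zero? ρ R) (λ z′ → P∉ (subst (_∈ xs) (unique-zero (sub R∈) P∈ z′ z) R∈)))) (∑-zero xs)
          once : ∀ P → P ∈ D → Zero ρ P → ∀ xs → Unique xs → P ∈ xs → (∀ {R} → R ∈ xs → R ∈ D) → ∑ xs (λ R → ind (zero? ρ R)) ≡ 1#
          once P P∈ z (x ∷ xs) u (here refl) sub = trans (cong₂ _+_ (ind-yes (zero? ρ P) z) (others P P∈ z xs (Unique[x∷xs]⇒x∉xs u) (sub ∘ there))) (+-identityʳ 1#)
          once P P∈ z (x ∷ xs) u@(_ ∷ u′) (there P∈xs) sub = trans (cong₂ _+_
            (ind-no (zero? ρ x) (λ zx → Unique[x∷xs]⇒x∉xs u (subst (_∈ xs) (unique-zero P∈ (sub (here refl)) z zx) P∈xs)))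
            (once P P∈ z xs u′ P∈xs (sub ∘ there))) (+-identityˡ 1#)

    -- An extension of degree m is only found up to double negation, which suffices as N ρ ≡ 1# is decidable.
    one-mod-p : ∀ {ρ} → AllLinear ρ → N ρ ≡ 1#
    one-mod-p {ρ} lin = decidable-stable (N ρ ≟ 1#) (λ ne → ShiftModule.¬¬extension F {h = h} pr q≡p^h m 1≤m (λ E → ne (N≡1 (base E) lin)))

-- Codes modulo p: orthogonality and weight.

module Codewords (F : FiniteField) {p h : ℕ} .{{_ : NonZero p}} (pr : Prime p) (q≡p^h : FiniteField.order F ≡ p ℕ.^ h) where
  open Geometry F
  open PG F using (χ; χS; ⟨_,_⟩; sumℤ; InC⊥; weight; Word; ∣_∣; _∩S_)
  open Characteristic {h = h} pr q≡p^h using (p≡0; ⟦n⟧≡0⇒p∣n)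

  ⟦%⟧ : ∀ z → ⟦ z %ℕ p ⟧ ≡ ⟦ z ⟧ℤ
  ⟦%⟧ z = sym (begin
    ⟦ z ⟧ℤ ≡⟨ cong ⟦_⟧ℤ (ℤDivMod.a≡a%ℕn+[a/ℕn]*n z p) ⟩
    ⟦ ℤ.+ (z %ℕ p) ℤ.+ (z ℤ./ℕ p) ℤ.* ℤ.+ p ⟧ℤ ≡⟨ ℤ-+-homo (ℤ.+ (z %ℕ p)) ((z ℤ./ℕ p) ℤ.* ℤ.+ p) ⟩
    ⟦ z %ℕ p ⟧ + ⟦ (z ℤ./ℕ p) ℤ.* ℤ.+ p ⟧ℤ ≡⟨ cong (⟦ z %ℕ p ⟧ +_) (trans (ℤ-*-homo (z ℤ./ℕ p) (ℤ.+ p)) (trans (cong (⟦ z ℤ./ℕ p ⟧ℤ *_) p≡0) (zeroʳ _))) ⟩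
    ⟦ z %ℕ p ⟧ + 0# ≡⟨ +-identityʳ _ ⟩
    ⟦ z %ℕ p ⟧ ∎)
    where open ≡-Reasoning

  %≡⇒⟦⟧≡ : ∀ {a b} → a %ℕ p ≡ b %ℕ p → ⟦ a ⟧ℤ ≡ ⟦ b ⟧ℤ
  %≡⇒⟦⟧≡ {a} {b} e = trans (sym (⟦%⟧ a)) (trans (cong ⟦_⟧ e) (⟦%⟧ b))

  ⟦⟧≡0⇒%≡0 : ∀ {z} → ⟦ z ⟧ℤ ≡ 0# → z %ℕ p ≡ 0
  ⟦⟧≡0⇒%≡0 {z} e = small (z %ℕ p) (ℤDivMod.n%ℕd<d z p) (⟦n⟧≡0⇒p∣n (trans (⟦%⟧ z) e))
    where
    small : ∀ r → r ℕ.< p → p Div.∣ r → r ≡ 0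
    small zero _ _ = refl
    small (suc r) r<p d = ⊥-elim (ℕₚ.<⇒≱ r<p (Div.∣⇒≤ d))

  %≡0⇒⟦⟧≡0 : ∀ {z} → z %ℕ p ≡ 0 → ⟦ z ⟧ℤ ≡ 0#
  %≡0⇒⟦⟧≡0 {z} e = trans (sym (⟦%⟧ z)) (cong ⟦_⟧ e)

  module _ {n : ℕ} where

    private
      points = allPoints n

    ⟦⟨,⟩⟧ : ∀ (c c′ : Word n) → ⟦ ⟨ c , c′ ⟩ ⟧ℤ ≡ ∑ points (λ P → ⟦ c P ⟧ℤ * ⟦ c′ P ⟧ℤ)
    ⟦⟨,⟩⟧ c c′ = go points
      where
      go : ∀ ps → ⟦ sumℤ (List.map (λ P → c P ℤ.* c′ P) ps) ⟧ℤ ≡ ∑ ps (λ P → ⟦ c P ⟧ℤ * ⟦ c′ P ⟧ℤ)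
      go [] = refl
      go (P ∷ ps) = trans (ℤ-+-homo (c P ℤ.* c′ P) _) (cong₂ _+_ (ℤ-*-homo (c P) (c′ P)) (go ps))

    ⟦sum⟧ : ∀ {A : Set} (gs : List A) (f : A → ℤ) → ⟦ sumℤ (List.map f gs) ⟧ℤ ≡ ∑ gs (λ g → ⟦ f g ⟧ℤ)
    ⟦sum⟧ [] f = refl
    ⟦sum⟧ (g ∷ gs) f = trans (ℤ-+-homo (f g) _) (cong (⟦ f g ⟧ℤ +_) (⟦sum⟧ gs f))

    -- Read in the field, a codeword equals a combination of incidence vectors of subspaces, so
    -- exchanging the sums over points and generators reduces orthogonality to single subspaces.
    orthogonal : ∀ {k} (c : Word n) → (∀ S → ∑ points (λ P → ⟦ c P ⟧ℤ * ⟦ χS {d = k} S P ⟧ℤ) ≡ 0#) → InC⊥ p n k c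
    orthogonal {k} c ⊥S c′ (gens , e) = trans (⟦⟧≡0⇒%≡0 {⟨ c , c′ ⟩} (begin
        ⟦ ⟨ c , c′ ⟩ ⟧ℤ
          ≡⟨ ⟦⟨,⟩⟧ c c′ ⟩
        ∑ points (λ P → ⟦ c P ⟧ℤ * ⟦ c′ P ⟧ℤ)
          ≡⟨ ∑-cong points (λ P → cong (⟦ c P ⟧ℤ *_) (trans (%≡⇒⟦⟧≡ {c′ P} {sumℤ (List.map (λ g → proj₁ g ℤ.* χS (proj₂ g) P) gens)} (e P)) (trans (⟦sum⟧ gens (λ g → proj₁ g ℤ.* χS (proj₂ g) P)) (∑-cong gens (λ g → ℤ-*-homo (proj₁ g) (χS (proj₂ g) P)))))) ⟩
        ∑ points (λ P → ⟦ c P ⟧ℤ * ∑ gens (λ g → ⟦ proj₁ g ⟧ℤ * ⟦ χS (proj₂ g) P ⟧ℤ))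
          ≡⟨ ∑-cong points (λ P → sym (∑-* gens ⟦ c P ⟧ℤ _)) ⟩
        ∑ points (λ P → ∑ gens (λ g → ⟦ c P ⟧ℤ * (⟦ proj₁ g ⟧ℤ * ⟦ χS (proj₂ g) P ⟧ℤ)))
          ≡⟨ ∑-swap points gens _ ⟩
        ∑ gens (λ g → ∑ points (λ P → ⟦ c P ⟧ℤ * (⟦ proj₁ g ⟧ℤ * ⟦ χS (proj₂ g) P ⟧ℤ)))
          ≡⟨ ∑-cong gens (λ g → trans (trans (∑-cong points (λ P → solve 3 (λ c a s → c :* (a :* s) := a :* (c :* s)) refl ⟦ c P ⟧ℤ ⟦ proj₁ g ⟧ℤ ⟦ χS (proj₂ g) P ⟧ℤ))
               (∑-* points ⟦ proj₁ g ⟧ℤ (λ P → ⟦ c P ⟧ℤ * ⟦ χS (proj₂ g) P ⟧ℤ))) (trans (cong (⟦ proj₁ g ⟧ℤ *_) (⊥S (proj₂ g))) (zeroʳ _))) ⟩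
        ∑ gens (λ _ → 0#)
          ≡⟨ ∑-zero gens ⟩
        0# ∎)) (sym (⟦⟧≡0⇒%≡0 {ℤ.+ 0} refl))
      where
      open ≡-Reasoning
      open Solver

    ⟦if⟧ : ∀ b → ⟦ (if b then ℤ.+ 1 else ℤ.+ 0) ⟧ℤ ≡ ind (b Bool.≟ true)
    ⟦if⟧ true = +-identityʳ 1#
    ⟦if⟧ false = refl

    ind-∧ : ∀ a b → ind ((a ∧ b) Bool.≟ true) ≡ ind (a Bool.≟ true) * ind (b Bool.≟ true)
    ind-∧ true b = sym (*-identityˡ _)
    ind-∧ false b = sym (zeroˡ _)

    -- The `m` equations of `S`, imposed on the m + 1 basis vectors of `T`, leave a kernel of
    -- positive rank; the intersection is thus a nonempty subspace and has 1 mod p points.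
    subspaces-meet : ∀ {m k} → m ℕ.+ k ≡ n → (T : Subspace n m) (S : Subspace n k) →
                     ∑ points (λ P → ind ((P ∈S T) Bool.≟ true) * ind ((P ∈S S) Bool.≟ true)) ≡ 1#
    subspaces-meet {m} {k} eq T S = trans (∑-cong points (λ P → sym (ind-∧ (P ∈S T) (P ∈S S))))
      (trans (∑-ind (λ P → ((P ∈S T) ∧ (P ∈S S)) Bool.≟ true) points)
        (count (kernel (Subspace.basis T) (Subspace.indep T) m A.linear)))
      where
      module A = Annihilator (annihilatorOf eq S)
      count : Kernel (Subspace.basis T) (λ w → ∀ i → A.functional i w ≡ 0#) m →
              ⟦ length (filter (λ P → ((P ∈S T) ∧ (P ∈S S)) Bool.≟ true) points) ⟧ ≡ 1#
      count record { rank = zero ; rank-≥ = le } = ⊥-elim (ℕₚ.1+n≰n (subst (suc m ℕ.≤_) (ℕₚ.+-identityʳ m) le))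
      count record { rank = suc r ; basis = us ; independent = ind ; in-span = sub ; killed = z ; complete-span = full } =
        trans (cong ⟦_⟧ (trans (count-span us ind (λ P → (P ∈S T) ∧ (P ∈S S)) (λ P → mk⇔
          (λ e → let t , s = ∧-true e in full (∈S⇒InSpan T {P} t) (A.kills (∈S⇒InSpan S {P} s)))
          (λ h → cong₂ _∧_ (InSpan⇒∈S T {P} (sub h)) (InSpan⇒∈S S {P} (A.separates (z h)))))) (length-allNVecs r))) (⟦θ⟧ r)

    subspace-size : ∀ {d} (T : Subspace n d) → length (filter (λ P → (P ∈S T) Bool.≟ true) points) ≡ θ order d
    subspace-size {d} T = trans (count-span (Subspace.basis T) (Subspace.indep T) (_∈S T)
      (λ P → mk⇔ (∈S⇒InSpan T {P}) (InSpan⇒∈S T {P}))) (length-allNVecs d)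

    χ-difference : Bool → Bool → ℤ
    χ-difference b t = (if b then ℤ.+ 1 else ℤ.+ 0) ℤ.- (if t then ℤ.+ 1 else ℤ.+ 0)

    ⟦χ-difference⟧ : ∀ b t → ⟦ χ-difference b t ⟧ℤ ≡ ind (b Bool.≟ true) + - ind (t Bool.≟ true)
    ⟦χ-difference⟧ b t = trans (ℤ-+-homo (if b then ℤ.+ 1 else ℤ.+ 0) _)
      (cong₂ _+_ (⟦if⟧ b) (trans (ℤ-neg-homo (if t then ℤ.+ 1 else ℤ.+ 0)) (cong -_ (⟦if⟧ t))))

    module _ (b t : Point n → Bool) where
      private
        nonzero? : ∀ P → Dec (¬ (χ-difference (b P) (t P) %ℕ p ≡ 0))
        nonzero? P = ¬? ((χ-difference (b P) (t P) %ℕ p) ℕ.≟ 0)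
        #b #t #bt #b¬t #≠ : List (Point n) → ℕ
        #b ps = length (filter (λ P → b P Bool.≟ true) ps)
        #t ps = length (filter (λ P → t P Bool.≟ true) ps)
        #bt ps = length (filter (λ P → (b P ∧ t P) Bool.≟ true) ps)
        #b¬t ps = length (filter (λ P → (b P ∧ not (t P)) Bool.≟ true) ps)
        #≠ ps = length (filter nonzero? ps)

        1≢0 : 1# ≢ 0#
        1≢0 e = 0≢1 (sym e)

        difference-zero : ∀ b → χ-difference b b %ℕ p ≡ 0
        difference-zero b = ⟦⟧≡0⇒%≡0 {χ-difference b b} (trans (⟦χ-difference⟧ b b) (-‿inverseʳ _))

        true-false : χ-difference true false %ℕ p ≢ 0
        true-false e = 1≢0 (trans (sym (+-identityʳ 1#)) (%≡0⇒⟦⟧≡0 {χ-difference true false} e))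

        false-true : χ-difference false true %ℕ p ≢ 0
        false-true e = 1≢0 (trans (sym (-‿involutive 1#)) (trans (cong -_ (trans (sym (trans (⟦χ-difference⟧ false true) (+-identityˡ _)))
          (%≡0⇒⟦⟧≡0 {χ-difference false true} e))) -0≡0))

      |b|-split : ∀ ps → #b ps ≡ #bt ps ℕ.+ #b¬t ps
      |b|-split [] = refl
      |b|-split (P ∷ ps) = begin
        #b (P ∷ ps) ≡⟨ length-filter-∷ (λ P → b P Bool.≟ true) P ps ⟩
        bit (b P Bool.≟ true) ℕ.+ #b ps ≡⟨ cong₂ ℕ._+_ (pointwise (b P) (t P)) (|b|-split ps) ⟩
        (bit ((b P ∧ t P) Bool.≟ true) ℕ.+ bit ((b P ∧ not (t P)) Bool.≟ true)) ℕ.+ (#bt ps ℕ.+ #b¬t ps)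
          ≡⟨ ℕS.solve 4 (λ x y u v → (x ℕS.:+ y) ℕS.:+ (u ℕS.:+ v) ℕS.:= (x ℕS.:+ u) ℕS.:+ (y ℕS.:+ v)) refl (bit ((b P ∧ t P) Bool.≟ true)) _ (#bt ps) _ ⟩
        (bit ((b P ∧ t P) Bool.≟ true) ℕ.+ #bt ps) ℕ.+ (bit ((b P ∧ not (t P)) Bool.≟ true) ℕ.+ #b¬t ps)
          ≡⟨ cong₂ ℕ._+_ (length-filter-∷ (λ P → (b P ∧ t P) Bool.≟ true) P ps) (length-filter-∷ (λ P → (b P ∧ not (t P)) Bool.≟ true) P ps) ⟨
        #bt (P ∷ ps) ℕ.+ #b¬t (P ∷ ps) ∎
        where
        open ≡-Reasoning
        pointwise : ∀ b t → bit (b Bool.≟ true) ≡ bit ((b ∧ t) Bool.≟ true) ℕ.+ bit ((b ∧ not t) Bool.≟ true)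
        pointwise true true = refl
        pointwise true false = refl
        pointwise false t = refl

      -- The entries are 0, 1 and -1, and the last two stay nonzero modulo every prime, 2 included.
      -- So the weight is the size of the symmetric difference, and each common point accounts for
      -- the 2 missing from |B| + |T|.
      weight-count : ∀ ps → #≠ ps ℕ.+ (#bt ps ℕ.+ #bt ps) ≡ #b ps ℕ.+ #t ps
      weight-count [] = refl
      weight-count (P ∷ ps) = begin
        #≠ (P ∷ ps) ℕ.+ (#bt (P ∷ ps) ℕ.+ #bt (P ∷ ps))
          ≡⟨ cong₂ (λ u v → u ℕ.+ (v ℕ.+ v)) (length-filter-∷ nonzero? P ps) (length-filter-∷ (λ P → (b P ∧ t P) Bool.≟ true) P ps) ⟩
        (n₀ ℕ.+ #≠ ps) ℕ.+ ((m₀ ℕ.+ #bt ps) ℕ.+ (m₀ ℕ.+ #bt ps))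
          ≡⟨ ℕS.solve 4 (λ x y u v → (x ℕS.:+ y) ℕS.:+ ((u ℕS.:+ v) ℕS.:+ (u ℕS.:+ v)) ℕS.:= (x ℕS.:+ (u ℕS.:+ u)) ℕS.:+ (y ℕS.:+ (v ℕS.:+ v))) refl n₀ (#≠ ps) m₀ (#bt ps) ⟩
        (n₀ ℕ.+ (m₀ ℕ.+ m₀)) ℕ.+ (#≠ ps ℕ.+ (#bt ps ℕ.+ #bt ps))
          ≡⟨ cong₂ ℕ._+_ (pointwise (b P) (t P) (nonzero? P)) (weight-count ps) ⟩
        (bit (b P Bool.≟ true) ℕ.+ bit (t P Bool.≟ true)) ℕ.+ (#b ps ℕ.+ #t ps)
          ≡⟨ ℕS.solve 4 (λ x y u v → (x ℕS.:+ y) ℕS.:+ (u ℕS.:+ v) ℕS.:= (x ℕS.:+ u) ℕS.:+ (y ℕS.:+ v)) refl (bit (b P Bool.≟ true)) _ (#b ps) _ ⟩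
        (bit (b P Bool.≟ true) ℕ.+ #b ps) ℕ.+ (bit (t P Bool.≟ true) ℕ.+ #t ps)
          ≡⟨ cong₂ ℕ._+_ (length-filter-∷ (λ P → b P Bool.≟ true) P ps) (length-filter-∷ (λ P → t P Bool.≟ true) P ps) ⟨
        #b (P ∷ ps) ℕ.+ #t (P ∷ ps) ∎
        where
        open ≡-Reasoning
        n₀ = bit (nonzero? P)
        m₀ = bit ((b P ∧ t P) Bool.≟ true)
        pointwise : ∀ b t (d : Dec (¬ (χ-difference b t %ℕ p ≡ 0))) →
                    bit d ℕ.+ (bit ((b ∧ t) Bool.≟ true) ℕ.+ bit ((b ∧ t) Bool.≟ true)) ≡ bit (b Bool.≟ true) ℕ.+ bit (t Bool.≟ true)
        pointwise true true (yes ne) = ⊥-elim (ne (difference-zero true))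
        pointwise true true (no _) = refl
        pointwise true false (yes _) = refl
        pointwise true false (no e) = ⊥-elim (e true-false)
        pointwise false true (yes _) = refl
        pointwise false true (no e) = ⊥-elim (e false-true)
        pointwise false false (yes ne) = ⊥-elim (ne (difference-zero false))
        pointwise false false (no _) = refl

-- The difference of the incidence vectors: orthogonality and weight.

module Theorem (F : FiniteField) {p h : ℕ} .{{_ : NonZero p}} (pr : Prime p) (q≡p^h : FiniteField.order F ≡ p ℕ.^ h)
  {n m k : ℕ} (m+k≡n : m ℕ.+ k ≡ n) (1≤m : 1 ℕ.≤ m)
  {B : PG.PointSet F n} (minimal : PG.MinimalBlocking F n k B) {x : ℕ} (|B|≡ : PG.∣_∣ F B ≡ FiniteField.order F ℕ.^ m ℕ.+ x)
  (2x< : 2 ℕ.* x ℕ.< FiniteField.order F ℕ.^ m ℕ.+ 1) (T : PG.Subspace F n m) (|B∩T|≡ : PG.∣_∣ F (PG._∩S_ F B T) ≡ x) where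
  open Geometry F
  open PG F using (χ; χS; InC⊥; weight)
  open Codewords F {h = h} pr q≡p^h
  open OneModP F {h = h} pr q≡p^h m+k≡n 1≤m B T

  private
    points = allPoints n
    Q = order ℕ.^ m

    |U|≡Q : length U ≡ Q
    |U|≡Q = ℕₚ.+-cancelˡ-≡ x _ _ (trans (cong (ℕ._+ length U) (sym |B∩T|≡))
      (trans (sym (|b|-split B (_∈S T) points)) (trans |B|≡ (ℕₚ.+-comm Q x))))

    2|D|≤Q : length D ℕ.+ length D ℕ.≤ Q
    2|D|≤Q = subst (λ d → d ℕ.+ d ℕ.≤ Q) (sym |B∩T|≡) (ℕₚ.≤-pred (ℕₚ.≤-trans
      (subst (λ y → suc (x ℕ.+ y) ℕ.≤ Q ℕ.+ 1) (ℕₚ.+-identityʳ x) 2x<) (ℕₚ.≤-reflexive (ℕₚ.+-comm Q 1))))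

  -- Splitting `B` into `D` and `U` turns the count of points on `S` into the number `N` of common
  -- zeros of the annihilator of `S`.
  B-meets : ∀ (S : Subspace n k) → ∑ points (λ P → ind (B P Bool.≟ true) * ind ((P ∈S S) Bool.≟ true)) ≡ 1#
  B-meets S = trans (trans (∑-cong points pointwise) (sym (trans (cong₂ _+_ (∑-filter (λ P → inT P Bool.≟ true) points f) (∑-filter (λ P → offT P Bool.≟ true) points f))
      (sym (∑-+ points _ _))))) (trans (sym (∑-++ D U f)) (trans (∑-cong (D ++ U) (λ P → ind-⇔ ((P ∈S S) Bool.≟ true) (zero? A.functional P)
        (λ s → A.kills (∈S⇒InSpan S {P} s)) (λ z → InSpan⇒∈S S {P} (A.separates z)))) (one-mod-p minimal 2|D|≤Q |U|≡Q A.linear)))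
    where
    module A = Annihilator (annihilatorOf m+k≡n S)
    f : Point n → Carrier
    f P = ind ((P ∈S S) Bool.≟ true)
    split : ∀ b t → ind (b Bool.≟ true) ≡ ind ((b ∧ t) Bool.≟ true) + ind ((b ∧ not t) Bool.≟ true)
    split true true = sym (+-identityʳ 1#)
    split true false = sym (+-identityˡ 1#)
    split false t = sym (+-identityˡ 0#)
    pointwise : ∀ P → ind (B P Bool.≟ true) * f P ≡ ind (inT P Bool.≟ true) * f P + ind (offT P Bool.≟ true) * f P
    pointwise P = trans (cong (_* f P) (split (B P) (P ∈S T))) (distribʳ (f P) _ _)

  codeword : InC⊥ p n k (λ P → χ B P ℤ.- χS T P)
  codeword = orthogonal (λ P → χ B P ℤ.- χS T P) λ S → begin
    ∑ points (λ P → ⟦ χ B P ℤ.- χS T P ⟧ℤ * ⟦ χS S P ⟧ℤ)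
      ≡⟨ ∑-cong points (λ P → trans (cong₂ _*_ (⟦χ-difference⟧ {n} (B P) (P ∈S T)) (⟦if⟧ {n} (P ∈S S)))
           (solve 3 (λ b t s → (b :- t) :* s := b :* s :+ :- t :* s) refl (ind (B P Bool.≟ true)) (ind ((P ∈S T) Bool.≟ true)) (ind ((P ∈S S) Bool.≟ true)))) ⟩
    ∑ points (λ P → ind (B P Bool.≟ true) * ind ((P ∈S S) Bool.≟ true) + - ind ((P ∈S T) Bool.≟ true) * ind ((P ∈S S) Bool.≟ true))
      ≡⟨ ∑-+ points _ _ ⟩
    ∑ points (λ P → ind (B P Bool.≟ true) * ind ((P ∈S S) Bool.≟ true)) + ∑ points (λ P → - ind ((P ∈S T) Bool.≟ true) * ind ((P ∈S S) Bool.≟ true))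
      ≡⟨ cong₂ _+_ (B-meets S) (trans (∑-cong points (λ P → solve 3 (λ o t s → :- t :* s := :- (t :* s)) refl 1# (ind ((P ∈S T) Bool.≟ true)) (ind ((P ∈S S) Bool.≟ true)))) (∑-neg points _)) ⟩
    1# + - ∑ points (λ P → ind ((P ∈S T) Bool.≟ true) * ind ((P ∈S S) Bool.≟ true))
      ≡⟨ cong (λ z → 1# + - z) (subspaces-meet m+k≡n T S) ⟩
    1# + - 1#
      ≡⟨ -‿inverseʳ 1# ⟩
    0# ∎
    where
    open ≡-Reasoning
    open Solver
    ∑-neg : ∀ {A : Set} (xs : List A) f → ∑ xs (λ x → - f x) ≡ - ∑ xs f
    ∑-neg [] f = sym -0≡0
    ∑-neg (x ∷ xs) f = trans (cong (- f x +_) (∑-neg xs f)) (-‿+-comm _ _)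

  weight≡ : weight p (λ P → χ B P ℤ.- χS T P) ≡ 2 ℕ.* Q ℕ.+ θ order (m ℕ.∸ 1) ℕ.∸ x
  -- Truncated subtraction is avoided: W + 2x = (Q + x) + |T| is proved first, one `x` is cancelled,
  -- and only then is the other moved to the right as `∸ x`.
  weight≡ = trans (sym (ℕₚ.m+n∸n≡m W x)) (cong (ℕ._∸ x) (ℕₚ.+-cancelʳ-≡ x _ _ (begin
    W ℕ.+ x ℕ.+ x ≡⟨ ℕₚ.+-assoc W x x ⟩
    W ℕ.+ (x ℕ.+ x) ≡⟨ cong (λ d → W ℕ.+ (d ℕ.+ d)) |B∩T|≡ ⟨
    W ℕ.+ (length D ℕ.+ length D) ≡⟨ weight-count B (_∈S T) points ⟩
    PG.∣_∣ F B ℕ.+ _ ≡⟨ cong₂ ℕ._+_ |B|≡ (trans (subspace-size T) (θ-split 1≤m)) ⟩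
    (Q ℕ.+ x) ℕ.+ (Q ℕ.+ θ order (m ℕ.∸ 1)) ≡⟨ ℕS.solve 3 (λ Q x t → (Q ℕS.:+ x) ℕS.:+ (Q ℕS.:+ t) ℕS.:= ℕS.con 2 ℕS.:* Q ℕS.:+ t ℕS.:+ x) refl Q x _ ⟩
    2 ℕ.* Q ℕ.+ θ order (m ℕ.∸ 1) ℕ.+ x ∎)))
    where
    open ≡-Reasoning
    W = weight p (λ P → χ B P ℤ.- χS T P)
    θ-split : ∀ {m} → 1 ℕ.≤ m → θ order m ≡ order ℕ.^ m ℕ.+ θ order (m ℕ.∸ 1)
    θ-split {suc m} _ = refl

open import Data.Nat using (_+_; _*_; _∸_; _^_; _≤_; _<_)
open import Data.Integer using (_-_)

theorem4p6 : (F : FiniteField) → let open PG F in let q = FiniteField.order F in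
    (p h : ℕ) .{{_ : NonZero p}} → Prime p → q ≡ p ^ h →
    (n k : ℕ) → 2 ≤ n → 1 ≤ k → k ≤ n ∸ 1 →
    (B : PointSet n) → MinimalBlocking n k B →
    (x : ℕ) → ∣ B ∣ ≡ q ^ (n ∸ k) + x → 2 * x < q ^ (n ∸ k) + 1 →
    (T : Subspace n (n ∸ k)) → ∣ B ∩S T ∣ ≡ x →
    InC⊥ p n k (λ P → χ B P - χS T P)
    × weight p (λ P → χ B P - χS T P) ≡ 2 * q ^ (n ∸ k) + θ q (n ∸ k ∸ 1) ∸ x
theorem4p6 F p h pr q≡p^h n k 2≤n 1≤k k≤n-1 B minimal x |B|≡ 2x< T |B∩T|≡ = codeword , weight≡
  where
  k<n : k < n
  k<n = ℕₚ.≤-trans (s≤s k≤n-1) (ℕₚ.≤-reflexive (ℕₚ.m+[n∸m]≡n (ℕₚ.<⇒≤ 2≤n)))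
  open Theorem F {h = h} pr q≡p^h (ℕₚ.m∸n+n≡m (ℕₚ.<⇒≤ k<n)) (ℕₚ.m<n⇒0<n∸m k<n) minimal |B|≡ 2x< T |B∩T|≡
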